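{- Let $\sigma$ be a signature, let $M$ be a finite, non-empty set of integers $m\ge2$, and let $q,k,d\in\mathbb{N}$. Every $\varphi\in\mathsf{FO{+}MOD}^+_M(q,k,d)$ is equivalent (on all $\sigma$-structures) to a formula $\varphi'$ in Gaifman normal form for $\mathsf{FO{+}MOD}^+_M(q,k,d)$, i.e. a Boolean combination of local formulas in $\mathsf{FO{+}MOD}^+_M(q,k,d)$, of basic local sentences for $\mathsf{FO{+}MOD}^+_M(q,k,d)$, and of local modulo-counting sentences for $\mathsf{FO{+}MOD}^+_M(q,k,d)$. Furthermore, $\varphi'$ can be chosen such that: 1. $\mathrm{free}(\varphi')=\mathrm{free}(\varphi)$; 2. the outer quantifier rank of $\varphi'$ is at most $\mathrm{qr}(\varphi)$ and its inner quantifier rank is at most $\mathrm{qr}(\varphi)-1$; 3. the outer radius of $\varphi'$ is at most $\mathrm{r}_1(q,k,d)$ and its inner radius is at most $\mathrm{r}_1(q-1,k+1,d)$; 4. the width of $\varphi'$ is at most $k+q$ and its inner distance is at most $\mathrm{r}_1(q,k,d)+2\,\mathrm{r}_1(q-1,k+1,d)$. Moreover, such a $\varphi'$ can be computed from $\varphi,q,k,d$.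
   Context: A signature $\sigma$ is a finite set of relation symbols with arities in $\mathbb N$ (arity 0 allowed); $\sigma$-structures are relational with finite non-empty universe. The Gaifman graph of $\mathcal A$ has vertex set $A$ and an edge between distinct $a,b$ iff both occur in a common tuple of some relation of $\mathcal A$; $\mathrm{dist}^{\mathcal A}$ is the distance in it ($\infty$ if disconnected). For a non-empty tuple $\bar a$, $\mathcal N_r^{\mathcal A}(\bar a)$ is the induced substructure on the set of elements at distance $\le r$ from some entry of $\bar a$. $\mathsf{FO}^+$ is first-order logic (with atoms $\mathsf{true},\mathsf{false}$, equalities, relational atoms) extended by distance atoms $\mathrm{dist}(x,y)\le d$ for constants $d\in\mathbb N$. $\mathsf{FO{+}MOD}^+_M$ additionally has modulo-counting quantifiers $\exists^{i\,\mathrm{mod}\,m}x$ for $m\in M$, $i\in\{0,\dots,m-1\}$: $\exists^{i\,\mathrm{mod}\,m}x\,\varphi$ says that the number of elements $a$ that can be assigned to $x$ so that $\varphi$ holds is congruent to $i$ modulo $m$. $\mathrm{qr}(\varphi)$ is the maximum nesting depth of quantifiers of both kinds (distance atoms are quantifier-free); $\mathrm{md}(\varphi)$ is the least $r\in\mathbb N$ such that $r'\le r$ for all distance atoms $\mathrm{dist}(x,y)\le r'$ in $\varphi$. $\mathrm{dist}(x,y)>r$ abbreviates $\neg\,\mathrm{dist}(x,y)\le r$. A formula $\varphi$ is $r$-local if for some non-empty tuple $\bar x$ of variables containing all its free variables, all structures $\mathcal A$ and all $\bar a\in A^{|\bar x|}$: $\mathcal A\models\varphi(\bar a)\iff\mathcal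 N_r^{\mathcal A}(\bar a)\models\varphi(\bar a)$; it is local if it is $r$-local for some $r\in\mathbb N$. Radius function: $\mathrm r_1(0,k,d)=\max\{d,1\}$, $\mathrm r_1(q+1,k,d)=4k\cdot\mathrm r_1(q,k+1,d)$ for $q,k,d\in\mathbb N$. Let $x_1,x_2,\dots$ be a fixed enumeration of the variables. Write $\mathsf M(q,k,d)$ for $\mathsf{FO{+}MOD}^+_M(q,k,d)$. $\mathsf M(0,k,d)$ is the set of all $\varphi\in\mathsf{FO}^+$ with $\mathrm{qr}(\varphi)=0$, $\mathrm{free}(\varphi)\subseteq\{x_1,\dots,x_k\}$, $\mathrm{md}(\varphi)\le d$. $\mathsf M(q+1,k,d)$ is the set of all $\varphi$ with $\mathrm{free}(\varphi)\subseteq\{x_1,\dots,x_k\}$ that are Boolean combinations of: (i) formulas in $\mathsf M(q,k+1,d)$ with free variables among $x_1,\dots,x_k$; (ii) $\mathrm{dist}(x_i,x_j)\le\tilde d$ with $i,j\in[k]$, $\tilde d\le\mathrm r_1(q+1,k,d)$; (iii) $\exists x_{k+1}(\mathrm{dist}(x_i,x_{k+1})\le\hat d\wedge\psi)$ with $\psi\in\mathsf M(q,k+1,d)$, $i\in[k]$, $\hat d\le\mathrm r_1(q+1,k,d)-\mathrm r_1(q,k+1,d)$; (iv) $\exists x_{k+1}\,\psi$ with $\psi\in\mathsf M(q,k+1,d)$; (v) $\exists^{i\,\mathrm{mod}\,m}x_{k+1}\,\psi$ with $\psi\in\mathsf M(q,k+1,d)$, $m\in M$, $i\in\{0,\dots,m-1\}$.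 A basic local sentence for $\mathsf M(q,k,d)$ of width $\ell$, inner distance $2r$, inner radius at most $\tilde r$, and inner quantifier rank $\mathrm{qr}(\lambda)$ is of the form $\exists y_1\cdots\exists y_\ell\big(\bigwedge_{1\le i<j\le\ell}\mathrm{dist}(y_i,y_j)>2r\wedge\bigwedge_{j\in[\ell]}\lambda(y_j)\big)$ with $\ell\ge1$, $r\ge\tilde r\ge0$, and $\lambda(x_1)\in\mathsf M(q-1,k+1,d)$ $\tilde r$-local with no free variable other than $x_1$. A local modulo-counting sentence for $\mathsf M(q,k,d)$ of inner radius at most $\tilde r$ and inner quantifier rank $\mathrm{qr}(\lambda)$ is of the form $\exists^{i\,\mathrm{mod}\,m}y\,\lambda(y)$ with $m\in M$, $i\in\{0,\dots,m-1\}$, $y$ a variable, and $\lambda(y)\in\mathsf M(q-1,k+1,d)$ $\tilde r$-local with $\mathrm{free}(\lambda)\subseteq\{y\}$. For $q=0$ there are no sentences of these two kinds. For a Boolean combination $\varphi'$ of local formulas (set $\mathcal L$) and basic local / local modulo-counting sentences (set $\mathcal S$): the outer quantifier rank is the maximum $\mathrm{qr}$ of formulas in $\mathcal L$; outer radius at most $r$ means every formula in $\mathcal L$ is $r$-local; inner quantifier rank and inner radius are the maxima over the sentences in $\mathcal S$; inner distance and width are the maxima over the basic local sentences in $\mathcal S$. Upper bounds on maxima over empty sets are vacuous. -}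

module Defs where

open import Data.Bool using (Bool; true; false; not; _∧_; _∨_; T; T?)
open import Data.Bool.ListAction using (any)
open import Data.Bool.Properties using (T-irrelevant; T-∨)
open import Data.Fin using (Fin; toℕ)
open import Data.Fin.Properties using (nonZeroIndex)
open import Data.List using (List; []; _∷_; _++_; [_]; map; foldr; allFin; filter; filterᵇ; length; cartesianProductWith)
open import Data.List.Membership.Propositional using (_∈_)
open import Data.List.Relation.Unary.All as All using (All)
open import Data.List.Relation.Unary.Any using (here; there)
open import Data.List.Relation.Unary.AllPairs using ([]; _∷_)
open import Data.List.Relation.Unary.Unique.Propositional using (Unique)
open import Data.Nat using (ℕ; zero; suc; _+_; _*_; _⊔_; _≤_; _<_; _%_; _≡ᵇ_)
import Data.Nat as ℕ
open import Data.Product using (Σ; ∃-syntax; _×_; _,_; proj₁)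
open import Data.Product.Properties using (≡-dec)
open import Data.Sum using (inj₁)
open import Data.Unit.Polymorphic using (⊤)
open import Data.Vec as Vec using (Vec; toList)
open import Function using (Equivalence)
open import Level using (Level)
open import Relation.Binary.Definitions using (DecidableEquality)
open import Relation.Binary.PropositionalEquality using (_≡_; refl; cong)
open import Relation.Nullary using (yes; no; ¬_; contradiction)
open import Relation.Nullary.Decidable using (⌊_⌋; ¬?; fromWitness)

private
  variable
    a p : Level

record Signature : Set where
  field
    symbols : ℕ
    arity   : Fin symbols → ℕ

-- The variable written x₍ᵢ₊₁₎ in the usual enumeration x₁, x₂, … is the number i.
-- Hence x₁, …, xₖ are the variables below k, and xₖ₊₁ is the variable k.
Var : Set
Var = ℕ

record Structure (σ : Signature) : Set₁ where
  open Signature σ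
  field
    Carrier   : Set
    _≟_       : DecidableEquality Carrier
    elements  : List Carrier
    complete  : ∀ a → a ∈ elements
    unique    : Unique elements
    inhabited : Carrier
    holds     : (R : Fin symbols) → Vec Carrier (arity R) → Bool

  tuples : (n : ℕ) → List (Vec Carrier n)
  tuples zero    = [ Vec.[] ]
  tuples (suc n) = cartesianProductWith Vec._∷_ elements (tuples n)

  occurs : ∀ {n} → Carrier → Vec Carrier n → Bool
  occurs a t = any (λ b → ⌊ a ≟ b ⌋) (toList t)

  gaifmanEdge : Carrier → Carrier → Bool
  gaifmanEdge a b =
    not ⌊ a ≟ b ⌋ ∧
    any (λ R → any (λ t → holds R t ∧ occurs a t ∧ occurs b t) (tuples (arity R)))
        (allFin symbols)

  -- dist(a, b) ≤ r: some path of at most r edges leads from a to b.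
  within : ℕ → Carrier → Carrier → Bool
  within zero    a b = ⌊ a ≟ b ⌋
  within (suc r) a b =
    within r a b ∨ any (λ c → gaifmanEdge a c ∧ within r c b) elements

  within-refl : ∀ r a → T (within r a a)
  within-refl zero    a = fromWitness {a? = a ≟ a} refl
  within-refl (suc r) a = Equivalence.from T-∨ (inj₁ (within-refl r a))

  ball : ∀ {n} → ℕ → Vec Carrier n → Carrier → Bool
  ball r ā b = any (λ a → within r a b) (toList ā)

  ball-head : ∀ {n} r (ā : Vec Carrier (suc n)) → T (ball r ā (Vec.head ā))
  ball-head r (a Vec.∷ _) = Equivalence.from T-∨ (inj₁ (within-refl r a))

module _ {A : Set} (P : A → Bool) where

  Restriction : Set
  Restriction = ∃[ a ] T (P a)

  restrict : List A → List Restriction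
  restrict []       = []
  restrict (a ∷ as) with T? (P a)
  ... | yes pa = (a , pa) ∷ restrict as
  ... | no  _  = restrict as

  ∈-restrict⁺ : ∀ {a as} (pa : T (P a)) → a ∈ as → (a , pa) ∈ restrict as
  ∈-restrict⁺ {a} {b ∷ _} pa a∈ with T? (P b) | a∈
  ... | yes pb | here refl = here (cong (a ,_) (T-irrelevant pa pb))
  ... | yes _  | there a∈′ = there (∈-restrict⁺ pa a∈′)
  ... | no ¬pb | here refl = contradiction pa ¬pb
  ... | no _   | there a∈′ = ∈-restrict⁺ pa a∈′

  ∈-restrict⁻ : ∀ {x} as → x ∈ restrict as → proj₁ x ∈ as
  ∈-restrict⁻ (a ∷ as) x∈ with T? (P a) | x∈
  ... | yes _ | here refl = here refl
  ... | yes _ | there x∈′ = there (∈-restrict⁻ as x∈′)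
  ... | no _  | x∈′       = there (∈-restrict⁻ as x∈′)

  restrict-unique : ∀ {as} → Unique as → Unique (restrict as)
  restrict-unique {[]}     []          = []
  restrict-unique {a ∷ as} (a≢ ∷ uniq) with T? (P a)
  ... | yes _ = All.tabulate (λ x∈ eq → All.lookup a≢ (∈-restrict⁻ as x∈) (cong proj₁ eq))
                ∷ restrict-unique uniq
  ... | no _  = restrict-unique uniq

module _ {σ : Signature} (A : Structure σ) where
  open Structure A

  induced : (P : Carrier → Bool) → Restriction P → Structure σ
  induced P a₀ = record
    { Carrier   = Restriction P
    ; _≟_       = ≡-dec _≟_ (λ p q → yes (T-irrelevant p q))
    ; elements  = restrict P elements
    ; complete  = λ (a , pa) → ∈-restrict⁺ P pa (complete a)
    ; unique    = restrict-unique P unique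
    ; inhabited = a₀
    ; holds     = λ R t → holds R (Vec.map proj₁ t)
    }

  neighbourhood : ∀ {n} → ℕ → Vec Carrier (suc n) → Structure σ
  neighbourhood r ā = induced (ball r ā) (Vec.head ā , ball-head r ā)

infixr 6 _∧′_
infixr 5 _∨′_
infix  7 ¬′_

data Formula (σ : Signature) (M : List ℕ) : Set where
  true′ false′ : Formula σ M
  _≈′_   : Var → Var → Formula σ M
  rel    : (R : Fin (Signature.symbols σ)) → Vec Var (Signature.arity σ R) → Formula σ M
  dist≤  : Var → Var → ℕ → Formula σ M
  ¬′_    : Formula σ M → Formula σ M
  _∧′_   : Formula σ M → Formula σ M → Formula σ M
  _∨′_   : Formula σ M → Formula σ M → Formula σ M
  ∃′     : Var → Formula σ M → Formula σ M
  ∃mod   : ∀ {m} → m ∈ M → Fin m → Var → Formula σ M → Formula σ M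

private
  variable
    σ : Signature
    M : List ℕ

free : Formula σ M → List Var
free true′            = []
free false′           = []
free (x ≈′ y)         = x ∷ y ∷ []
free (rel R xs)       = toList xs
free (dist≤ x y d)    = x ∷ y ∷ []
free (¬′ φ)           = free φ
free (φ ∧′ ψ)         = free φ ++ free ψ
free (φ ∨′ ψ)         = free φ ++ free ψ
free (∃′ x φ)         = filter (λ y → ¬? (y ℕ.≟ x)) (free φ)
free (∃mod _ _ x φ)   = filter (λ y → ¬? (y ℕ.≟ x)) (free φ)

bound : Formula σ M → List Var
bound true′           = []
bound false′          = []
bound (x ≈′ y)        = []
bound (rel R xs)      = []
bound (dist≤ x y d)   = []
bound (¬′ φ)          = bound φ
bound (φ ∧′ ψ)        = bound φ ++ bound ψ
bound (φ ∨′ ψ)        = bound φ ++ bound ψ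
bound (∃′ x φ)        = x ∷ bound φ
bound (∃mod _ _ x φ)  = x ∷ bound φ

qr : Formula σ M → ℕ
qr true′            = 0
qr false′           = 0
qr (x ≈′ y)         = 0
qr (rel R xs)       = 0
qr (dist≤ x y d)    = 0
qr (¬′ φ)           = qr φ
qr (φ ∧′ ψ)         = qr φ ⊔ qr ψ
qr (φ ∨′ ψ)         = qr φ ⊔ qr ψ
qr (∃′ x φ)         = suc (qr φ)
qr (∃mod _ _ x φ)   = suc (qr φ)

md : Formula σ M → ℕ
md true′            = 0
md false′           = 0
md (x ≈′ y)         = 0
md (rel R xs)       = 0
md (dist≤ x y d)    = d
md (¬′ φ)           = md φ
md (φ ∧′ ψ)         = md φ ⊔ md ψ
md (φ ∨′ ψ)         = md φ ⊔ md ψ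
md (∃′ x φ)         = md φ
md (∃mod _ _ x φ)   = md φ

replace : Var → Var → Var → Var
replace x y z with z ℕ.≟ x
... | yes _ = y
... | no  _ = z

-- Replaces the free occurrences of x by y. Nothing is renamed to avoid capture,
-- so this is the intended substitution only if y ∉ bound φ.
_[_≔_] : Formula σ M → Var → Var → Formula σ M
true′          [ x ≔ y ] = true′
false′         [ x ≔ y ] = false′
(u ≈′ v)       [ x ≔ y ] = replace x y u ≈′ replace x y v
rel R us       [ x ≔ y ] = rel R (Vec.map (replace x y) us)
dist≤ u v d    [ x ≔ y ] = dist≤ (replace x y u) (replace x y v) d
(¬′ φ)         [ x ≔ y ] = ¬′ (φ [ x ≔ y ])
(φ ∧′ ψ)       [ x ≔ y ] = (φ [ x ≔ y ]) ∧′ (ψ [ x ≔ y ])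
(φ ∨′ ψ)       [ x ≔ y ] = (φ [ x ≔ y ]) ∨′ (ψ [ x ≔ y ])
∃′ z φ         [ x ≔ y ] with z ℕ.≟ x
... | yes _ = ∃′ z φ
... | no  _ = ∃′ z (φ [ x ≔ y ])
∃mod m∈ i z φ  [ x ≔ y ] with z ℕ.≟ x
... | yes _ = ∃mod m∈ i z φ
... | no  _ = ∃mod m∈ i z (φ [ x ≔ y ])

⋀ : List (Formula σ M) → Formula σ M
⋀ = foldr _∧′_ true′

∃* : List Var → Formula σ M → Formula σ M
∃* ys φ = foldr ∃′ φ ys

dist> : Var → Var → ℕ → Formula σ M
dist> x y r = ¬′ (dist≤ x y r)

pairwiseDist> : ℕ → List Var → List (Formula σ M)
pairwiseDist> r []       = []
pairwiseDist> r (y ∷ ys) = map (λ z → dist> y z r) ys ++ pairwiseDist> r ys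

Assignment : Structure σ → Set
Assignment A = Var → Structure.Carrier A

_[_↦_] : {B : Set} → (Var → B) → Var → B → Var → B
(v [ x ↦ b ]) y with y ℕ.≟ x
... | yes _ = b
... | no  _ = v y

⟦_⟧ : Formula σ M → (A : Structure σ) → Assignment A → Bool
⟦ true′ ⟧         A v = true
⟦ false′ ⟧        A v = false
⟦ x ≈′ y ⟧        A v = ⌊ v x ≟ v y ⌋
  where open Structure A
⟦ rel R xs ⟧      A v = Structure.holds A R (Vec.map v xs)
⟦ dist≤ x y d ⟧   A v = Structure.within A d (v x) (v y)
⟦ ¬′ φ ⟧          A v = not (⟦ φ ⟧ A v)
⟦ φ ∧′ ψ ⟧        A v = ⟦ φ ⟧ A v ∧ ⟦ ψ ⟧ A v
⟦ φ ∨′ ψ ⟧        A v = ⟦ φ ⟧ A v ∨ ⟦ ψ ⟧ A v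
⟦ ∃′ x φ ⟧        A v = any (λ a → ⟦ φ ⟧ A (v [ x ↦ a ])) (Structure.elements A)
⟦ ∃mod {m} _ i x φ ⟧ A v = (count % m) ≡ᵇ toℕ i
  where
  instance _ = nonZeroIndex i
  count = length (filterᵇ (λ a → ⟦ φ ⟧ A (v [ x ↦ a ])) (Structure.elements A))

Equivalent : Formula σ M → Formula σ M → Set₁
Equivalent {σ} φ ψ = (A : Structure σ) (v : Assignment A) → ⟦ φ ⟧ A v ≡ ⟦ ψ ⟧ A v

-- The tuple of variables is x̄ and the tuple of elements is ā = v(x̄). An assignment w
-- into the neighbourhood interprets x̄ by ā; its values outside x̄ are irrelevant,
-- since x̄ contains all free variables.
IsLocal : ℕ → Formula σ M → Set₁
IsLocal {σ} r φ =
  ∃[ n ] Σ (Vec Var (suc n)) λ x̄ →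
    (∀ x → x ∈ free φ → x ∈ toList x̄) ×
    ((A : Structure σ) (v : Assignment A)
     (w : Assignment (neighbourhood A r (Vec.map v x̄))) →
     (∀ x → x ∈ toList x̄ → proj₁ (w x) ≡ v x) →
     ⟦ φ ⟧ A v ≡ ⟦ φ ⟧ (neighbourhood A r (Vec.map v x̄)) w)

data BooleanCombination (P : Formula σ M → Set p) : Formula σ M → Set p where
  base : ∀ {φ} → P φ → BooleanCombination P φ
  neg  : ∀ {φ} → BooleanCombination P φ → BooleanCombination P (¬′ φ)
  conj : ∀ {φ ψ} → BooleanCombination P φ → BooleanCombination P ψ →
         BooleanCombination P (φ ∧′ ψ)
  disj : ∀ {φ ψ} → BooleanCombination P φ → BooleanCombination P ψ →
         BooleanCombination P (φ ∨′ ψ)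

Every : {P : Formula σ M → Set p} → (∀ {φ} → P φ → Set a) →
        ∀ {φ} → BooleanCombination P φ → Set a
Every Q (base b)   = Q b
Every Q (neg b)    = Every Q b
Every Q (conj b c) = Every Q b × Every Q c
Every Q (disj b c) = Every Q b × Every Q c

r₁ : ℕ → ℕ → ℕ → ℕ
r₁ zero    k d = d ⊔ 1
r₁ (suc q) k d = 4 * k * r₁ q (suc k) d

FreeBelow : ℕ → Formula σ M → Set
FreeBelow k φ = ∀ x → x ∈ free φ → x < k

-- C stands for the class with parameters q, k + 1, d.
data Generator (q k d : ℕ) (C : Formula σ M → Set) : Formula σ M → Set where
  lower    : ∀ {ψ} → C ψ → FreeBelow k ψ → Generator q k d C ψ
  distance : ∀ {i j e} → i < k → j < k → e ≤ r₁ (suc q) k d →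
             Generator q k d C (dist≤ i j e)
  near     : ∀ {i e ψ} → C ψ → i < k → e + r₁ q (suc k) d ≤ r₁ (suc q) k d →
             Generator q k d C (∃′ k (dist≤ i k e ∧′ ψ))
  exists   : ∀ {ψ} → C ψ → Generator q k d C (∃′ k ψ)
  modulo   : ∀ {m ψ} (m∈ : m ∈ M) (i : Fin m) → C ψ → Generator q k d C (∃mod m∈ i k ψ)

FO+MOD⁺ : (q k d : ℕ) → Formula σ M → Set
FO+MOD⁺ zero    k d φ = qr φ ≡ 0 × FreeBelow k φ × md φ ≤ d
FO+MOD⁺ (suc q) k d φ =
  FreeBelow k φ × BooleanCombination (Generator q k d (FO+MOD⁺ q (suc k) d)) φ

-- The index q is shifted: these are the sentences for FO+MOD⁺(q + 1, k, d). The inner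
-- distance is 2 * r and the inner radius is at most r̃.
record BasicLocal (q k d : ℕ) (χ : Formula σ M) : Set₁ where
  field
    ℓ r r̃     : ℕ
    body       : Formula σ M
    body-class : FO+MOD⁺ q (suc k) d body
    body-free  : FreeBelow 1 body
    body-local : IsLocal r̃ body
    r̃≤r       : r̃ ≤ r
    1≤ℓ        : 1 ≤ ℓ
    ys         : List Var
    ys-length  : length ys ≡ ℓ
    ys-unique  : Unique ys
    ys-fresh   : All (λ y → ¬ (y ∈ bound body)) ys
    shape      : χ ≡ ∃* ys (⋀ (pairwiseDist> (2 * r) ys) ∧′ ⋀ (map (λ y → body [ 0 ≔ y ]) ys))

-- The index q is shifted as in BasicLocal.
record LocalModulo (q k d : ℕ) (χ : Formula σ M) : Set₁ where
  field
    r̃         : ℕ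
    body       : Formula σ M
    y          : Var
    body-class : FO+MOD⁺ q (suc k) d body
    body-free  : ∀ x → x ∈ free body → x ≡ y
    body-local : IsLocal r̃ body
    m          : ℕ
    m∈M        : m ∈ M
    i          : Fin m
    shape      : χ ≡ ∃mod m∈M i y body

-- The indices encode that for q = 0 there are only local formulas.
data Constituent {σ M} : (q k d : ℕ) → Formula σ M → Set₁ where
  localFormula : ∀ {q k d ψ} → FO+MOD⁺ q k d ψ → ∃[ r ] IsLocal r ψ → Constituent q k d ψ
  basicLocal   : ∀ {q k d ψ} → BasicLocal q k d ψ → Constituent (suc q) k d ψ
  localModulo  : ∀ {q k d ψ} → LocalModulo q k d ψ → Constituent (suc q) k d ψ

GaifmanNormalForm : (q k d : ℕ) → Formula σ M → Set₁
GaifmanNormalForm q k d = BooleanCombination (Constituent q k d)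

module _ {q k d : ℕ} {φ : Formula σ M} where

  OuterRank≤ : ℕ → GaifmanNormalForm q k d φ → Set
  OuterRank≤ n = Every λ where
    (localFormula {ψ = ψ} _ _) → qr ψ ≤ n
    (basicLocal _)             → ⊤
    (localModulo _)            → ⊤

  OuterRadius≤ : ℕ → GaifmanNormalForm q k d φ → Set₁
  OuterRadius≤ n = Every λ where
    (localFormula {ψ = ψ} _ _) → IsLocal n ψ
    (basicLocal _)             → ⊤
    (localModulo _)            → ⊤

  -- "Inner rank at most n − 1", where n − 1 is the integer −1 for n = 0.
  InnerRank< : ℕ → GaifmanNormalForm q k d φ → Set
  InnerRank< n = Every λ where
    (localFormula _ _) → ⊤
    (basicLocal s)     → qr (BasicLocal.body s) < n
    (localModulo s)    → qr (LocalModulo.body s) < n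

  InnerRadius≤ : ℕ → GaifmanNormalForm q k d φ → Set
  InnerRadius≤ n = Every λ where
    (localFormula _ _) → ⊤
    (basicLocal s)     → BasicLocal.r̃ s ≤ n
    (localModulo s)    → LocalModulo.r̃ s ≤ n

  Width≤ : ℕ → GaifmanNormalForm q k d φ → Set
  Width≤ n = Every λ where
    (localFormula _ _) → ⊤
    (basicLocal s)     → BasicLocal.ℓ s ≤ n
    (localModulo _)    → ⊤

  InnerDistance≤ : ℕ → GaifmanNormalForm q k d φ → Set
  InnerDistance≤ n = Every λ where
    (localFormula _ _) → ⊤
    (basicLocal s)     → 2 * BasicLocal.r s ≤ n
    (localModulo _)    → ⊤

{-# OPTIONS --safe #-}

-- A normal form is built as a decision tree whose questions are local formulas and sentences.
-- To treat Q y φ(x̄, y), the questions of the tree for φ that do not involve y are asked first;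
-- there remains a local formula α(x̄, y). All quantifiers in α are guarded by atoms that keep the
-- quantified element close to one of the free variables. So, if y is far from x̄, then α splits into
-- formulas about x̄, which can also be asked first, and a formula β(y). Hence α and β differ only
-- close to x̄. Modulo m, the number of α-witnesses is that of the β-witnesses plus a correction that
-- local formulas compute. For ∃, a witness close to x̄ is found by a local formula, and a distant one
-- exists iff β has more scattered witnesses than there are close to x̄. The latter number is the
-- largest number of x̄ that are close to a witness and have pairwise distances > t, provided that it
-- is the same for t and t + 4 r₁. One of k successive intervals has this property: hence the factor
-- 4k in r₁.

module Submission where

open import Defs
open import Data.Bool using (Bool; true; false; not; _∧_; _∨_; T; T?; if_then_else_)
import Data.Bool as Bool
open import Data.Bool.ListAction using (any)
open import Data.Bool.Properties using (T-irrelevant; T-∧; T-∨; ∨-identityʳ; ∧-assoc; if-eta)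
open import Data.Empty using (⊥-elim)
open import Data.Fin as Fin using (Fin; zero; suc; toℕ; fromℕ<)
open import Data.Fin.Properties using (nonZeroIndex; toℕ-fromℕ<; pigeonhole)
open import Data.List using
  (List; []; _∷_; _++_; map; filter; filterᵇ; length; allFin; lookup; applyUpTo; cartesianProduct;
   cartesianProductWith)
open import Data.List.Membership.Propositional using (_∈_; _∉_; find; lose; mapWith∈)
open import Data.List.Membership.Propositional.Properties using
  (∈-applyUpTo⁻; ∈-filter⁺; ∈-filter⁻; ∈-map⁺; ∈-map⁻; ∈-++⁺ˡ; ∈-++⁺ʳ; ∈-++⁻; ∈-allFin;
   ∈-cartesianProduct⁺; ∈-cartesianProduct⁻; ∈-cartesianProductWith⁺; ∈-cartesianProductWith⁻; ∈-lookup)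
open import Data.List.Properties using (length-map; length-applyUpTo)
open import Data.List.Relation.Unary.All as All using (All; []; _∷_)
import Data.List.Relation.Unary.All.Properties as All
open import Data.List.Relation.Unary.AllPairs as AllPairs using (AllPairs; []; _∷_)
import Data.List.Relation.Unary.AllPairs.Properties as AllPairs
open import Data.List.Relation.Unary.Any as Any using (Any; here; there)
open import Data.List.Relation.Unary.Any.Properties using (any⁺; any⁻)
open import Data.List.Relation.Unary.Unique.Propositional using (Unique)
open import Data.Nat using (ℕ; zero; suc; pred; _+_; _*_; _∸_; _⊔_; _≤_; _<_; _%_; _≡ᵇ_; _<ᵇ_; z≤n; s≤s)
import Data.Nat as ℕ
open import Data.Nat.DivMod using (%-distribˡ-+; [m+kn]%n≡m%n; m%n%n≡m%n; m%n<n)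
open import Data.Nat.ListAction using (sum)
open import Data.Nat.Properties using
  (≤-refl; ≤-reflexive; ≤-trans; <-irrefl; <⇒≤; <⇒≢; ≤-pred; n≤1+n; m≤m+n; m≤n+m; m≤m⊔n; m≤n⊔m; ⊔-lub;
   +-assoc; +-comm; +-suc; +-identityʳ; +-cancelˡ-≡; +-monoˡ-≤; +-monoʳ-≤; *-monoˡ-≤; *-monoʳ-≤;
   m∸n+n≡m; m+n≤o⇒m≤o∸n; m≤n*m; ≡ᵇ⇒≡; ≡⇒≡ᵇ; n≤0⇒n≡0; m≤n⇒m<n∨m≡n)
open import Data.Nat.Tactic.RingSolver using (solve-∀)
open import Data.Product using (Σ-syntax; ∃-syntax; _×_; _,_; proj₁; proj₂)
open import Data.Sum using (_⊎_; inj₁; inj₂; [_,_]′)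
import Data.Sum as Sum
open import Data.Unit using (tt) renaming (⊤ to ⊤₀)
open import Data.Vec as Vec using (Vec; toList; fromList)
import Data.Vec.Properties as Vec
open import Function using (_⇔_; mk⇔; Equivalence; _∘_; id)
open import Relation.Binary.PropositionalEquality using
  (_≡_; _≢_; refl; sym; trans; cong; cong₂; subst; subst₂; module ≡-Reasoning)
open import Relation.Nullary using (Dec; yes; no; ¬_; contradiction)
open import Relation.Nullary.Decidable using (⌊_⌋; ¬?; toWitness; fromWitness; map′; _×-dec_; _⊎-dec_)

-- Splitting needs control over every distance inside a formula, which semantic locality does not
-- give; hence the syntactic fragment `Local`, whose radius is read off its guards. Trees rather
-- than formulas carry the induction: which β belongs to α depends on answers about x̄, but one β
-- must serve all y. A true atom R(x, y) makes x and y neighbours, yet for q = 0 and d = 0 the class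
-- has no atom dist ≤ 1 to say so. Therefore whatever spoils a split at an atom is recorded as that
-- atom itself. Such atoms are the guards used in modulo counting, because a class admits wide
-- distance guards only under ∃. For ∃, let R = `r₁ q (suc k) d`. Exchanging two of the x̄ for
-- witnesses within R of them changes their distance by at most 2R. The argument makes this exchange
-- in both directions, so a stable interval must have length 4R. The x̄ are searched for α-witnesses
-- up to `r₁ (suc q) k d` minus R, the largest radius of a guarded ∃ in the class; a witness beyond
-- it is also far from the witnesses chosen near x̄.

private
  variable
    σ : Signature
    M : List ℕ
    X B C : Set
    q k d n r : ℕ
    φ ψ β γ θ : Formula σ M
    F G : Var → Set
    s : Var → Bool
    P P₁ P₂ : Formula σ M → Set

-- Booleans as propositions

T-ext : ∀ {a b} → (T a → T b) → (T b → T a) → a ≡ b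
T-ext {true}  {true}  f g = refl
T-ext {true}  {false} f g = ⊥-elim (f tt)
T-ext {false} {true}  f g = ⊥-elim (g tt)
T-ext {false} {false} f g = refl

T⇒true : ∀ {b} → T b → b ≡ true
T⇒true {true} _ = refl

¬T⇒false : ∀ {b} → ¬ T b → b ≡ false
¬T⇒false {true}  ¬b = ⊥-elim (¬b tt)
¬T⇒false {false} _  = refl

T-not⁺ : ∀ {b} → ¬ T b → T (not b)
T-not⁺ {true}  ¬b = ¬b tt
T-not⁺ {false} _  = tt

T-not⁻ : ∀ {b} → T (not b) → ¬ T b
T-not⁻ {false} _ ()

∧⁺ : ∀ {a b} → T a → T b → T (a ∧ b)
∧⁺ p q = Equivalence.from T-∧ (p , q)

∧⁻ : ∀ {a b} → T (a ∧ b) → T a × T b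
∧⁻ = Equivalence.to T-∧

∧-congʳ : ∀ {a b c} → (T a → b ≡ c) → a ∧ b ≡ a ∧ c
∧-congʳ {true}  eq = eq tt
∧-congʳ {false} eq = refl

any-intro : ∀ (p : X → Bool) {x xs} → x ∈ xs → T (p x) → T (any p xs)
any-intro p x∈ px = any⁺ p (lose x∈ px)

any-elim : ∀ (p : X → Bool) xs → T (any p xs) → ∃[ x ] x ∈ xs × T (p x)
any-elim p xs t = find (any⁻ p xs t)

-- The Gaifman metric

module _ {σ : Signature} (A : Structure σ) where
  open Structure A

  -- Records rather than synonyms, so that the arguments are inferrable.
  record Within (r : ℕ) (a b : Carrier) : Set where
    constructor path
    field reached : T (within r a b)

  record Edge (a b : Carrier) : Set where
    constructor edge
    field adjacent : T (gaifmanEdge a b)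

  within? : ∀ r a b → Dec (Within r a b)
  within? r a b = map′ path Within.reached (T? (within r a b))

  within-here : ∀ r {a} → Within r a a
  within-here r {a} = path (within-refl r a)

  CommonTuple : Carrier → Carrier → Set
  CommonTuple a b =
    Σ[ R ∈ Fin (Signature.symbols σ) ] Σ[ t ∈ Vec Carrier (Signature.arity σ R) ]
      T (holds R t) × a ∈ toList t × b ∈ toList t

  occurs⁺ : ∀ {n a} (t : Vec Carrier n) → a ∈ toList t → T (occurs a t)
  occurs⁺ {a = a} t a∈ = any-intro (λ b → ⌊ a ≟ b ⌋) a∈ (fromWitness {a? = a ≟ a} refl)

  occurs⁻ : ∀ {n a} (t : Vec Carrier n) → T (occurs a t) → a ∈ toList t
  occurs⁻ {a = a} t p with any-elim (λ b → ⌊ a ≟ b ⌋) (toList t) p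
  ... | b , b∈ , q with refl ← toWitness {a? = a ≟ b} q = b∈

  ∈-tuples : ∀ {n} (t : Vec Carrier n) → t ∈ tuples n
  ∈-tuples Vec.[]      = here refl
  ∈-tuples (a Vec.∷ t) = ∈-cartesianProductWith⁺ Vec._∷_ (complete a) (∈-tuples t)

  edge⁺ : ∀ {a b} → a ≢ b → CommonTuple a b → Edge a b
  edge⁺ {a} {b} a≢b (R , t , h , a∈ , b∈) = edge
    (∧⁺ (T-not⁺ (λ p → a≢b (toWitness {a? = a ≟ b} p)))
       (any-intro _ (∈-allFin R)
         (any-intro (λ t → holds R t ∧ occurs a t ∧ occurs b t) (∈-tuples t)
           (∧⁺ h (∧⁺ (occurs⁺ t a∈) (occurs⁺ t b∈))))))

  edge⁻ : ∀ {a b} → Edge a b → a ≢ b × CommonTuple a b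
  edge⁻ {a} {b} (edge e) with ∧⁻ e
  ... | a≢b , e′ with any-elim _ (allFin _) e′
  ... | R , _ , e″ with any-elim (λ t → holds R t ∧ occurs a t ∧ occurs b t) (tuples (Signature.arity σ R)) e″
  ... | t , _ , h with ∧⁻ h
  ... | ht , o with ∧⁻ o
  ... | oa , ob =
    (λ a≡b → T-not⁻ a≢b (fromWitness {a? = a ≟ b} a≡b)) , R , t , ht , occurs⁻ t oa , occurs⁻ t ob

  edge-sym : ∀ {a b} → Edge a b → Edge b a
  edge-sym {a} {b} e = swap (edge⁻ e)
    where
    swap : a ≢ b × CommonTuple a b → Edge b a
    swap (a≢b , R , t , h , a∈ , b∈) = edge⁺ (a≢b ∘ sym) (R , t , h , b∈ , a∈)

  within-cons : ∀ {r a b c} → Edge a c → Within r c b → Within (suc r) a b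
  within-cons {r} {a} {b} {c} (edge e) (path w) = path (Equivalence.from T-∨
    (inj₂ (any-intro (λ c → gaifmanEdge a c ∧ within r c b) (complete c) (∧⁺ e w))))

  within-uncons : ∀ {r a b} → Within (suc r) a b →
                  Within r a b ⊎ (∃[ c ] Edge a c × Within r c b)
  within-uncons {r} {a} {b} (path w) with Equivalence.to T-∨ w
  ... | inj₁ w′ = inj₁ (path w′)
  ... | inj₂ w′ with any-elim (λ c → gaifmanEdge a c ∧ within r c b) elements w′
  ... | c , _ , p with ∧⁻ p
  ... | e , w″ = inj₂ (c , edge e , path w″)

  within-zero : ∀ {a b} → Within 0 a b → a ≡ b
  within-zero {a} {b} (path w) = toWitness {a? = a ≟ b} w

  within-suc : ∀ {r a b} → Within r a b → Within (suc r) a b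
  within-suc (path w) = path (Equivalence.from T-∨ (inj₁ w))

  within-trans : ∀ r {s a b c} → Within r a b → Within s b c → Within (r + s) a c
  within-trans zero {a = a} w w′ with refl ← within-zero w = w′
  within-trans (suc r) w w′ with within-uncons w
  ... | inj₁ v           = within-suc (within-trans r v w′)
  ... | inj₂ (c , e , v) = within-cons e (within-trans r v w′)

  within-mono : ∀ {r s a b} → r ≤ s → Within r a b → Within s a b
  within-mono {r} {s} {a} {b} r≤s w =
    subst (λ n → Within n a b) (trans (+-comm r (s ∸ r)) (m∸n+n≡m r≤s))
      (within-trans r w (within-here (s ∸ r)))

  edge-within : ∀ {a b} → Edge a b → Within 1 a b
  edge-within e = within-cons e (within-here 0)

  within-sym : ∀ r {a b} → Within r a b → Within r b a
  within-sym zero w with refl ← within-zero w = within-here 0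
  within-sym (suc r) {a} {b} w with within-uncons w
  ... | inj₁ v           = within-suc (within-sym r v)
  ... | inj₂ (c , e , v) =
    subst (λ n → Within n b a) (+-comm r 1)
      (within-trans r (within-sym r v) (edge-within (edge-sym e)))

  commonTuple-within : ∀ {a b} → CommonTuple a b → Within 1 a b
  commonTuple-within {a} {b} c = cases (a ≟ b)
    where
    cases : Dec (a ≡ b) → Within 1 a b
    cases (yes refl) = within-here 1
    cases (no a≢b)   = edge-within (edge⁺ a≢b c)

-- Distances in induced substructures

lift-vec : {P : X → Bool} {n : ℕ} (t : Vec X n) → (∀ {a} → a ∈ toList t → T (P a)) →
           Σ[ u ∈ Vec (Restriction P) n ] Vec.map proj₁ u ≡ t
lift-vec Vec.[]      P∋ = Vec.[] , refl
lift-vec (a Vec.∷ t) P∋ with lift-vec t (P∋ ∘ there)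
... | u , refl = ((a , P∋ (here refl)) Vec.∷ u) , refl

module _ {σ : Signature} (A : Structure σ) (P : Structure.Carrier A → Bool) (o : Restriction P) where
  open Structure A

  private
    A↾P : Structure σ
    A↾P = induced A P o

  restriction-≡ : (x y : Restriction P) → proj₁ x ≡ proj₁ y → x ≡ y
  restriction-≡ (a , p) (.a , q) refl = cong (a ,_) (T-irrelevant p q)

  ∈-proj₁⁻ : ∀ {n x} (u : Vec (Restriction P) n) → proj₁ x ∈ toList (Vec.map proj₁ u) → x ∈ toList u
  ∈-proj₁⁻ {x = x} u x∈ with ∈-map⁻ proj₁ (subst (_ ∈_) (Vec.toList-map proj₁ u) x∈)
  ... | y , y∈ , eq with refl ← restriction-≡ x y eq = y∈

  ∈-proj₁⁺ : ∀ {n x} (u : Vec (Restriction P) n) → x ∈ toList u → proj₁ x ∈ toList (Vec.map proj₁ u)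
  ∈-proj₁⁺ u x∈ = subst (_ ∈_) (sym (Vec.toList-map proj₁ u)) (∈-map⁺ proj₁ x∈)

  edge-induced⁻ : ∀ {x y} → Edge A↾P x y → Edge A (proj₁ x) (proj₁ y)
  edge-induced⁻ {x} {y} e = projected (edge⁻ A↾P e)
    where
    projected : x ≢ y × CommonTuple A↾P x y → Edge A (proj₁ x) (proj₁ y)
    projected (x≢y , R , u , h , x∈ , y∈) =
      edge⁺ A (x≢y ∘ restriction-≡ x y) (R , Vec.map proj₁ u , h , ∈-proj₁⁺ u x∈ , ∈-proj₁⁺ u y∈)

  -- An edge needs a whole tuple to survive in the substructure, not only its two ends. All entries
  -- of that tuple are within distance 1 of x.
  edge-induced⁺ : ∀ {x y} → (∀ c → Within A 1 (proj₁ x) c → T (P c)) →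
                  Edge A (proj₁ x) (proj₁ y) → Edge A↾P x y
  edge-induced⁺ {x} {y} nb e = restricted (edge⁻ A e)
    where
    restricted : proj₁ x ≢ proj₁ y × CommonTuple A (proj₁ x) (proj₁ y) → Edge A↾P x y
    restricted (x≢y , R , t , h , x∈ , y∈) = lifted
      (lift-vec t (λ {c} c∈ → nb c (commonTuple-within A (R , t , h , x∈ , c∈))))
      where
      lifted : Σ[ u ∈ Vec (Restriction P) _ ] Vec.map proj₁ u ≡ t → Edge A↾P x y
      lifted (u , refl) = edge⁺ A↾P (x≢y ∘ cong proj₁) (R , u , h , ∈-proj₁⁻ u x∈ , ∈-proj₁⁻ u y∈)

  within-induced⁻ : ∀ r {x y} → Within A↾P r x y → Within A r (proj₁ x) (proj₁ y)
  within-induced⁻ zero w with refl ← within-zero A↾P w = within-here A 0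
  within-induced⁻ (suc r) w with within-uncons A↾P w
  ... | inj₁ v           = within-suc A (within-induced⁻ r v)
  ... | inj₂ (c , e , v) = within-cons A (edge-induced⁻ e) (within-induced⁻ r v)

  -- A path of at most r edges from x never leaves the r-ball around x. So it is enough that the
  -- ball around one end lies in `P`, and a distance atom can be anchored at either of its
  -- variables.
  within-induced⁺ : ∀ r {x y} → (∀ c → Within A r (proj₁ x) c → T (P c)) →
                    Within A r (proj₁ x) (proj₁ y) → Within A↾P r x y
  within-induced⁺ zero {x} {y} nb w =
    path (fromWitness {a? = Structure._≟_ A↾P x y} (restriction-≡ x y (within-zero A w)))
  within-induced⁺ (suc r) {x} nb w with within-uncons A w
  ... | inj₁ v           = within-suc A↾P (within-induced⁺ r (λ c → nb c ∘ within-suc A) v)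
  ... | inj₂ (c , e , v) =
    within-cons A↾P {c = c , nb c (within-mono A (s≤s z≤n) (edge-within A e))}
      (edge-induced⁺ (λ b → nb b ∘ within-mono A (s≤s z≤n)) e)
      (within-induced⁺ r (λ b → nb b ∘ within-cons A e) v)

  within-induced : ∀ r x y → (∀ c → Within A r (proj₁ x) c → T (P c)) →
                   within r (proj₁ x) (proj₁ y) ≡ Structure.within A↾P r x y
  within-induced r x y nb =
    T-ext (Within.reached ∘ within-induced⁺ r nb ∘ path) (Within.reached ∘ within-induced⁻ r ∘ path)

-- Assignments and substitution

update-same : ∀ {B : Set} (v : Var → B) x {b} → (v [ x ↦ b ]) x ≡ b
update-same v x with x ℕ.≟ x
... | yes _  = refl
... | no x≢x = contradiction refl x≢x

update-other : ∀ {B : Set} (v : Var → B) {x y b} → y ≢ x → (v [ x ↦ b ]) y ≡ v y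
update-other v {x} {y} y≢x with y ℕ.≟ x
... | yes y≡x = contradiction y≡x y≢x
... | no _    = refl

update-cong : ∀ {B C : Set} (f : B → C) {v : Var → B} {w : Var → C} {x b} y →
              (y ≢ x → f (v y) ≡ w y) → f ((v [ x ↦ b ]) y) ≡ (w [ x ↦ f b ]) y
update-cong f {x = x} y eq with y ℕ.≟ x
... | yes _  = refl
... | no y≢x = eq y≢x

update-swap : ∀ {B : Set} (v : Var → B) {x z a b} u → z ≢ x →
              ((v [ z ↦ a ]) [ x ↦ b ]) u ≡ ((v [ x ↦ b ]) [ z ↦ a ]) u
update-swap v {x} {z} u z≢x with u ℕ.≟ x in eqx | u ℕ.≟ z in eqz
... | yes refl | yes refl = contradiction refl z≢x
... | yes refl | no _     rewrite eqx = refl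
... | no _     | yes refl rewrite eqz = refl
... | no _     | no _     rewrite eqx | eqz = refl

replace-other : ∀ {x y z} → z ≢ x → replace x y z ≡ z
replace-other {x} {y} {z} z≢x with z ℕ.≟ x
... | yes z≡x = contradiction z≡x z≢x
... | no _    = refl

replace-elim : ∀ (P : Var → Set) {x y} z → P y → (z ≢ x → P z) → P (replace x y z)
replace-elim P {x} z py pz with z ℕ.≟ x
... | yes _  = py
... | no z≢x = pz z≢x

lookup-replace : ∀ {B : Set} (v : Var → B) x y z → v (replace x y z) ≡ (v [ x ↦ v y ]) z
lookup-replace v x y z with z ℕ.≟ x
... | yes _ = refl
... | no _  = refl

map-cong-∈ : ∀ {B C : Set} {f g : B → C} {n} (xs : Vec B n) →
             (∀ {x} → x ∈ toList xs → f x ≡ g x) → Vec.map f xs ≡ Vec.map g xs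
map-cong-∈ Vec.[]       eq = refl
map-cong-∈ (x Vec.∷ xs) eq = cong₂ Vec._∷_ (eq (here refl)) (map-cong-∈ xs (eq ∘ there))

-- ∃ and ∃^{i mod m} both inspect only the number of witnesses.

data Quantifier (M : List ℕ) : Set where
  some : Quantifier M
  mod  : ∀ {m} → m ∈ M → Fin m → Quantifier M

quantify : Quantifier M → Var → Formula σ M → Formula σ M
quantify some       = ∃′
quantify (mod m∈ i) = ∃mod m∈ i

accepts : Quantifier M → ℕ → Bool
accepts some            n = 0 <ᵇ n
accepts (mod {m} m∈ i) n = (n % m) ≡ᵇ toℕ i
  where instance _ = nonZeroIndex i

count : (X → Bool) → List X → ℕ
count f xs = length (filterᵇ f xs)

count-∷ : ∀ (f : X → Bool) x xs → count f (x ∷ xs) ≡ (if f x then 1 else 0) + count f xs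
count-∷ f x xs with f x
... | true  = refl
... | false = refl

any-count : ∀ (f : X → Bool) xs → any f xs ≡ (0 <ᵇ count f xs)
any-count f []       = refl
any-count f (x ∷ xs) with f x
... | true  = refl
... | false = any-count f xs

count-cong : ∀ {f g : X → Bool} xs → (∀ x → f x ≡ g x) → count f xs ≡ count g xs
count-cong         []       eq = refl
count-cong {f = f} {g} (x ∷ xs) eq = begin
  count f (x ∷ xs)                        ≡⟨ count-∷ f x xs ⟩
  (if f x then 1 else 0) + count f xs     ≡⟨ cong₂ (λ b n → (if b then 1 else 0) + n) (eq x) (count-cong xs eq) ⟩
  (if g x then 1 else 0) + count g xs     ≡⟨ count-∷ g x xs ⟨
  count g (x ∷ xs)                        ∎
  where open ≡-Reasoning

count-none : ∀ {f : X → Bool} xs → (∀ x → ¬ T (f x)) → count f xs ≡ 0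
count-none         []       none = refl
count-none {f = f} (x ∷ xs) none with f x | none x
... | true  | ¬t = ⊥-elim (¬t tt)
... | false | _  = count-none xs none

count-∧ : ∀ (g f : X → Bool) xs →
          count f xs ≡ count (λ x → g x ∧ f x) xs + count (λ x → not (g x) ∧ f x) xs
count-∧ g f []       = refl
count-∧ g f (x ∷ xs) with g x | f x
... | true  | true  = cong suc (count-∧ g f xs)
... | true  | false = count-∧ g f xs
... | false | true  = trans (cong suc (count-∧ g f xs)) (sym (+-suc _ _))
... | false | false = count-∧ g f xs

count-restrict : ∀ (P : X → Bool) {f : X → Bool} {g : Restriction P → Bool} xs →
                 (∀ x → T (f x) → T (P x)) → (∀ x → f (proj₁ x) ≡ g x) →
                 count f xs ≡ count g (restrict P xs)
count-restrict P             []       f⊆P eq = refl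
count-restrict P {f = f} {g} (x ∷ xs) f⊆P eq with T? (P x)
... | yes p = begin
  count f (x ∷ xs)                                            ≡⟨ count-∷ f x xs ⟩
  (if f x then 1 else 0) + count f xs                         ≡⟨ cong₂ (λ b n → (if b then 1 else 0) + n)
                                                                   (eq (x , p)) (count-restrict P xs f⊆P eq) ⟩
  (if g (x , p) then 1 else 0) + count g (restrict P xs)      ≡⟨ count-∷ g (x , p) (restrict P xs) ⟨
  count g ((x , p) ∷ restrict P xs)                           ∎
  where open ≡-Reasoning
... | no ¬p = trans (count-∷ f x xs)
  (trans (cong (λ b → (if b then 1 else 0) + count f xs) (¬T⇒false (¬p ∘ f⊆P x))) (count-restrict P xs f⊆P eq))

witnesses : (φ : Formula σ M) (A : Structure σ) → Assignment A → Var → ℕ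
witnesses φ A v x = count (λ a → ⟦ φ ⟧ A (v [ x ↦ a ])) (Structure.elements A)

⟦quantify⟧ : ∀ (Q : Quantifier M) x (φ : Formula σ M) A v →
             ⟦ quantify Q x φ ⟧ A v ≡ accepts Q (witnesses φ A v x)
⟦quantify⟧ some       x φ A v = any-count (λ a → ⟦ φ ⟧ A (v [ x ↦ a ])) (Structure.elements A)
⟦quantify⟧ (mod m∈ i) x φ A v = refl

∃′-intro : ∀ (φ : Formula σ M) A v {x} a → T (⟦ φ ⟧ A (v [ x ↦ a ])) → T (⟦ ∃′ x φ ⟧ A v)
∃′-intro φ A v {x} a = any-intro (λ a → ⟦ φ ⟧ A (v [ x ↦ a ])) (Structure.complete A a)

∃′-elim : ∀ (φ : Formula σ M) A v {x} → T (⟦ ∃′ x φ ⟧ A v) →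
          ∃[ a ] T (⟦ φ ⟧ A (v [ x ↦ a ]))
∃′-elim φ A v {x} t with any-elim (λ a → ⟦ φ ⟧ A (v [ x ↦ a ])) (Structure.elements A) t
... | a , _ , p = a , p

free-quantify⁺ : ∀ (Q : Quantifier M) {x y} (φ : Formula σ M) → y ∈ free φ → y ≢ x → y ∈ free (quantify Q x φ)
free-quantify⁺ some      {x} φ = ∈-filter⁺ (λ y → ¬? (y ℕ.≟ x))
free-quantify⁺ (mod _ _) {x} φ = ∈-filter⁺ (λ y → ¬? (y ℕ.≟ x))

free-quantify⁻ : ∀ (Q : Quantifier M) {x y} (φ : Formula σ M) → y ∈ free (quantify Q x φ) → y ∈ free φ × y ≢ x
free-quantify⁻ some      {x} φ = ∈-filter⁻ (λ y → ¬? (y ℕ.≟ x))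
free-quantify⁻ (mod _ _) {x} φ = ∈-filter⁻ (λ y → ¬? (y ℕ.≟ x))

qr-quantify : ∀ (Q : Quantifier M) x (φ : Formula σ M) → qr (quantify Q x φ) ≡ suc (qr φ)
qr-quantify some      x φ = refl
qr-quantify (mod _ _) x φ = refl

bound-quantify : ∀ (Q : Quantifier M) x (φ : Formula σ M) → bound (quantify Q x φ) ≡ x ∷ bound φ
bound-quantify some      x φ = refl
bound-quantify (mod _ _) x φ = refl

subst-quantify : ∀ (Q : Quantifier M) {x y z} (φ : Formula σ M) → z ≢ x →
                 quantify Q z φ [ x ≔ y ] ≡ quantify Q z (φ [ x ≔ y ])
subst-quantify some {x} {y} {z} φ z≢x with z ℕ.≟ x
... | yes z≡x = contradiction z≡x z≢x
... | no _    = refl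
subst-quantify (mod _ _) {x} {y} {z} φ z≢x with z ℕ.≟ x
... | yes z≡x = contradiction z≡x z≢x
... | no _    = refl

subst-quantify-bound : ∀ (Q : Quantifier M) {x y} (φ : Formula σ M) → quantify Q x φ [ x ≔ y ] ≡ quantify Q x φ
subst-quantify-bound some {x} φ with x ℕ.≟ x
... | yes _  = refl
... | no x≢x = contradiction refl x≢x
subst-quantify-bound (mod _ _) {x} φ with x ℕ.≟ x
... | yes _  = refl
... | no x≢x = contradiction refl x≢x

-- Matching on a formula itself would separate the two quantifiers. The view merges them into the
-- case `quantified`, so that an induction can handle both at once.
data View {σ M} : Formula σ M → Set where
  true′ : View true′
  false′ : View false′
  _≈′_ : ∀ x y → View (x ≈′ y)
  rel : ∀ R xs → View (rel R xs)
  dist≤ : ∀ x y e → View (dist≤ x y e)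
  ¬′_ : ∀ {φ} → View φ → View (¬′ φ)
  _∧′_ : ∀ {φ ψ} → View φ → View ψ → View (φ ∧′ ψ)
  _∨′_ : ∀ {φ ψ} → View φ → View ψ → View (φ ∨′ ψ)
  quantified : ∀ Q x {φ} → View φ → View (quantify Q x φ)

view : (φ : Formula σ M) → View φ
view true′          = true′
view false′         = false′
view (x ≈′ y)       = x ≈′ y
view (rel R xs)     = rel R xs
view (dist≤ x y e)  = dist≤ x y e
view (¬′ φ)         = ¬′ view φ
view (φ ∧′ ψ)       = view φ ∧′ view ψ
view (φ ∨′ ψ)       = view φ ∨′ view ψ
view (∃′ x φ)       = quantified some x (view φ)
view (∃mod m∈ i x φ) = quantified (mod m∈ i) x (view φ)

-- Coincidence and substitution lemmas

coincidence-view : ∀ {φ : Formula σ M} → View φ → ∀ A {v w} → (∀ {x} → x ∈ free φ → v x ≡ w x) →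
                   ⟦ φ ⟧ A v ≡ ⟦ φ ⟧ A w
coincidence-view true′         A eq = refl
coincidence-view false′        A eq = refl
coincidence-view (x ≈′ y)      A eq =
  cong₂ (λ a b → ⌊ Structure._≟_ A a b ⌋) (eq (here refl)) (eq (there (here refl)))
coincidence-view (rel R xs)    A eq = cong (Structure.holds A R) (map-cong-∈ xs eq)
coincidence-view (dist≤ x y e) A eq = cong₂ (Structure.within A e) (eq (here refl)) (eq (there (here refl)))
coincidence-view (¬′ φ)        A eq = cong not (coincidence-view φ A eq)
coincidence-view (_∧′_ {φ} p q) A eq =
  cong₂ _∧_ (coincidence-view p A (eq ∘ ∈-++⁺ˡ)) (coincidence-view q A (eq ∘ ∈-++⁺ʳ (free φ)))
coincidence-view (_∨′_ {φ} p q) A eq =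
  cong₂ _∨_ (coincidence-view p A (eq ∘ ∈-++⁺ˡ)) (coincidence-view q A (eq ∘ ∈-++⁺ʳ (free φ)))
coincidence-view (quantified Q x {φ} p) A {v} {w} eq = begin
  ⟦ quantify Q x φ ⟧ A v           ≡⟨ ⟦quantify⟧ Q x φ A v ⟩
  accepts Q (witnesses φ A v x)    ≡⟨ cong (accepts Q) (count-cong (Structure.elements A) same) ⟩
  accepts Q (witnesses φ A w x)    ≡⟨ ⟦quantify⟧ Q x φ A w ⟨
  ⟦ quantify Q x φ ⟧ A w           ∎
  where
  open ≡-Reasoning
  same : ∀ a → ⟦ φ ⟧ A (v [ x ↦ a ]) ≡ ⟦ φ ⟧ A (w [ x ↦ a ])
  same a = coincidence-view p A λ {y} y∈ →
    update-cong id {v} {w} {x} {a} y (λ y≢x → eq (free-quantify⁺ Q φ y∈ y≢x))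

coincidence : ∀ (φ : Formula σ M) A {v w} → (∀ {x} → x ∈ free φ → v x ≡ w x) → ⟦ φ ⟧ A v ≡ ⟦ φ ⟧ A w
coincidence φ = coincidence-view (view φ)

subst-view : ∀ {φ : Formula σ M} → View φ → ∀ {x y} → y ∉ bound φ → ∀ A v →
             ⟦ φ [ x ≔ y ] ⟧ A v ≡ ⟦ φ ⟧ A (v [ x ↦ v y ])
subst-view true′         y∉ A v = refl
subst-view false′        y∉ A v = refl
subst-view (x ≈′ y) {u} {w} y∉ A v =
  cong₂ (λ a b → ⌊ Structure._≟_ A a b ⌋) (lookup-replace v u w x) (lookup-replace v u w y)
subst-view (rel R xs) {u} {w} y∉ A v = cong (Structure.holds A R)
  (trans (sym (Vec.map-∘ v (replace u w) xs)) (Vec.map-cong (lookup-replace v u w) xs))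
subst-view (dist≤ x y e) {u} {w} y∉ A v =
  cong₂ (Structure.within A e) (lookup-replace v u w x) (lookup-replace v u w y)
subst-view (¬′ p)        y∉ A v = cong not (subst-view p y∉ A v)
subst-view (_∧′_ {φ} p q) y∉ A v =
  cong₂ _∧_ (subst-view p (y∉ ∘ ∈-++⁺ˡ) A v) (subst-view q (y∉ ∘ ∈-++⁺ʳ (bound φ)) A v)
subst-view (_∨′_ {φ} p q) y∉ A v =
  cong₂ _∨_ (subst-view p (y∉ ∘ ∈-++⁺ˡ) A v) (subst-view q (y∉ ∘ ∈-++⁺ʳ (bound φ)) A v)
subst-view (quantified Q z {φ} p) {x} {y} y∉ A v with z ℕ.≟ x
... | yes refl = begin
  ⟦ quantify Q z φ [ z ≔ y ] ⟧ A v      ≡⟨ cong (λ χ → ⟦ χ ⟧ A v) (subst-quantify-bound Q φ) ⟩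
  ⟦ quantify Q z φ ⟧ A v                ≡⟨ coincidence (quantify Q z φ) A (λ u∈ →
                                             sym (update-other v (proj₂ (free-quantify⁻ Q φ u∈)))) ⟩
  ⟦ quantify Q z φ ⟧ A (v [ z ↦ v y ])  ∎
  where open ≡-Reasoning
... | no z≢x = begin
  ⟦ quantify Q z φ [ x ≔ y ] ⟧ A v               ≡⟨ cong (λ χ → ⟦ χ ⟧ A v) (subst-quantify Q φ z≢x) ⟩
  ⟦ quantify Q z (φ [ x ≔ y ]) ⟧ A v             ≡⟨ ⟦quantify⟧ Q z (φ [ x ≔ y ]) A v ⟩
  accepts Q (witnesses (φ [ x ≔ y ]) A v z)      ≡⟨ cong (accepts Q) (count-cong (Structure.elements A) inner) ⟩
  accepts Q (witnesses φ A (v [ x ↦ v y ]) z)    ≡⟨ ⟦quantify⟧ Q z φ A (v [ x ↦ v y ]) ⟨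
  ⟦ quantify Q z φ ⟧ A (v [ x ↦ v y ])           ∎
  where
  open ≡-Reasoning
  y∉′ : y ∉ z ∷ bound φ
  y∉′ = subst (y ∉_) (bound-quantify Q z φ) y∉
  inner : ∀ a → ⟦ φ [ x ≔ y ] ⟧ A (v [ z ↦ a ]) ≡ ⟦ φ ⟧ A ((v [ x ↦ v y ]) [ z ↦ a ])
  -- The bound variable z differs from y and from x: its update leaves the value of y alone and
  -- commutes with the update of x.
  inner a = trans (subst-view p (y∉′ ∘ there) A (v [ z ↦ a ])) (coincidence φ A λ {u} _ →
    trans (cong (λ b → ((v [ z ↦ a ]) [ x ↦ b ]) u) (update-other v (y∉′ ∘ here)))
          (update-swap v u z≢x))

substitution : ∀ (φ : Formula σ M) {x y} → y ∉ bound φ → ∀ A v → ⟦ φ [ x ≔ y ] ⟧ A v ≡ ⟦ φ ⟧ A (v [ x ↦ v y ])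
substitution φ = subst-view (view φ)

free-subst : ∀ {φ : Formula σ M} → View φ → ∀ {x y z} → z ∈ free (φ [ x ≔ y ]) → z ≡ y ⊎ (z ∈ free φ × z ≢ x)
free-subst true′ ()
free-subst false′ ()
free-subst (x ≈′ y) {u} {w} z∈ = free-pair u w x y z∈
  where
  free-pair : ∀ u w x y {z} → z ∈ replace u w x ∷ replace u w y ∷ [] → z ≡ w ⊎ (z ∈ x ∷ y ∷ [] × z ≢ u)
  free-pair u w x y (here refl) =
    replace-elim (λ z → z ≡ w ⊎ (z ∈ x ∷ y ∷ [] × z ≢ u)) x (inj₁ refl) (λ ne → inj₂ (here refl , ne))
  free-pair u w x y (there (here refl)) =
    replace-elim (λ z → z ≡ w ⊎ (z ∈ x ∷ y ∷ [] × z ≢ u)) y (inj₁ refl) (λ ne → inj₂ (there (here refl) , ne))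
free-subst (rel R xs) {u} {w} z∈ with ∈-map⁻ (replace u w) (subst (_ ∈_) (Vec.toList-map (replace u w) xs) z∈)
... | x , x∈ , refl = replace-elim (λ z → z ≡ w ⊎ (z ∈ toList xs × z ≢ u)) x (inj₁ refl) (λ ne → inj₂ (x∈ , ne))
free-subst {σ} {M} (dist≤ x y e) z∈ = free-subst {σ} {M} (x ≈′ y) z∈
free-subst (¬′ p) z∈ = free-subst p z∈
free-subst (_∧′_ {φ} {ψ} p q) {x} {y} z∈ with ∈-++⁻ (free (φ [ x ≔ y ])) z∈
... | inj₁ z∈φ = Sum.map₂ (λ (a , b) → ∈-++⁺ˡ a , b) (free-subst p z∈φ)
... | inj₂ z∈ψ = Sum.map₂ (λ (a , b) → ∈-++⁺ʳ (free φ) a , b) (free-subst q z∈ψ)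
free-subst (_∨′_ {φ} {ψ} p q) {x} {y} z∈ with ∈-++⁻ (free (φ [ x ≔ y ])) z∈
... | inj₁ z∈φ = Sum.map₂ (λ (a , b) → ∈-++⁺ˡ a , b) (free-subst p z∈φ)
... | inj₂ z∈ψ = Sum.map₂ (λ (a , b) → ∈-++⁺ʳ (free φ) a , b) (free-subst q z∈ψ)
free-subst (quantified Q u {φ} p) {x} {y} {z} z∈ with u ℕ.≟ x
... | yes refl = inj₂ (z∈′ , proj₂ (free-quantify⁻ Q φ z∈′))
  where
  z∈′ : z ∈ free (quantify Q u φ)
  z∈′ = subst (λ χ → z ∈ free χ) (subst-quantify-bound Q φ) z∈
... | no u≢x with free-quantify⁻ Q (φ [ x ≔ y ]) (subst (λ χ → z ∈ free χ) (subst-quantify Q φ u≢x) z∈)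
...   | z∈′ , z≢u = Sum.map₂ (λ (a , b) → free-quantify⁺ Q φ a z≢u , b) (free-subst p z∈′)

qr-subst : ∀ {φ : Formula σ M} → View φ → ∀ {x y} → qr (φ [ x ≔ y ]) ≡ qr φ
qr-subst true′         = refl
qr-subst false′        = refl
qr-subst (x ≈′ y)      = refl
qr-subst (rel R xs)    = refl
qr-subst (dist≤ x y e) = refl
qr-subst (¬′ p)        = qr-subst p
qr-subst (p ∧′ q)      = cong₂ _⊔_ (qr-subst p) (qr-subst q)
qr-subst (p ∨′ q)      = cong₂ _⊔_ (qr-subst p) (qr-subst q)
qr-subst (quantified Q z {φ} p) {x} {y} with z ℕ.≟ x
... | yes refl = cong qr (subst-quantify-bound Q φ)
... | no z≢x   = begin
  qr (quantify Q z φ [ x ≔ y ])    ≡⟨ cong qr (subst-quantify Q φ z≢x) ⟩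
  qr (quantify Q z (φ [ x ≔ y ]))  ≡⟨ qr-quantify Q z (φ [ x ≔ y ]) ⟩
  suc (qr (φ [ x ≔ y ]))           ≡⟨ cong suc (qr-subst p) ⟩
  suc (qr φ)                       ≡⟨ qr-quantify Q z φ ⟨
  qr (quantify Q z φ)              ∎
  where open ≡-Reasoning

-- Decision trees

-- The free monad on yes-no questions. Unlike a formula, a tree can return a list of indices, a
-- residue or another tree, on which later questions depend.
data Tree {σ M} (P : Formula σ M → Set) (B : Set) : Set where
  leaf : B → Tree P B
  ask  : ∀ ψ → P ψ → Tree P B → Tree P B → Tree P B

Oracle : Signature → List ℕ → Set
Oracle σ M = Formula σ M → Bool

run : Tree {σ} {M} P B → Oracle σ M → B
run (leaf b)      ρ = b
run (ask ψ _ t f) ρ = if ρ ψ then run t ρ else run f ρ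

infixl 1 _>>=_

_>>=_ : Tree P B → (B → Tree P C) → Tree P C
leaf b      >>= g = g b
ask ψ p t f >>= g = ask ψ p (t >>= g) (f >>= g)

run->>= : ∀ (t : Tree {σ} {M} P B) (g : B → Tree P C) ρ → run (t >>= g) ρ ≡ run (g (run t ρ)) ρ
run->>= (leaf b)      g ρ = refl
run->>= (ask ψ _ t f) g ρ with ρ ψ
... | true  = run->>= t g ρ
... | false = run->>= f g ρ

query : ∀ ψ → P ψ → Tree P Bool
query ψ p = ask ψ p (leaf true) (leaf false)

if-true-false : ∀ b → (if b then true else false) ≡ b
if-true-false true  = refl
if-true-false false = refl

run->>=-query : ∀ (χ : B → Formula σ M) (p : ∀ b → P (χ b)) (t : Tree P B) ρ →
                run (t >>= λ b → query (χ b) (p b)) ρ ≡ ρ (χ (run t ρ))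
run->>=-query {P = P} χ p t ρ =
  trans (run->>= t (λ b → query (χ b) (p b)) ρ) (if-true-false (ρ (χ (run t ρ))))

reask : (∀ {ψ} → P₁ ψ → P₂ ψ) → Tree P₁ B → Tree P₂ B
reask h (leaf b)      = leaf b
reask h (ask ψ p t f) = ask ψ (h p) (reask h t) (reask h f)

run-reask : ∀ (h : ∀ {ψ} → P₁ ψ → P₂ ψ) (t : Tree {σ} {M} P₁ B) ρ → run (reask {P₂ = P₂} h t) ρ ≡ run t ρ
run-reask h (leaf b)      ρ = refl
run-reask h (ask ψ _ t f) ρ = cong₂ (if ρ ψ then_else_) (run-reask h t ρ) (run-reask h f ρ)

-- Questions of the first kind do not mention the variable about to be quantified,
-- so they may be asked before it is.
pull : (∀ {ψ} → P ψ → P₁ ψ ⊎ P₂ ψ) → Tree P B → Tree P₁ (Tree P₂ B)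
pull h (leaf b)      = leaf (leaf b)
pull h (ask ψ p t f) with h p
... | inj₁ p₁ = ask ψ p₁ (pull h t) (pull h f)
... | inj₂ p₂ = pull h t >>= λ t′ → pull h f >>= λ f′ → leaf (ask ψ p₂ t′ f′)

-- Typically ρ answers before the variable has a value and ρ′ afterwards. They agree on the
-- questions asked first, so one residual tree is right for all values. A question of the second
-- kind has no answer yet, and so both of its branches are pulled.
run-pull : ∀ (h : ∀ {ψ} → P ψ → P₁ ψ ⊎ P₂ ψ) (t : Tree {σ} {M} P B) {ρ ρ′} →
           (∀ {ψ} → P₁ ψ → ρ ψ ≡ ρ′ ψ) → run (run (pull {P₁ = P₁} {P₂ = P₂} h t) ρ) ρ′ ≡ run t ρ′
run-pull h (leaf b)      same = refl
run-pull h (ask ψ p t f) {ρ} {ρ′} same with h p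
... | inj₁ p₁ rewrite same p₁ with ρ′ ψ
...   | true  = run-pull h t same
...   | false = run-pull h f same
run-pull {P₁ = P₁} {P₂ = P₂} h (ask ψ p t f) {ρ} {ρ′} same | inj₂ p₂
  rewrite run->>= (pull {P₁ = P₁} {P₂ = P₂} h t) (λ t′ → pull h f >>= λ f′ → leaf (ask ψ p₂ t′ f′)) ρ
        | run->>= (pull {P₁ = P₁} {P₂ = P₂} h f) (λ f′ → leaf (ask ψ p₂ (run (pull h t) ρ) f′)) ρ
  = cong₂ (if ρ′ ψ then_else_) (run-pull h t same) (run-pull h f same)

formula : Tree {σ} {M} P Bool → Formula σ M
formula (leaf true)   = true′
formula (leaf false)  = false′
formula (ask ψ _ t f) = (ψ ∧′ formula t) ∨′ (¬′ ψ ∧′ formula f)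

oracle : (A : Structure σ) → Assignment A → Oracle σ M
oracle A v ψ = ⟦ ψ ⟧ A v

⟦formula⟧ : ∀ (t : Tree {σ} {M} P Bool) A v → ⟦ formula t ⟧ A v ≡ run t (oracle A v)
⟦formula⟧ (leaf true)   A v = refl
⟦formula⟧ (leaf false)  A v = refl
⟦formula⟧ (ask ψ _ t f) A v with ⟦ ψ ⟧ A v
... | true  = trans (∨-identityʳ (⟦ formula t ⟧ A v)) (⟦formula⟧ t A v)
... | false = ⟦formula⟧ f A v

formula-free : ∀ {F : Var → Set} (t : Tree {σ} {M} P Bool) → (∀ {ψ} → P ψ → ∀ {x} → x ∈ free ψ → F x) →
               ∀ {x} → x ∈ free (formula t) → F x
formula-free (leaf true)   h ()
formula-free (leaf false)  h ()
formula-free (ask ψ p t f) h x∈ with ∈-++⁻ (free (ψ ∧′ formula t)) x∈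
... | inj₁ x∈₁ = [ h p , formula-free t h ]′ (∈-++⁻ (free ψ) x∈₁)
... | inj₂ x∈₂ = [ h p , formula-free f h ]′ (∈-++⁻ (free ψ) x∈₂)

formula-qr : ∀ {n} (t : Tree {σ} {M} P Bool) → (∀ {ψ} → P ψ → qr ψ ≤ n) → qr (formula t) ≤ n
formula-qr (leaf true)   h = z≤n
formula-qr (leaf false)  h = z≤n
formula-qr (ask ψ p t f) h =
  ⊔-lub (⊔-lub (h p) (formula-qr t h)) (⊔-lub (h p) (formula-qr f h))

anyT : (X → Tree P Bool) → List X → Tree P Bool
anyT g []       = leaf false
anyT g (x ∷ xs) = g x >>= λ b → if b then leaf true else anyT g xs

run-anyT : ∀ (g : X → Tree {σ} {M} P Bool) xs ρ → run (anyT g xs) ρ ≡ any (λ x → run (g x) ρ) xs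
run-anyT g []       ρ = refl
run-anyT g (x ∷ xs) ρ rewrite run->>= (g x) (λ b → if b then leaf true else anyT g xs) ρ with run (g x) ρ
... | true  = refl
... | false = run-anyT g xs ρ

filterT : (X → Tree P Bool) → List X → Tree P (List X)
filterT g []       = leaf []
filterT g (x ∷ xs) = g x >>= λ b → filterT g xs >>= λ ys → leaf (if b then x ∷ ys else ys)

run-filterT : ∀ (g : X → Tree {σ} {M} P Bool) xs ρ → run (filterT g xs) ρ ≡ filterᵇ (λ x → run (g x) ρ) xs
run-filterT g []       ρ = refl
run-filterT g (x ∷ xs) ρ
  rewrite run->>= (g x) (λ b → filterT g xs >>= λ ys → leaf (if b then x ∷ ys else ys)) ρ
        | run->>= (filterT g xs) (λ ys → leaf (if run (g x) ρ then x ∷ ys else ys)) ρ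
        | run-filterT g xs ρ
  with run (g x) ρ
... | true  = refl
... | false = refl

-- Atoms

data Atomic {σ M} : Formula σ M → Set where
  equality : ∀ {x y} → Atomic (x ≈′ y)
  relation : ∀ {R xs} → Atomic (rel R xs)
  distance : ∀ {x y e} → Atomic (dist≤ x y e)

-- Unlike `md`, this is positive for relational atoms: their variables denote neighbours or equal
-- elements although no distance is written.
reach : Formula σ M → ℕ
reach (rel _ _)     = 1
reach (dist≤ _ _ e) = e
reach _             = 0

reach-within : Atomic γ → ∀ A v {x y} → T (⟦ γ ⟧ A v) → x ∈ free γ → y ∈ free γ → Within A (reach γ) (v x) (v y)
reach-within {γ = u ≈′ w} equality A v t x∈ y∈ with toWitness {a? = Structure._≟_ A (v u) (v w)} t
... | vu≡vw = subst₂ (Within A 0) (value x∈) (value y∈) (within-here A 0)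
  where
  value : ∀ {x} → x ∈ u ∷ w ∷ [] → v u ≡ v x
  value (here refl)         = refl
  value (there (here refl)) = vu≡vw
reach-within {γ = rel R xs} relation A v t x∈ y∈ =
  commonTuple-within A (R , Vec.map v xs , t , value x∈ , value y∈)
  where
  value : ∀ {x} → x ∈ toList xs → v x ∈ toList (Vec.map v xs)
  value x∈ = subst (_ ∈_) (sym (Vec.toList-map v xs)) (∈-map⁺ v x∈)
reach-within {γ = dist≤ u w e} distance A v t x∈ y∈ = go x∈ y∈
  where
  go : ∀ {x y} → x ∈ u ∷ w ∷ [] → y ∈ u ∷ w ∷ [] → Within A e (v x) (v y)
  go (here refl)         (here refl)         = within-here A e
  go (here refl)         (there (here refl)) = path t
  go (there (here refl)) (here refl)         = within-sym A e (path t)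
  go (there (here refl)) (there (here refl)) = within-here A e

Ball⊆ : (A : Structure σ) → ℕ → Structure.Carrier A → (Structure.Carrier A → Bool) → Set
Ball⊆ A r a P = ∀ c → Within A r a c → T (P c)

Ball⊆-mono : ∀ (A : Structure σ) {r s a P} → r ≤ s → Ball⊆ A s a P → Ball⊆ A r a P
Ball⊆-mono A r≤s ball c w = ball c (within-mono A r≤s w)

-- Among atoms only distance atoms can change their truth value in an induced substructure, since a
-- path may leave it.
Anchored : Atomic γ → (A : Structure σ) → Assignment A → (Structure.Carrier A → Bool) → Set
Anchored equality               A v P = ⊤₀
Anchored relation               A v P = ⊤₀
Anchored (distance {x} {y} {e}) A v P = Ball⊆ A e (v x) P ⊎ Ball⊆ A e (v y) P

atomic-local : (a : Atomic γ) → ∀ (A : Structure σ) P o v (w : Assignment (induced A P o)) → Anchored a A v P →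
               (∀ {x} → x ∈ free γ → proj₁ (w x) ≡ v x) → ⟦ γ ⟧ A v ≡ ⟦ γ ⟧ (induced A P o) w
atomic-local {γ = x ≈′ y} equality A P o v w _ eq
  rewrite sym (eq (here refl)) | sym (eq (there (here refl))) = T-ext
  (λ t → fromWitness {a? = Structure._≟_ (induced A P o) (w x) (w y)}
           (restriction-≡ A P o (w x) (w y) (toWitness {a? = Structure._≟_ A (proj₁ (w x)) (proj₁ (w y))} t)))
  (λ t → fromWitness {a? = Structure._≟_ A (proj₁ (w x)) (proj₁ (w y))}
           (cong proj₁ (toWitness {a? = Structure._≟_ (induced A P o) (w x) (w y)} t)))
atomic-local {γ = rel R xs} relation A P o v w _ eq = cong (Structure.holds A R)
  (trans (map-cong-∈ xs (sym ∘ eq)) (Vec.map-∘ proj₁ w xs))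
atomic-local {γ = dist≤ x y e} distance A P o v w anchor eq
  rewrite sym (eq (here refl)) | sym (eq (there (here refl))) with anchor
... | inj₁ ball = within-induced A P o e (w x) (w y) ball
... | inj₂ ball = T-ext
  (λ t → Within.reached (within-sym (induced A P o) e
           (within-induced⁺ A P o e ball (within-sym A e (path t)))))
  (λ t → Within.reached (within-induced⁻ A P o e (path t)))

anchored-at : ∀ (a : Atomic γ) (A : Structure σ) {P v x} →
              x ∈ free γ → Ball⊆ A (reach γ) (v x) P → Anchored a A v P
anchored-at equality A x∈ ball = tt
anchored-at relation A x∈ ball = tt
anchored-at distance A (here refl)         ball = inj₁ ball
anchored-at distance A (there (here refl)) ball = inj₂ ball

anchored : ∀ (a : Atomic γ) (A : Structure σ) {P v} →
           (∀ {x} → x ∈ free γ → Ball⊆ A (md γ) (v x) P) → Anchored a A v P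
anchored equality A ball = tt
anchored relation A ball = tt
anchored distance A ball = inj₁ (ball (here refl))

atomic-qr : Atomic γ → qr γ ≡ 0
atomic-qr equality = refl
atomic-qr relation = refl
atomic-qr distance = refl

atomic-bound : Atomic γ → bound γ ≡ []
atomic-bound equality = refl
atomic-bound relation = refl
atomic-bound distance = refl

atomic-subst : ∀ {x y} → Atomic γ → Atomic (γ [ x ≔ y ])
atomic-subst equality = equality
atomic-subst relation = relation
atomic-subst distance = distance

reach-subst : ∀ {x y} → Atomic γ → reach (γ [ x ≔ y ]) ≡ reach γ
reach-subst equality = refl
reach-subst relation = refl
reach-subst distance = refl

md-subst : ∀ {x y} → Atomic γ → md (γ [ x ≔ y ]) ≡ md γ
md-subst equality = refl
md-subst relation = refl
md-subst distance = refl

free-subst-atomic : ∀ {x y u} → Atomic γ → u ∈ free γ → replace x y u ∈ free (γ [ x ≔ y ])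
free-subst-atomic equality (here refl)         = here refl
free-subst-atomic equality (there (here refl)) = there (here refl)
free-subst-atomic {γ = rel R xs} {x} {y} relation u∈ =
  subst (_ ∈_) (sym (Vec.toList-map (replace x y) xs)) (∈-map⁺ (replace x y) u∈)
free-subst-atomic distance (here refl)         = here refl
free-subst-atomic distance (there (here refl)) = there (here refl)

-- The syntactic fragment of local formulas

-- Bounds the distance in an atomic formula of the class. It is smaller than `r₁` only for q = 0 and
-- d = 0, where relational atoms still connect elements at distance 1.
cap : ℕ → ℕ → ℕ → ℕ
cap d zero    k = d
cap d (suc q) k = r₁ (suc q) k d

-- Some variable `i < k` is demanded because `r₁ (suc q) 0 d` is 0.
r₁-step : ∀ q {k d i} → i < k → r₁ q (suc k) d ≤ r₁ (suc q) k d
r₁-step q {suc k} i<k = m≤n*m _ (4 * suc k)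

1≤r₁ : ∀ q k d → 1 ≤ r₁ q (suc k) d
1≤r₁ zero    k d = m≤n⊔m d 1
1≤r₁ (suc q) k d = ≤-trans (1≤r₁ q (suc k) d) (r₁-step q {i = 0} (s≤s z≤n))

cap≤r₁ : ∀ d q k → cap d q k ≤ r₁ q k d
cap≤r₁ d zero    k = m≤m⊔n d 1
cap≤r₁ d (suc q) k = ≤-refl

-- A quantified variable is guarded by an atom γ that keeps it close to some free variable i.
-- Only for ∃ and γ = dist(i, k) ≤ e may γ exceed the atoms of the class below.
data Local {σ M} (d : ℕ) : ℕ → ℕ → Formula σ M → Set where
  true′   : Local d q k true′
  false′  : Local d q k false′
  atom    : Atomic γ → FreeBelow k γ → md γ ≤ cap d q k → Local d q k γ
  ¬′_     : Local d q k φ → Local d q k (¬′ φ)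
  _∧′_    : Local d q k φ → Local d q k ψ → Local d q k (φ ∧′ ψ)
  _∨′_    : Local d q k φ → Local d q k ψ → Local d q k (φ ∨′ ψ)
  raise   : Local d q (suc k) φ → FreeBelow k φ → Local d (suc q) k φ
  guarded : ∀ (Q : Quantifier M) {i} → Local d q (suc k) θ → Atomic γ → FreeBelow (suc k) γ →
            i < k → i ∈ free γ → k ∈ free γ → reach γ + r₁ q (suc k) d ≤ r₁ (suc q) k d →
            (md γ ≤ cap d q (suc k)) ⊎ (Q ≡ some × γ ≡ dist≤ i k (reach γ)) →
            Local d (suc q) k (quantify Q k (γ ∧′ θ))

below-suc : ∀ {x k} → x ≢ k → x < suc k → x < k
below-suc x≢k x<1+k with m≤n⇒m<n∨m≡n (≤-pred x<1+k)
... | inj₁ x<k = x<k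
... | inj₂ x≡k = contradiction x≡k x≢k

local-below : Local {σ} {M} d q k φ → FreeBelow k φ
local-below true′             x ()
local-below false′            x ()
local-below (atom _ below _)  x x∈ = below x x∈
local-below (¬′ l)            x x∈ = local-below l x x∈
local-below (_∧′_ {φ = φ} l m) x x∈ = [ local-below l x , local-below m x ]′ (∈-++⁻ (free φ) x∈)
local-below (_∨′_ {φ = φ} l m) x x∈ = [ local-below l x , local-below m x ]′ (∈-++⁻ (free φ) x∈)
local-below (raise _ below)   x x∈ = below x x∈
local-below (guarded {θ = θ} {γ = γ} Q l _ below _ _ _ _ _) x x∈ with free-quantify⁻ Q (γ ∧′ θ) x∈
... | x∈′ , x≢k = below-suc x≢k ([ below x , local-below l x ]′ (∈-++⁻ (free γ) x∈′))

-- Each quantifier binds the first variable not yet in use. Hence a variable below k can be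
-- substituted without capture, in particular x₁ when a sentence is formed.
local-bound : Local {σ} {M} d q k φ → ∀ {x} → x ∈ bound φ → k ≤ x
local-bound (atom a _ _) x∈ rewrite atomic-bound a with () ← x∈
local-bound (¬′ l) x∈ = local-bound l x∈
local-bound (_∧′_ {φ = φ} l m) x∈ = [ local-bound l , local-bound m ]′ (∈-++⁻ (bound φ) x∈)
local-bound (_∨′_ {φ = φ} l m) x∈ = [ local-bound l , local-bound m ]′ (∈-++⁻ (bound φ) x∈)
local-bound (raise l _) x∈ = ≤-trans (n≤1+n _) (local-bound l x∈)
local-bound {k = k} (guarded {θ = θ} {γ = γ} Q l a _ _ _ _ _ _) {x} x∈ =
  go (subst (x ∈_) (trans (bound-quantify Q k (γ ∧′ θ)) (cong (λ ys → k ∷ ys ++ bound θ) (atomic-bound a))) x∈)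
  where
  go : x ∈ k ∷ bound θ → k ≤ x
  go (here refl)  = ≤-refl
  go (there x∈θ) = ≤-trans (n≤1+n _) (local-bound l x∈θ)

quantifier-free : ∀ {φ : Formula σ M} q → qr φ ≡ 0 → FreeBelow k φ → md φ ≤ d → FO+MOD⁺ q k d φ
quantifier-free zero    q≡0 below md≤ = q≡0 , below , md≤
quantifier-free {φ = φ} (suc q) q≡0 below md≤ =
  below , base (lower (quantifier-free {φ = φ} q q≡0 (λ x x∈ → ≤-trans (below x x∈) (n≤1+n _)) md≤) below)

atomic-class : ∀ q → Atomic γ → FreeBelow k γ → md γ ≤ cap d q k → FO+MOD⁺ q k d γ
atomic-class {γ = γ} zero    a        below md≤ = quantifier-free {φ = γ} 0 (atomic-qr a) below md≤
atomic-class {γ = γ} (suc q) equality below md≤ = quantifier-free {φ = γ} (suc q) refl below z≤n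
atomic-class {γ = γ} (suc q) relation below md≤ = quantifier-free {φ = γ} (suc q) refl below z≤n
atomic-class (suc q) distance below md≤ =
  below , base (distance (below _ (here refl)) (below _ (there (here refl))) md≤)

∧-class : ∀ q → FO+MOD⁺ q k d φ → FO+MOD⁺ q k d ψ → FO+MOD⁺ q k d (φ ∧′ ψ)
∧-class {φ = φ} zero (a , b , c) (a′ , b′ , c′) =
  cong₂ _⊔_ a a′ , (λ x x∈ → [ b x , b′ x ]′ (∈-++⁻ (free φ) x∈)) , ⊔-lub c c′
∧-class {φ = φ} (suc q) (b , c) (b′ , c′) =
  (λ x x∈ → [ b x , b′ x ]′ (∈-++⁻ (free φ) x∈)) , conj c c′

∨-class : ∀ q → FO+MOD⁺ q k d φ → FO+MOD⁺ q k d ψ → FO+MOD⁺ q k d (φ ∨′ ψ)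
∨-class {φ = φ} zero (a , b , c) (a′ , b′ , c′) =
  cong₂ _⊔_ a a′ , (λ x x∈ → [ b x , b′ x ]′ (∈-++⁻ (free φ) x∈)) , ⊔-lub c c′
∨-class {φ = φ} (suc q) (b , c) (b′ , c′) =
  (λ x x∈ → [ b x , b′ x ]′ (∈-++⁻ (free φ) x∈)) , disj c c′

¬-class : ∀ q → FO+MOD⁺ q k d φ → FO+MOD⁺ q k d (¬′ φ)
¬-class zero    c       = c
¬-class (suc q) (b , c) = b , neg c

local-class : Local {σ} {M} d q k φ → FO+MOD⁺ q k d φ
local-class {q = q} true′                  = quantifier-free {φ = true′} q refl (λ _ ()) z≤n
local-class {q = q} false′                 = quantifier-free {φ = false′} q refl (λ _ ()) z≤n
local-class {q = q} (atom a below md≤)     = atomic-class q a below md≤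
local-class {q = q} (¬′ l)                 = ¬-class q (local-class l)
local-class {q = q} (l ∧′ m)               = ∧-class q (local-class l) (local-class m)
local-class {q = q} (l ∨′ m)               = ∨-class q (local-class l) (local-class m)
local-class         (raise l below)        = below , base (lower (local-class l) below)
-- This guard may be too wide for the class below, and `near` admits it nevertheless. In the
-- remaining cases `γ ∧′ θ` is itself a formula of that class.
local-class l@(guarded some l′ a below i<k i∈ k∈ r≤ (inj₂ (_ , γ≡))) =
  local-below l , base (subst (λ χ → Generator _ _ _ _ (∃′ _ (χ ∧′ _))) (sym γ≡) (near (local-class l′) i<k r≤))
local-class {q = suc q} l@(guarded some l′ a below i<k i∈ k∈ r≤ (inj₁ md≤)) =
  local-below l , base (exists (∧-class q (atomic-class q a below md≤) (local-class l′)))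
local-class {q = suc q} l@(guarded (mod m∈ i) l′ a below i<k i∈ k∈ r≤ (inj₁ md≤)) =
  local-below l , base (modulo m∈ i (∧-class q (atomic-class q a below md≤) (local-class l′)))

local-subst : ∀ {x y} → Local {σ} {M} d q k φ → x < k → y < k → Local d q k (φ [ x ≔ y ])
local-subst true′  x<k y<k = true′
local-subst false′ x<k y<k = false′
local-subst {φ = γ} {x} {y} (atom a below md≤) x<k y<k =
  atom (atomic-subst a) (subst-below below y<k) (≤-trans (≤-reflexive (md-subst a)) md≤)
  where
  subst-below : ∀ {k} → FreeBelow k γ → y < k → FreeBelow k (γ [ x ≔ y ])
  subst-below below y<k z z∈ with free-subst (view γ) z∈
  ... | inj₁ refl     = y<k
  ... | inj₂ (z∈′ , _) = below z z∈′
local-subst (¬′ l)   x<k y<k = ¬′ local-subst l x<k y<k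
local-subst (l ∧′ m) x<k y<k = local-subst l x<k y<k ∧′ local-subst m x<k y<k
local-subst (l ∨′ m) x<k y<k = local-subst l x<k y<k ∨′ local-subst m x<k y<k
local-subst {φ = φ} {x} {y} (raise l below) x<k y<k =
  raise (local-subst l (≤-trans x<k (n≤1+n _)) (≤-trans y<k (n≤1+n _)))
    λ z z∈ → [ (λ { refl → y<k }) , below z ∘ proj₁ ]′ (free-subst (view φ) z∈)
local-subst {d = d} {k = k} {x = x} {y} (guarded {q = q} {θ = θ} {γ = γ} Q {i} l a below i<k i∈ k∈ r≤ cls) x<k y<k =
  subst (Local d (suc q) k) (sym (subst-quantify Q (γ ∧′ θ) k≢x))
    (guarded Q (local-subst l (≤-trans x<k (n≤1+n _)) (≤-trans y<k (n≤1+n _))) (atomic-subst a) below′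
      (replace-elim (_< k) i y<k (λ _ → i<k)) (free-subst-atomic a i∈)
      (subst (_∈ free (γ [ x ≔ y ])) (replace-other k≢x) (free-subst-atomic a k∈))
      (subst (λ n → n + r₁ q (suc k) d ≤ r₁ (suc q) k d) (sym (reach-subst a)) r≤)
      (Sum.map (≤-trans (≤-reflexive (md-subst a))) (λ (Q≡ , γ≡) → Q≡ , guard≡ γ≡) cls))
  where
  k≢x : k ≢ x
  k≢x refl = <-irrefl refl x<k
  below′ : FreeBelow (suc k) (γ [ x ≔ y ])
  below′ z z∈ = [ (λ { refl → ≤-trans y<k (n≤1+n _) }) , below z ∘ proj₁ ]′ (free-subst (view γ) z∈)
  guard≡ : γ ≡ dist≤ i k (reach γ) → γ [ x ≔ y ] ≡ dist≤ (replace x y i) k (reach (γ [ x ≔ y ]))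
  guard≡ γ≡ = trans (cong (_[ x ≔ y ]) γ≡) (cong₂ (dist≤ (replace x y i)) (replace-other k≢x) (sym (reach-subst a)))

-- `P` may be any set containing the balls, not exactly their union: under a quantifier the tuple
-- grows while the substructure stays the same.
LocalAt : ℕ → Formula σ M → Set₁
LocalAt {σ} r φ = ∀ (A : Structure σ) P o v (w : Assignment (induced A P o)) →
  (∀ {x} → x ∈ free φ → Ball⊆ A r (v x) P) → (∀ {x} → x ∈ free φ → proj₁ (w x) ≡ v x) →
  ⟦ φ ⟧ A v ≡ ⟦ φ ⟧ (induced A P o) w

-- A witness of a guarded quantifier lies within `reach γ` of the value of i, and so its own ball of
-- radius `r₁ q (suc k) d` is inside the ball of i. Thus all witnesses belong to `P` and the
-- induction applies at each of them; their number is unchanged, which settles both quantifiers.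
local-at : Local {σ} {M} d q k φ → LocalAt (r₁ q k d) φ
local-at true′  A P o v w ball eq = refl
local-at false′ A P o v w ball eq = refl
local-at {d = d} {q} {k} (atom a below md≤) A P o v w ball eq =
  atomic-local a A P o v w (anchored a A (λ x∈ → Ball⊆-mono A (≤-trans md≤ (cap≤r₁ d q k)) (ball x∈))) eq
local-at (¬′ l) A P o v w ball eq = cong not (local-at l A P o v w ball eq)
local-at (_∧′_ {φ = φ} l m) A P o v w ball eq = cong₂ _∧_
  (local-at l A P o v w (ball ∘ ∈-++⁺ˡ) (eq ∘ ∈-++⁺ˡ))
  (local-at m A P o v w (ball ∘ ∈-++⁺ʳ (free φ)) (eq ∘ ∈-++⁺ʳ (free φ)))
local-at (_∨′_ {φ = φ} l m) A P o v w ball eq = cong₂ _∨_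
  (local-at l A P o v w (ball ∘ ∈-++⁺ˡ) (eq ∘ ∈-++⁺ˡ))
  (local-at m A P o v w (ball ∘ ∈-++⁺ʳ (free φ)) (eq ∘ ∈-++⁺ʳ (free φ)))
local-at (raise {q = q} l below) A P o v w ball eq =
  local-at l A P o v w (λ x∈ → Ball⊆-mono A (r₁-step q (below _ x∈)) (ball x∈)) eq
local-at {d = d} {k = k} (guarded {q = q} {θ = θ} {γ = γ} Q {i} l a below i<k i∈ k∈ r≤ _) A P o v w ball eq = begin
  ⟦ quantify Q k (γ ∧′ θ) ⟧ A v             ≡⟨ ⟦quantify⟧ Q k (γ ∧′ θ) A v ⟩
  accepts Q (witnesses (γ ∧′ θ) A v k)      ≡⟨ cong (accepts Q) (count-restrict P (Structure.elements A) close same) ⟩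
  accepts Q (witnesses (γ ∧′ θ) A↾P w k)    ≡⟨ ⟦quantify⟧ Q k (γ ∧′ θ) A↾P w ⟨
  ⟦ quantify Q k (γ ∧′ θ) ⟧ A↾P w           ∎
  where
  open ≡-Reasoning
  A↾P : Structure _
  A↾P = induced A P o
  i≢k : i ≢ k
  i≢k = <⇒≢ i<k
  ball-i : Ball⊆ A (r₁ (suc q) k d) (v i) P
  ball-i = ball (free-quantify⁺ Q (γ ∧′ θ) (∈-++⁺ˡ i∈) i≢k)
  guard-within : ∀ a′ → T (⟦ γ ⟧ A (v [ k ↦ a′ ])) → Within A (reach γ) (v i) a′
  guard-within a′ t = subst₂ (Within A (reach γ)) (update-other v i≢k) (update-same v k)
    (reach-within a A (v [ k ↦ a′ ]) t i∈ k∈)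
  close : ∀ a′ → T (⟦ γ ∧′ θ ⟧ A (v [ k ↦ a′ ])) → T (P a′)
  close a′ t = ball-i a′ (within-mono A (≤-trans (m≤m+n _ _) r≤) (guard-within a′ (proj₁ (∧⁻ t))))
  eq′ : ∀ {χ : Formula _ _} (x′ : Restriction P) → (∀ {x} → x ∈ free χ → x ∈ free (γ ∧′ θ)) →
        ∀ {x} → x ∈ free χ → proj₁ ((w [ k ↦ x′ ]) x) ≡ (v [ k ↦ proj₁ x′ ]) x
  eq′ x′ χ⊆ {x} x∈ = update-cong proj₁ {v = w} {w = v} x (λ x≢k → eq (free-quantify⁺ Q (γ ∧′ θ) (χ⊆ x∈) x≢k))
  ball′ : ∀ x′ → T (⟦ γ ⟧ A (v [ k ↦ proj₁ x′ ])) → ∀ {x} → x ∈ free θ →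
          Ball⊆ A (r₁ q (suc k) d) ((v [ k ↦ proj₁ x′ ]) x) P
  ball′ x′ t {x} x∈ with x ℕ.≟ k
  ... | yes refl = λ c near-c →
    ball-i c (within-mono A r≤ (within-trans A (reach γ) (guard-within (proj₁ x′) t) near-c))
  ... | no x≢k   = Ball⊆-mono A (r₁-step q i<k) (ball (free-quantify⁺ Q (γ ∧′ θ) (∈-++⁺ʳ (free γ) x∈) x≢k))
  same : ∀ x′ → ⟦ γ ∧′ θ ⟧ A (v [ k ↦ proj₁ x′ ]) ≡ ⟦ γ ∧′ θ ⟧ A↾P (w [ k ↦ x′ ])
  same x′ = trans
    (∧-congʳ λ t → local-at l A P o (v [ k ↦ proj₁ x′ ]) (w [ k ↦ x′ ]) (ball′ x′ t) (eq′ {θ} x′ (∈-++⁺ʳ (free γ))))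
    (cong (_∧ ⟦ θ ⟧ A↾P (w [ k ↦ x′ ])) (atomic-local a A P o (v [ k ↦ proj₁ x′ ]) (w [ k ↦ x′ ])
      (anchored-at a A {v = v [ k ↦ proj₁ x′ ]} i∈
        (subst (λ b → Ball⊆ A (reach γ) b P) (sym (update-other v i≢k))
          (Ball⊆-mono A (≤-trans (m≤m+n _ _) r≤) ball-i)))
      (eq′ {γ} x′ ∈-++⁺ˡ)))

-- 0 is added because the tuple has to be non-empty.
isLocal : Local {σ} {M} d q k φ → IsLocal (r₁ q k d) φ
isLocal {d = d} {q} {k} {φ} l = length (free φ) , x̄ , (λ x x∈ → listed x∈) , λ A v w eq →
  local-at l A (ball A v) (v 0 , Structure.ball-head A (r₁ q k d) (Vec.map v x̄)) v w
    (λ x∈ c near-c → any-intro (λ a → Structure.within A (r₁ q k d) a c) (value v x∈) (Within.reached near-c))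
    (λ {x} x∈ → eq x (listed x∈))
  where
  x̄ : Vec Var (suc (length (free φ)))
  x̄ = 0 Vec.∷ fromList (free φ)
  listed : ∀ {x} → x ∈ free φ → x ∈ toList x̄
  listed x∈ = there (subst (_ ∈_) (sym (Vec.toList∘fromList (free φ))) x∈)
  value : ∀ {V : Set} (v : Var → V) {x} → x ∈ free φ → v x ∈ toList (Vec.map v x̄)
  value v {x} x∈ = subst (v x ∈_) (sym (Vec.toList-map v x̄)) (∈-map⁺ v (listed x∈))
  ball : ∀ A → Assignment A → Structure.Carrier A → Bool
  ball A v = Structure.ball A (r₁ q k d) (Vec.map v x̄)

mapWith∈-∈ : ∀ {B : Set} (xs : List X) (f : ∀ {x} → x ∈ xs → B) {x} (x∈ : x ∈ xs) → f x∈ ∈ mapWith∈ xs f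
mapWith∈-∈ (x ∷ xs) f (here refl) = here refl
mapWith∈-∈ (x ∷ xs) f (there x∈)  = there (mapWith∈-∈ xs (f ∘ there) x∈)

-- Splitting a local formula along a partition s of the variables into two sides

record Piece {σ M} (d q k : ℕ) (F : Var → Set) (n : ℕ) (ψ : Formula σ M) : Set where
  constructor piece
  field
    local   : Local d q k ψ
    free⊆   : ∀ {x} → x ∈ free ψ → F x
    qr≤     : qr ψ ≤ n

open Piece public

OneSided : (d q k : ℕ) → (Var → Set) → (Var → Bool) → ℕ → Formula σ M → Set
OneSided d q k F s n ψ = Σ[ b ∈ Bool ] Piece d q k (λ x → F x × s x ≡ b) n ψ

-- An atom whose truth would link the two sides. By `reach≤r₁` it is false when the sides are far
-- apart; by `md≤cap` it stays in the class and can later guard a modulo-counting quantifier.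
record Crossing {σ M} (d q k : ℕ) (F : Var → Set) (s : Var → Bool) (γ : Formula σ M) : Set where
  field
    atomic    : Atomic γ
    below     : FreeBelow k γ
    md≤cap    : md γ ≤ cap d q k
    reach≤r₁  : reach γ ≤ r₁ q k d
    inside    : ∀ {x} → x ∈ free γ → F x
    {left right} : Var
    left∈     : left ∈ free γ
    right∈    : right ∈ free γ
    separated : s left ≢ s right

-- The default concerns nullary relations, which have no variable to determine a side.
side : (Var → Bool) → List Var → Bool
side s []      = true
side s (x ∷ _) = s x

onSide : ∀ (s : Var → Bool) b xs → (∀ {x} → x ∈ xs → s x ≡ b) ⊎ (∃[ x ] x ∈ xs × s x ≢ b)
onSide s b xs with All.all? (λ x → s x Bool.≟ b) xs
... | yes all = inj₁ (All.lookup all)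
... | no ¬all = inj₂ (find (All.¬All⇒Any¬ (λ x → s x Bool.≟ b) xs ¬all))

side-∈ : ∀ (s : Var → Bool) {x xs} → x ∈ xs → ∃[ y ] y ∈ xs × s y ≡ side s xs
side-∈ s {xs = y ∷ _} _ = y , here refl , refl

reach≤ : ∀ d q {k i} → i < k → Atomic γ → md γ ≤ cap d q k → reach γ ≤ r₁ q k d
reach≤ d q               i<k equality md≤ = z≤n
reach≤ d q {k = suc k}   i<k relation md≤ = 1≤r₁ q k d
reach≤ d q               i<k distance md≤ = ≤-trans md≤ (cap≤r₁ d q _)

raise-one-sided : (∀ {x} → x ∈ free φ → F x) → FreeBelow k φ →
                  OneSided d q (suc k) (_∈ free φ) s (qr φ) ψ → qr φ ≤ n → OneSided d (suc q) k F s n ψ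
raise-one-sided F∋ below (b , p) φ≤n = b , record
  { local = raise (local p) (λ x x∈ → below x (proj₁ (free⊆ p x∈)))
  ; free⊆ = λ x∈ → F∋ (proj₁ (free⊆ p x∈)) , proj₂ (free⊆ p x∈)
  ; qr≤   = ≤-trans (qr≤ p) φ≤n
  }

module _ (k : Var) (s : Var → Bool) (i : Var) where

  -- The bound variable k joins the side of i, to which its guard ties it.
  onto : Var → Bool
  onto = s [ k ↦ s i ]

  onto-bound : onto k ≡ s i
  onto-bound = update-same s k

  onto-other : ∀ {x} → x ≢ k → onto x ≡ s x
  onto-other = update-other s

qr-guarded : ∀ (Q : Quantifier M) {γ θ : Formula σ M} → Atomic γ → qr (quantify Q k (γ ∧′ θ)) ≡ suc (qr θ)
qr-guarded {k = k} Q {γ} {θ} a = trans (qr-quantify Q k (γ ∧′ θ)) (cong (λ m → suc (m ⊔ qr θ)) (atomic-qr a))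

-- Since k is on the side of i, a question about the opposite side cannot mention k and makes sense
-- outside the quantifier.
separate : ∀ {i} (Q : Quantifier M) {γ θ : Formula σ M} → Atomic γ → i < k → i ∈ free γ →
           (∀ {x} → x ∈ free (quantify Q k (γ ∧′ θ)) → F x) → qr (quantify Q k (γ ∧′ θ)) ≤ n →
           OneSided d q (suc k) (_∈ free θ) (onto k s i) (qr θ) ψ →
           OneSided d (suc q) k F s n ψ ⊎ Piece d q (suc k) (λ x → x ∈ free θ × onto k s i x ≡ s i) (qr θ) ψ
separate {k = k} {s = s} {ψ = ψ} {i = i} Q {γ} {θ} a i<k i∈ F∋ φ≤n (b , p) with b Bool.≟ s i
... | yes refl = inj₂ p
... | no b≢    = inj₁ (b , record
  { local = raise (local p) (λ x x∈ → below-suc (x≢k x∈) (local-below (local p) x x∈))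
  ; free⊆ = λ x∈ → F∋ (free-quantify⁺ Q (γ ∧′ θ) (∈-++⁺ʳ (free γ) (proj₁ (free⊆ p x∈))) (x≢k x∈))
                 , trans (sym (onto-other k s i (x≢k x∈))) (proj₂ (free⊆ p x∈))
  ; qr≤   = ≤-trans (qr≤ p) (≤-trans (n≤1+n _) (subst (_≤ _) (qr-guarded Q a) φ≤n))
  })
  where
  x≢k : ∀ {x} → x ∈ free ψ → x ≢ k
  x≢k x∈ refl = b≢ (trans (sym (proj₂ (free⊆ p x∈))) (onto-bound k s i))

piece-formula : (t : Tree (Piece {σ} {M} d q k F n) Bool) → Local d q k (formula t)
piece-formula (leaf true)   = true′
piece-formula (leaf false)  = false′
piece-formula (ask ψ p t f) = (local p ∧′ piece-formula t) ∨′ (¬′ local p ∧′ piece-formula f)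

-- Connectives merely combine answers. Under a quantifier, what θ says about the side opposite to i
-- is asked first; the remaining tree concerns the side of i only and becomes a formula again, of
-- rank at most that of θ, to be guarded as before.
split : ∀ (s : Var → Bool) (F : Var → Set) → Local {σ} {M} d q k φ → (∀ {x} → x ∈ free φ → F x) → qr φ ≤ n →
        Tree (OneSided {σ} {M} d q k F s n) Bool
split s F true′  F∋ φ≤n = leaf true
split s F false′ F∋ φ≤n = leaf false
split {φ = γ} s F l@(atom _ _ _) F∋ φ≤n with onSide s (side s (free γ)) (free γ)
... | inj₁ pure  = query γ (side s (free γ) , piece l (λ x∈ → F∋ x∈ , pure x∈) φ≤n)
... | inj₂ mixed = leaf false
split s F (¬′ l) F∋ φ≤n = split s F l F∋ φ≤n >>= λ b → leaf (not b)
split s F (_∧′_ {φ = φ} l m) F∋ φ≤n =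
  split s F l (F∋ ∘ ∈-++⁺ˡ) (≤-trans (m≤m⊔n _ _) φ≤n) >>= λ b →
  split s F m (F∋ ∘ ∈-++⁺ʳ (free φ)) (≤-trans (m≤n⊔m (qr φ) _) φ≤n) >>= λ c → leaf (b ∧ c)
split s F (_∨′_ {φ = φ} l m) F∋ φ≤n =
  split s F l (F∋ ∘ ∈-++⁺ˡ) (≤-trans (m≤m⊔n _ _) φ≤n) >>= λ b →
  split s F m (F∋ ∘ ∈-++⁺ʳ (free φ)) (≤-trans (m≤n⊔m (qr φ) _) φ≤n) >>= λ c → leaf (b ∨ c)
split s F (raise {φ = φ} l below) F∋ φ≤n =
  reask (λ p → raise-one-sided {φ = φ} F∋ below p φ≤n) (split s (_∈ free φ) l id ≤-refl)
split {k = k} s F (guarded {θ = θ} {γ = γ} Q {i} l a below i<k i∈ k∈ r≤ cls) F∋ φ≤n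
  with onSide (onto k s i) (s i) (free γ)
-- When the sides are far apart, no element satisfies a guard that involves both. Having no witness
-- still satisfies the quantifier "0 mod m", so the answer depends on `Q`.
... | inj₂ mixed = leaf (accepts Q 0)
... | inj₁ pure  =
  pull (separate Q a i<k i∈ F∋ φ≤n) (split (onto k s i) (_∈ free θ) l id ≤-refl) >>= λ t →
  query (quantify Q k (γ ∧′ formula t)) (s i , record
    { local = guarded Q (piece-formula t) a below i<k i∈ k∈ r≤ cls
    ; free⊆ = kept t
    ; qr≤   = ≤-trans (≤-reflexive (qr-guarded Q a))
                (≤-trans (s≤s (formula-qr t qr≤)) (subst (_≤ _) (qr-guarded Q a) φ≤n))
    })
  where
  kept : ∀ (t : Tree (Piece _ _ _ (λ x → x ∈ free θ × onto k s i x ≡ s i) (qr θ)) Bool) {x} →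
         x ∈ free (quantify Q k (γ ∧′ formula t)) → F x × s x ≡ s i
  kept t x∈ with free-quantify⁻ Q (γ ∧′ formula t) x∈
  ... | x∈′ , x≢k with ∈-++⁻ (free γ) x∈′
  ...   | inj₁ x∈γ = F∋ (free-quantify⁺ Q (γ ∧′ θ) (∈-++⁺ˡ x∈γ) x≢k)
                   , trans (sym (onto-other k s i x≢k)) (pure x∈γ)
  ...   | inj₂ x∈t with formula-free t free⊆ x∈t
  ...     | x∈θ , eq = F∋ (free-quantify⁺ Q (γ ∧′ θ) (∈-++⁺ʳ (free γ) x∈θ) x≢k)
                     , trans (sym (onto-other k s i x≢k)) eq

separatedPairs : (Var → Bool) → List Var → List (Var × Var)
separatedPairs s xs = filter (λ (x , y) → ¬? (s x Bool.≟ s y)) (cartesianProduct xs xs)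

-- One distance atom for each separated pair is enough for a quantified formula: any crossing inside
-- it would bring such a pair within `r₁ (suc q) k d`.
distanceCrossing : ∀ {d q k} {φ : Formula σ M} (s : Var → Bool) (F : Var → Set) → FreeBelow k φ →
                   (∀ {x} → x ∈ free φ → F x) →
                   ∀ {xy} → xy ∈ separatedPairs s (free φ) → ∃[ γ ] Crossing {σ} {M} d (suc q) k F s γ
distanceCrossing {d = d} {q} {k} {φ} s F below F∋ {x , y} xy∈
  with ∈-filter⁻ (λ (x , y) → ¬? (s x Bool.≟ s y)) {xs = cartesianProduct (free φ) (free φ)} xy∈
... | xy∈′ , x≁y with ∈-cartesianProduct⁻ (free φ) (free φ) xy∈′
... | x∈ , y∈ = dist≤ x y (r₁ (suc q) k d) , record
  { atomic    = distance
  ; below     = λ { _ (here refl) → below x x∈ ; _ (there (here refl)) → below y y∈ }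
  ; md≤cap    = ≤-refl
  ; reach≤r₁  = ≤-refl
  ; inside    = λ { (here refl) → F∋ x∈ ; (there (here refl)) → F∋ y∈ }
  ; left∈     = here refl
  ; right∈    = there (here refl)
  ; separated = x≁y
  }

raise-crossing : (∀ {x} → x ∈ free φ → F x) → FreeBelow k φ →
                 ∃[ γ ] Crossing {σ} {M} d q (suc k) (_∈ free φ) s γ → ∃[ γ ] Crossing {σ} {M} d (suc q) k F s γ
raise-crossing {k = k} {d = d} {q = q} F∋ below (γ , c) = γ , record
  { atomic    = atomic
  ; below     = λ x x∈ → below x (inside x∈)
  ; md≤cap    = ≤-trans md≤cap (≤-trans (cap≤r₁ d q (suc k)) step)
  ; reach≤r₁  = ≤-trans reach≤r₁ step
  ; inside    = F∋ ∘ inside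
  ; left∈     = left∈
  ; right∈    = right∈
  ; separated = separated
  }
  where
  open Crossing c hiding (below)
  step : r₁ q (suc k) d ≤ r₁ (suc q) k d
  step = r₁-step q (below left (inside left∈))

-- The split is valid as soon as these atoms are all false.
crossings : ∀ (s : Var → Bool) (F : Var → Set) → Local {σ} {M} d q k φ → (∀ {x} → x ∈ free φ → F x) →
            List (∃[ γ ] Crossing {σ} {M} d q k F s γ)
crossings s F true′  F∋ = []
crossings s F false′ F∋ = []
crossings {d = d} {q = q} {φ = γ} s F (atom a below md≤) F∋ with onSide s (side s (free γ)) (free γ)
... | inj₁ pure             = []
... | inj₂ (x , x∈ , x≁) with side-∈ s x∈
...   | y , y∈ , y~ = (γ , record
  { atomic = a ; below = below ; md≤cap = md≤ ; reach≤r₁ = reach≤ d q (below x x∈) a md≤ ; inside = F∋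
  ; left∈ = x∈ ; right∈ = y∈ ; separated = λ eq → x≁ (trans eq y~) }) ∷ []
crossings s F (¬′ l) F∋ = crossings s F l F∋
crossings s F (_∧′_ {φ = φ} l m) F∋ = crossings s F l (F∋ ∘ ∈-++⁺ˡ) ++ crossings s F m (F∋ ∘ ∈-++⁺ʳ (free φ))
crossings s F (_∨′_ {φ = φ} l m) F∋ = crossings s F l (F∋ ∘ ∈-++⁺ˡ) ++ crossings s F m (F∋ ∘ ∈-++⁺ʳ (free φ))
crossings s F (raise {φ = φ} l below) F∋ =
  map (raise-crossing {φ = φ} F∋ below) (crossings s (_∈ free φ) l id)
crossings {φ = φ} s F l@(guarded _ _ _ _ _ _ _ _ _) F∋ =
  mapWith∈ (separatedPairs s (free φ)) (distanceCrossing {φ = φ} s F (local-below l) F∋)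

-- Correctness of the splitting

crossing-within : ∀ (c : Crossing {σ} {M} d q k F s γ) A v → T (⟦ γ ⟧ A v) →
                  Within A (r₁ q k d) (v (Crossing.left c)) (v (Crossing.right c))
crossing-within c A v t =
  within-mono A (Crossing.reach≤r₁ c) (reach-within (Crossing.atomic c) A v t (Crossing.left∈ c) (Crossing.right∈ c))

Refuted : (A : Structure σ) → Assignment A → List (∃[ γ ] Crossing {σ} {M} d q k F s γ) → Set
Refuted A v cs = ∀ {c} → c ∈ cs → ¬ T (⟦ proj₁ c ⟧ A v)

far-apart : ∀ (s : Var → Bool) F (below : FreeBelow k φ) (F∋ : ∀ {x} → x ∈ free φ → F x) (A : Structure σ) v →
            Refuted A v (mapWith∈ (separatedPairs s (free φ)) (distanceCrossing {d = d} {q} {φ = φ} s F below F∋)) →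
            ∀ {x y} → x ∈ free φ → y ∈ free φ → s x ≢ s y → ¬ Within A (r₁ (suc q) k d) (v x) (v y)
far-apart {φ = φ} {d = d} {q = q} s F below F∋ A v refuted {x} {y} x∈ y∈ x≁y w =
  refuted (mapWith∈-∈ (separatedPairs s (free φ)) (distanceCrossing {φ = φ} s F below F∋)
    (∈-filter⁺ (λ (x , y) → ¬? (s x Bool.≟ s y)) (∈-cartesianProduct⁺ x∈ y∈) x≁y)) (Within.reached w)

-- In the guarded case, let a crossing of θ involve k. Its end on the opposite side is within
-- `r₁ q (suc k) d` of the value of k, which is within `reach γ` of i. So two separated variables
-- would be within `r₁ (suc q) k d`, against the refuted distance atoms.
split-correct : ∀ (s : Var → Bool) (F : Var → Set) (l : Local {σ} {M} d q k φ)
                (F∋ : ∀ {x} → x ∈ free φ → F x) (φ≤n : qr φ ≤ n) A v →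
                Refuted A v (crossings s F l F∋) → run (split s F l F∋ φ≤n) (oracle A v) ≡ ⟦ φ ⟧ A v
split-correct s F true′  F∋ φ≤n A v refuted = refl
split-correct s F false′ F∋ φ≤n A v refuted = refl
split-correct {φ = γ} s F l@(atom _ _ _) F∋ φ≤n A v refuted with onSide s (side s (free γ)) (free γ)
... | inj₁ pure = if-true-false (⟦ γ ⟧ A v)
... | inj₂ (x , x∈ , x≁) with side-∈ s x∈
...   | y , y∈ , y~ = sym (¬T⇒false (refuted (here refl)))
split-correct s F (¬′ l) F∋ φ≤n A v refuted = trans
  (run->>= (split s F l F∋ φ≤n) (λ b → leaf (not b)) (oracle A v))
  (cong not (split-correct s F l F∋ φ≤n A v refuted))
split-correct s F (_∧′_ {φ = φ} l m) F∋ φ≤n A v refuted = trans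
  (run->>= (split s F l _ _) (λ b → split s F m _ _ >>= λ c → leaf (b ∧ c)) (oracle A v))
  (trans (run->>= (split s F m _ _) (λ c → leaf (run (split s F l _ _) (oracle A v) ∧ c)) (oracle A v))
    (cong₂ _∧_ (split-correct s F l _ _ A v (refuted ∘ ∈-++⁺ˡ))
               (split-correct s F m _ _ A v (refuted ∘ ∈-++⁺ʳ (crossings s F l (F∋ ∘ ∈-++⁺ˡ))))))
split-correct s F (_∨′_ {φ = φ} l m) F∋ φ≤n A v refuted = trans
  (run->>= (split s F l _ _) (λ b → split s F m _ _ >>= λ c → leaf (b ∨ c)) (oracle A v))
  (trans (run->>= (split s F m _ _) (λ c → leaf (run (split s F l _ _) (oracle A v) ∨ c)) (oracle A v))
    (cong₂ _∨_ (split-correct s F l _ _ A v (refuted ∘ ∈-++⁺ˡ))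
               (split-correct s F m _ _ A v (refuted ∘ ∈-++⁺ʳ (crossings s F l (F∋ ∘ ∈-++⁺ˡ))))))
split-correct s F (raise {φ = φ} l below) F∋ φ≤n A v refuted = trans
  (run-reask (λ p → raise-one-sided {φ = φ} F∋ below p φ≤n) (split s (_∈ free φ) l id ≤-refl) (oracle A v))
  (split-correct s (_∈ free φ) l id ≤-refl A v (refuted ∘ ∈-map⁺ (raise-crossing {φ = φ} F∋ below)))
split-correct {σ} {M} {d} {suc q} {k} {n = n} s F l₀@(guarded {θ = θ} {γ = γ} Q {i} l a below i<k i∈ k∈ r≤ cls)
  F∋ φ≤n A v refuted = cases
  where
  open ≡-Reasoning
  whole : Formula σ M
  whole = quantify Q k (γ ∧′ θ)
  far : ∀ {x y} → x ∈ free whole → y ∈ free whole → s x ≢ s y → ¬ Within A (r₁ (suc q) k d) (v x) (v y)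
  far = far-apart {φ = whole} s F (local-below l₀) F∋ A v refuted
  i≢k : i ≢ k
  i≢k = <⇒≢ i<k
  i∈φ : i ∈ free whole
  i∈φ = free-quantify⁺ Q (γ ∧′ θ) (∈-++⁺ˡ i∈) i≢k
  guard-within : ∀ {z x} → T (⟦ γ ⟧ A (v [ k ↦ z ])) → x ∈ free γ → Within A (reach γ) (v i) ((v [ k ↦ z ]) x)
  guard-within {z} {x} t x∈ = subst (λ b → Within A (reach γ) b ((v [ k ↦ z ]) x)) (update-other v i≢k)
    (reach-within a A (v [ k ↦ z ]) t i∈ x∈)
  refuted′ : ∀ {z} → T (⟦ γ ⟧ A (v [ k ↦ z ])) → Refuted A (v [ k ↦ z ]) (crossings (onto k s i) (_∈ free θ) l id)
  refuted′ {z} t {χ , c} _ u =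
    cross (Crossing.inside c (Crossing.left∈ c)) (Crossing.inside c (Crossing.right∈ c)) (Crossing.separated c)
      (crossing-within c A (v [ k ↦ z ]) u)
    where
    near-z : Within A (reach γ) (v i) z
    near-z = subst (Within A (reach γ) (v i)) (update-same v k) (guard-within t k∈)
    θ⊆ : ∀ {x} → x ∈ free θ → x ≢ k → x ∈ free whole
    θ⊆ x∈ = free-quantify⁺ Q (γ ∧′ θ) (∈-++⁺ʳ (free γ) x∈)
    bound-side : ∀ {y} → y ∈ free θ → y ≢ k → s i ≢ s y → ¬ Within A (r₁ q (suc k) d) z (v y)
    bound-side y∈ y≢k i≁y w = far i∈φ (θ⊆ y∈ y≢k) i≁y (within-mono A r≤ (within-trans A (reach γ) near-z w))
    cross : ∀ {x y} → x ∈ free θ → y ∈ free θ → onto k s i x ≢ onto k s i y →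
            ¬ Within A (r₁ q (suc k) d) ((v [ k ↦ z ]) x) ((v [ k ↦ z ]) y)
    cross {x} {y} x∈ y∈ x≁y w with x ℕ.≟ k | y ℕ.≟ k
    ... | yes refl | yes refl = x≁y refl
    ... | yes refl | no y≢k   = bound-side y∈ y≢k x≁y w
    ... | no x≢k   | yes refl = bound-side x∈ x≢k (x≁y ∘ sym) (within-sym A (r₁ q (suc k) d) w)
    ... | no x≢k   | no y≢k   = far (θ⊆ x∈ x≢k) (θ⊆ y∈ y≢k) x≁y (within-mono A (r₁-step q i<k) w)
  cases : run (split s F l₀ F∋ φ≤n) (oracle A v) ≡ ⟦ whole ⟧ A v
  cases with onSide (onto k s i) (s i) (free γ)
  ... | inj₂ (x , x∈ , x≁) = begin
    accepts Q 0                                ≡⟨ cong (accepts Q) (count-none (Structure.elements A)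
                                                    (λ z t → empty z (proj₁ (∧⁻ t)))) ⟨
    accepts Q (witnesses (γ ∧′ θ) A v k)       ≡⟨ ⟦quantify⟧ Q k (γ ∧′ θ) A v ⟨
    ⟦ whole ⟧ A v                                  ∎
    where
    x≢k : x ≢ k
    x≢k refl = x≁ (onto-bound k s i)
    empty : ∀ z → ¬ T (⟦ γ ⟧ A (v [ k ↦ z ]))
    empty z t = far i∈φ (free-quantify⁺ Q (γ ∧′ θ) (∈-++⁺ˡ x∈) x≢k)
      (λ eq → x≁ (trans (onto-other k s i x≢k) (sym eq)))
      (within-mono A (≤-trans (m≤m+n _ _) r≤)
        (subst (Within A (reach γ) (v i)) (update-other v x≢k) (guard-within t x∈)))
  ... | inj₁ pure = trans (run->>=-query χ _ pulled (oracle A v)) (begin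
    ⟦ χ t ⟧ A v                                         ≡⟨ ⟦quantify⟧ Q k (γ ∧′ formula t) A v ⟩
    accepts Q (witnesses (γ ∧′ formula t) A v k)        ≡⟨ cong (accepts Q) (count-cong (Structure.elements A)
                                                             (λ z → ∧-congʳ (same z))) ⟩
    accepts Q (witnesses (γ ∧′ θ) A v k)                ≡⟨ ⟦quantify⟧ Q k (γ ∧′ θ) A v ⟨
    ⟦ whole ⟧ A v                                       ∎)
    where
    OwnTree : Set
    OwnTree = Tree (Piece d q (suc k) (λ x → x ∈ free θ × onto k s i x ≡ s i) (qr θ)) Bool
    inner : Tree (OneSided d q (suc k) (_∈ free θ) (onto k s i) (qr θ)) Bool
    inner = split (onto k s i) (_∈ free θ) l id ≤-refl
    pulled : Tree (OneSided d (suc q) k F s n) OwnTree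
    pulled = pull (separate Q a i<k i∈ F∋ φ≤n) inner
    χ : OwnTree → Formula σ M
    χ t = quantify Q k (γ ∧′ formula t)
    t : OwnTree
    t = run pulled (oracle A v)
    unaffected : ∀ {z ψ} → OneSided d (suc q) k F s n ψ → ⟦ ψ ⟧ A v ≡ ⟦ ψ ⟧ A (v [ k ↦ z ])
    unaffected {ψ = ψ} (_ , p) =
      coincidence ψ A (λ {x} x∈ → sym (update-other v (<⇒≢ (local-below (local p) x x∈))))
    same : ∀ z → T (⟦ γ ⟧ A (v [ k ↦ z ])) → ⟦ formula t ⟧ A (v [ k ↦ z ]) ≡ ⟦ θ ⟧ A (v [ k ↦ z ])
    same z u = begin
      ⟦ formula t ⟧ A (v [ k ↦ z ])              ≡⟨ ⟦formula⟧ t A (v [ k ↦ z ]) ⟩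
      run t (oracle A (v [ k ↦ z ]))             ≡⟨ run-pull (separate Q a i<k i∈ F∋ φ≤n) inner
                                                     unaffected ⟩
      run inner (oracle A (v [ k ↦ z ]))         ≡⟨ split-correct (onto k s i) (_∈ free θ) l id ≤-refl
                                                        A (v [ k ↦ z ]) (refuted′ u) ⟩
      ⟦ θ ⟧ A (v [ k ↦ z ])                      ∎

-- Scattered witnesses

⋀⁺ : ∀ (A : Structure σ) {v} {φs : List (Formula σ M)} → All (λ φ → T (⟦ φ ⟧ A v)) φs → T (⟦ ⋀ φs ⟧ A v)
⋀⁺ A []       = tt
⋀⁺ A (t ∷ ts) = ∧⁺ t (⋀⁺ A ts)

⋀⁻ : ∀ (A : Structure σ) {v} (φs : List (Formula σ M)) → T (⟦ ⋀ φs ⟧ A v) → All (λ φ → T (⟦ φ ⟧ A v)) φs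
⋀⁻ A []       t = []
⋀⁻ A (φ ∷ φs) t = proj₁ (∧⁻ t) ∷ ⋀⁻ A φs (proj₂ (∧⁻ t))

Apart : (A : Structure σ) → ℕ → (a b : Structure.Carrier A) → Set
Apart A r a b = ¬ Within A r a b

pairwise⁺ : ∀ {σ M r} (A : Structure σ) {v ys} → AllPairs (Apart A r) (map v ys) →
            All (λ (φ : Formula σ M) → T (⟦ φ ⟧ A v)) (pairwiseDist> r ys)
pairwise⁺ A {ys = []}     []       = []
pairwise⁺ A {ys = y ∷ ys} (p ∷ ps) = All.++⁺
  (All.map⁺ (All.map (λ apart → T-not⁺ (apart ∘ path)) (All.map⁻ p))) (pairwise⁺ A ps)

pairwise⁻ : ∀ {σ M r} (A : Structure σ) {v} ys → All (λ (φ : Formula σ M) → T (⟦ φ ⟧ A v)) (pairwiseDist> r ys) →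
            AllPairs (Apart A r) (map v ys)
pairwise⁻                 A []       _  = []
pairwise⁻ {M = M} {r = r} A (y ∷ ys) ts =
  All.map⁺ (All.map (λ t → T-not⁻ t ∘ Within.reached) (All.map⁻ (All.++⁻ˡ (map (λ z → dist> {M = M} y z r) ys) ts)))
  ∷ pairwise⁻ A ys (All.++⁻ʳ (map (λ z → dist> y z r) ys) ts)

free-⋀⁻ : ∀ (φs : List (Formula σ M)) {x} → x ∈ free (⋀ φs) → ∃[ φ ] φ ∈ φs × x ∈ free φ
free-⋀⁻ (φ ∷ φs) x∈ with ∈-++⁻ (free φ) x∈
... | inj₁ x∈φ = φ , here refl , x∈φ
... | inj₂ x∈′ with free-⋀⁻ φs x∈′
...   | ψ , ψ∈ , x∈ψ = ψ , there ψ∈ , x∈ψ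

pairwise-∈ : ∀ {r} ys {φ : Formula σ M} → φ ∈ pairwiseDist> r ys → ∃[ y ] ∃[ z ] y ∈ ys × z ∈ ys × φ ≡ dist> y z r
pairwise-∈ {r = r} (y ∷ ys) φ∈ with ∈-++⁻ (map (λ z → dist> y z r) ys) φ∈
... | inj₁ φ∈₁ with ∈-map⁻ (λ z → dist> y z r) φ∈₁
...   | z , z∈ , φ≡ = y , z , here refl , there z∈ , φ≡
pairwise-∈ (y ∷ ys) φ∈ | inj₂ φ∈₂ with pairwise-∈ ys φ∈₂
...   | u , z , u∈ , z∈ , φ≡ = u , z , there u∈ , there z∈ , φ≡

pairwise-free : ∀ r ys {x} → x ∈ free (⋀ {σ} {M} (pairwiseDist> r ys)) → x ∈ ys
pairwise-free {σ} {M} r ys x∈ with free-⋀⁻ {σ} {M} (pairwiseDist> r ys) x∈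
... | φ , φ∈ , x∈φ with pairwise-∈ ys φ∈
...   | y , z , y∈ , z∈ , refl with x∈φ
...     | here refl         = y∈
...     | there (here refl) = z∈

⋀-local : ∀ {φs : List (Formula σ M)} → All (Local d q k) φs → Local d q k (⋀ φs)
⋀-local []       = true′
⋀-local (l ∷ ls) = l ∧′ ⋀-local ls

⋀-qr : ∀ {φs : List (Formula σ M)} → All (λ φ → qr φ ≤ n) φs → qr (⋀ φs) ≤ n
⋀-qr []       = z≤n
⋀-qr (p ∷ ps) = ⊔-lub p (⋀-qr ps)

pairwise-piece : ∀ {r ys} → (∀ {y} → y ∈ ys → y < k × F y) → r ≤ cap d q k →
                 Piece {σ} {M} d q k F n (⋀ (pairwiseDist> r ys))
pairwise-piece {r = r} {ys} good r≤ = record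
  { local = ⋀-local (All.tabulate λ φ∈ → local-one (pairwise-∈ ys φ∈))
  ; free⊆ = λ x∈ → proj₂ (good (pairwise-free r ys x∈))
  ; qr≤   = ⋀-qr (All.tabulate λ φ∈ → qr-one (pairwise-∈ ys φ∈))
  }
  where
  local-one : ∀ {φ} → ∃[ y ] ∃[ z ] y ∈ ys × z ∈ ys × φ ≡ dist> y z r → Local _ _ _ φ
  local-one (y , z , y∈ , z∈ , refl) = ¬′ atom distance
    (λ { _ (here refl) → proj₁ (good y∈) ; _ (there (here refl)) → proj₁ (good z∈) }) r≤
  qr-one : ∀ {φ} → ∃[ y ] ∃[ z ] y ∈ ys × z ∈ ys × φ ≡ dist> y z r → qr φ ≤ _
  qr-one (y , z , y∈ , z∈ , refl) = z≤n

-- No member of a list of numbers exceeds their sum, so these variables lie beyond all bound ones.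
fresh : Formula σ M → ℕ → List Var
fresh β = applyUpTo (λ j → suc (sum (bound β)) + j)

∈⇒≤sum : ∀ {x xs} → x ∈ xs → x ≤ sum xs
∈⇒≤sum {xs = x ∷ xs} (here refl) = m≤m+n x (sum xs)
∈⇒≤sum {xs = y ∷ xs} (there x∈)  = ≤-trans (∈⇒≤sum x∈) (m≤n+m (sum xs) y)

fresh-∉ : ∀ (β : Formula σ M) ℓ {y} → y ∈ fresh β ℓ → y ∉ bound β
fresh-∉ β ℓ y∈ y∈β with ∈-applyUpTo⁻ (λ j → suc (sum (bound β)) + j) y∈
... | j , _ , refl = <-irrefl refl (≤-trans (m≤m+n _ j) (∈⇒≤sum y∈β))

fresh-unique : ∀ (β : Formula σ M) ℓ → Unique (fresh β ℓ)
fresh-unique β ℓ = AllPairs.applyUpTo⁺₁ (λ j → suc (sum (bound β)) + j) ℓ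
  (λ i<j _ eq → <⇒≢ i<j (+-cancelˡ-≡ (suc (sum (bound β))) _ _ eq))

scatter : ℕ → ℕ → Formula σ M → Formula σ M
scatter ℓ r β = ∃* ys (⋀ (pairwiseDist> (2 * r) ys) ∧′ ⋀ (map (λ y → β [ 0 ≔ y ]) ys))
  where ys = fresh β ℓ

free-∃* : ∀ ys (φ : Formula σ M) {x} → x ∈ free (∃* ys φ) → x ∈ free φ × x ∉ ys
free-∃* []       φ x∈ = x∈ , λ ()
free-∃* (y ∷ ys) φ x∈ with free-quantify⁻ some (∃* ys φ) x∈
... | x∈′ , x≢y with free-∃* ys φ x∈′
...   | x∈φ , x∉ys = x∈φ , λ { (here x≡y) → x≢y x≡y ; (there x∈ys) → x∉ys x∈ys }

scattered-closed : ∀ ℓ r (β : Formula σ M) → FreeBelow 1 β → ∀ {x} → x ∉ free (scatter ℓ r β)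
scattered-closed {σ} {M} ℓ r β only x∈
  with free-∃* (fresh β ℓ) (⋀ (pairwiseDist> (2 * r) (fresh β ℓ)) ∧′ ⋀ (map (λ y → β [ 0 ≔ y ]) (fresh β ℓ))) x∈
... | x∈′ , x∉ with ∈-++⁻ (free (⋀ {σ} {M} (pairwiseDist> (2 * r) (fresh β ℓ)))) x∈′
...   | inj₁ x∈₁ = x∉ (pairwise-free {σ} {M} (2 * r) (fresh β ℓ) x∈₁)
...   | inj₂ x∈₂ with free-⋀⁻ (map (λ y → β [ 0 ≔ y ]) (fresh β ℓ)) x∈₂
...     | φ , φ∈ , x∈φ with ∈-map⁻ (λ y → β [ 0 ≔ y ]) φ∈
...       | y , y∈ , refl with free-subst (view β) x∈φ
...         | inj₁ refl        = x∉ y∈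
...         | inj₂ (x∈β , x≢0) = x≢0 (n≤0⇒n≡0 (≤-pred (only _ x∈β)))

∃*-elim : ∀ ys (φ : Formula σ M) A {v} → T (⟦ ∃* ys φ ⟧ A v) → ∃[ u ] T (⟦ φ ⟧ A u)
∃*-elim []       φ A {v} t = v , t
∃*-elim (y ∷ ys) φ A {v} t with ∃′-elim (∃* ys φ) A v t
... | a , t′ = ∃*-elim ys φ A t′

∃*-intro : ∀ ys (φ : Formula σ M) A u → T (⟦ φ ⟧ A u) → T (⟦ ∃* ys φ ⟧ A u)
∃*-intro []       φ A u t = t
∃*-intro (y ∷ ys) φ A u t = ∃′-intro (∃* ys φ) A u (u y)
  (subst T (coincidence (∃* ys φ) A (λ {x} _ → unchanged x)) (∃*-intro ys φ A u t))
  where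
  unchanged : ∀ x → u x ≡ (u [ y ↦ u y ]) x
  unchanged x with x ℕ.≟ y
  ... | yes refl = refl
  ... | no _     = refl

realise : ∀ {B : Set} → B → ∀ {ys} (bs : List B) → Unique ys → length bs ≡ length ys →
          Σ[ u ∈ (Var → B) ] map u ys ≡ bs
realise b₀ {[]}     []       []         eq = (λ _ → b₀) , refl
realise b₀ {y ∷ ys} (b ∷ bs) (y∉ ∷ uniq) eq with realise b₀ bs uniq (cong pred eq)
... | u , refl = u [ y ↦ b ] , cong₂ _∷_ (update-same u y) (map-update ys y∉)
  where
  map-update : ∀ zs → All (y ≢_) zs → map (u [ y ↦ b ]) zs ≡ map u zs
  map-update []       []         = refl
  map-update (z ∷ zs) (y≢z ∷ y∉) = cong₂ _∷_ (update-other u (y≢z ∘ sym)) (map-update zs y∉)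

Scattered : (A : Structure σ) → Assignment A → ℕ → ℕ → Formula σ M → Set
Scattered A v ℓ r β =
  ∃[ bs ] length bs ≡ ℓ × AllPairs (Apart A (2 * r)) bs × All (λ b → T (⟦ β ⟧ A (v [ 0 ↦ b ]))) bs

-- Since β has no free variable but x₁, only the value of y matters.
body-at : ∀ (β : Formula σ M) → FreeBelow 1 β → ∀ A u v {y} → y ∉ bound β →
          ⟦ β [ 0 ≔ y ] ⟧ A u ≡ ⟦ β ⟧ A (v [ 0 ↦ u y ])
body-at β only A u v {y} y∉ = trans (substitution β y∉ A u) (coincidence β A λ x∈ → same (only _ x∈))
  where
  same : ∀ {x} → x < 1 → (u [ 0 ↦ u y ]) x ≡ (v [ 0 ↦ u y ]) x
  same (s≤s z≤n) = refl

scattered⁻ : ∀ ℓ r (β : Formula σ M) → FreeBelow 1 β → ∀ A v → T (⟦ scatter ℓ r β ⟧ A v) → Scattered A v ℓ r β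
scattered⁻ ℓ r β only A v t with ∃*-elim (fresh β ℓ) _ A t
... | u , t′ with ∧⁻ t′
...   | apart , bodies = map u (fresh β ℓ)
                       , trans (length-map u (fresh β ℓ)) (length-applyUpTo (λ j → suc (sum (bound β)) + j) ℓ)
                       , pairwise⁻ A (fresh β ℓ) (⋀⁻ A (pairwiseDist> (2 * r) (fresh β ℓ)) apart)
                       , All.map⁺ (All.tabulate λ {y} y∈ → subst T (body-at β only A u v (fresh-∉ β ℓ y∈))
                           (All.lookup (All.map⁻ (⋀⁻ A (map (λ y → β [ 0 ≔ y ]) (fresh β ℓ)) bodies)) y∈))

scattered⁺ : ∀ ℓ r (β : Formula σ M) → FreeBelow 1 β → ∀ A v → Scattered A v ℓ r β → T (⟦ scatter ℓ r β ⟧ A v)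
scattered⁺ ℓ r β only A v (bs , len , apart , bodies)
  with realise (v 0) bs (fresh-unique β ℓ)
    (trans len (sym (length-applyUpTo (λ j → suc (sum (bound β)) + j) ℓ)))
... | u , refl = subst T
  (coincidence (scatter ℓ r β) A {u} {v} (λ x∈ → ⊥-elim (scattered-closed ℓ r β only x∈)))
  (∃*-intro (fresh β ℓ) _ A u (∧⁺ (⋀⁺ A (pairwise⁺ A apart))
    (⋀⁺ A (All.map⁺ (All.tabulate λ {y} y∈ →
      subst T (sym (body-at β only A u v (fresh-∉ β ℓ y∈))) (All.lookup (All.map⁻ bodies) y∈))))))

-- The questions a normal form may ask

-- `rank` and `vars` tell where the body arose and are kept when its sentence moves to a larger
-- class. Raising the local formula along with it could push its radius beyond the `r` fixed in the
-- sentence.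
record Body {σ M} (d q k n : ℕ) (β : Formula σ M) : Set where
  field
    {rank vars} : ℕ
    isLoc   : Local d rank vars β
    radius≤ : r₁ rank vars d ≤ r₁ q (suc k) d
    class   : FO+MOD⁺ q (suc k) d β
    only    : FreeBelow 1 β
    qr<     : qr β < n

  radius : ℕ
  radius = r₁ rank vars d

data Sentence {σ M} (d q k n : ℕ) : Formula σ M → Set where
  scattered : ∀ ℓ r {β} (b : Body d q k n β) → 1 ≤ ℓ → ℓ ≤ k + suc q → Body.radius b ≤ r →
              2 * r ≤ r₁ (suc q) k d + 2 * r₁ q (suc k) d → Sentence d q k n (scatter ℓ r β)
  counted   : ∀ {m} (m∈ : m ∈ M) (i : Fin m) {β} → Body d q k n β → Sentence d q k n (∃mod m∈ i 0 β)

sentence-closed : Sentence {σ} {M} d q k n ψ → ∀ {x} → x ∉ free ψ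
sentence-closed (scattered ℓ r {β} b _ _ _ _) = scattered-closed ℓ r β (Body.only b)
sentence-closed (counted m∈ i {β} b) x∈ with free-quantify⁻ (mod m∈ i) β x∈
... | x∈β , x≢0 = x≢0 (n≤0⇒n≡0 (≤-pred (Body.only b _ x∈β)))

data Question {σ M} (d n : ℕ) (F : Var → Set) : (q k : ℕ) → Formula σ M → Set where
  asLocal    : Piece d q k F n ψ → Question d n F q k ψ
  asSentence : Sentence d q k n ψ → Question d n F (suc q) k ψ

raise-body : Body {σ} {M} d q (suc k) n β → Body d (suc q) k n β
raise-body {d = d} {q = q} {k = k} {β = β} b = record
  { isLoc   = Body.isLoc b
  ; radius≤ = ≤-trans (Body.radius≤ b) (r₁-step q {i = 0} (s≤s z≤n))
  ; class   = below , base (lower (Body.class b) below)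
  ; only    = Body.only b
  ; qr<     = Body.qr< b
  }
  where
  below : FreeBelow (suc k) β
  below x x∈ = ≤-trans (Body.only b x x∈) (s≤s z≤n)

-- For k = 0 the first summand on the right vanishes, and the second has to pay for the whole left
-- side: `2 * r₁ q (2 + k) d` is at most `R`, and two copies of `R` are available.
raise-distance : ∀ q k d → r₁ (suc q) (suc k) d + 2 * r₁ q (2 + k) d ≤ r₁ (2 + q) k d + 2 * r₁ (suc q) (suc k) d
raise-distance q k d = ≤-trans
  (+-monoʳ-≤ R (≤-trans (*-monoˡ-≤ (r₁ q (2 + k) d) 2≤) (≤-reflexive (sym (+-identityʳ R)))))
  (m≤n+m (2 * R) (r₁ (2 + q) k d))
  where
  R : ℕ
  R = r₁ (suc q) (suc k) d
  2≤ : 2 ≤ 4 * suc k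
  2≤ = ≤-trans (s≤s (s≤s z≤n)) (*-monoʳ-≤ 4 (s≤s {n = k} z≤n))

raise-sentence : Sentence {σ} {M} d q (suc k) n ψ → Sentence d (suc q) k n ψ
raise-sentence {d = d} {q = q} {k = k} (scattered ℓ r b 1≤ℓ ℓ≤ radius≤r r≤) = scattered ℓ r (raise-body b) 1≤ℓ
  (≤-trans ℓ≤ (≤-reflexive (sym (+-suc k (suc q))))) radius≤r (≤-trans r≤ (raise-distance q k d))
raise-sentence (counted m∈ i b) = counted m∈ i (raise-body b)

-- Existential quantification over a local formula

-- Lists with repetitions do no harm in the search for scattered indices: a repeated index is not
-- apart from itself.
words : ℕ → List X → List (List X)
words zero    xs = [] ∷ []
words (suc c) xs = cartesianProductWith _∷_ xs (words c xs)

words⁺ : ∀ {xs J : List X} {c} → length J ≡ c → All (_∈ xs) J → J ∈ words c xs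
words⁺ {c = zero}  refl []         = here refl
words⁺ {c = suc c} refl (x∈ ∷ all) = ∈-cartesianProductWith⁺ _∷_ x∈ (words⁺ refl all)

words⁻ : ∀ {xs : List X} c {J} → J ∈ words c xs → length J ≡ c × All (_∈ xs) J
words⁻           zero    (here refl) = refl , []
words⁻ {xs = xs} (suc c) J∈ with ∈-cartesianProductWith⁻ _∷_ xs (words c xs) J∈
... | x , J , x∈ , J∈′ , refl with words⁻ c J∈′
...   | len , all = cong suc len , x∈ ∷ all

AllPairs-lookup : ∀ {R : X → X → Set} {xs} → AllPairs R xs → ∀ {i j : Fin (length xs)} → i Fin.< j →
                  R (lookup xs i) (lookup xs j)
AllPairs-lookup (p ∷ ps) {zero}  {suc j} _         = All.lookup p (∈-lookup j)
AllPairs-lookup (p ∷ ps) {suc i} {suc j} (s≤s i<j) = AllPairs-lookup ps i<j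

module _ {σ : Signature} {M : List ℕ} {d q k n : ℕ} {β : Formula σ M} (lβ : Local d q (suc k) β) where

  bound-body : 0 ∉ bound β
  bound-body 0∈ with () ← local-bound lβ 0∈

  -- The body of a scattered sentence must speak about x₁. Both variables are below `suc k`, so
  -- renaming preserves the local fragment together with its radius.
  body : (∀ {x} → x ∈ free β → x ≡ k) → qr β < n → Body d q k n (β [ k ≔ 0 ])
  body only-k qr<n = record
    { isLoc   = renamed
    ; radius≤ = ≤-refl
    ; class   = local-class renamed
    ; only    = λ x x∈ → [ (λ { refl → s≤s z≤n }) , (λ (x∈β , x≢k) → contradiction (only-k x∈β) x≢k) ]′
                           (free-subst (view β) x∈)
    ; qr<     = subst (_< n) (sym (qr-subst (view β))) qr<n
    }
    where
    renamed : Local d q (suc k) (β [ k ≔ 0 ])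
    renamed = local-subst lβ ≤-refl (s≤s z≤n)

  body-value : (∀ {x} → x ∈ free β → x ≡ k) → ∀ A v b → ⟦ β [ k ≔ 0 ] ⟧ A (v [ 0 ↦ b ]) ≡ ⟦ β ⟧ A (v [ k ↦ b ])
  body-value only-k A v b = trans (substitution β bound-body A (v [ 0 ↦ b ]))
    (coincidence β A λ x∈ → same (only-k x∈))
    where
    same : ∀ {x} → x ≡ k → ((v [ 0 ↦ b ]) [ k ↦ b ]) x ≡ (v [ k ↦ b ]) x
    same refl = trans (update-same (v [ 0 ↦ b ]) k) (sym (update-same v k))

Index : ℕ → (Var → Set) → Set
Index k F = Σ[ i ∈ Var ] (i < k × F i)

nearby : Var → Var → ℕ → Formula σ M → Formula σ M
nearby i k e χ = ∃′ k (dist≤ i k e ∧′ χ)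

nearby-piece : ∀ {i e} {χ : Formula σ M} → i < k → F i → Local d q (suc k) χ →
               e + r₁ q (suc k) d ≤ r₁ (suc q) k d →
               (∀ {x} → x ∈ free χ → x ≢ k → F x) → qr χ < n → Piece d (suc q) k F n (nearby i k e χ)
nearby-piece {k = k} {F = F} {i = i} {e} {χ} i<k Fi l e≤ F∋ qr<n = record
  { local = guarded some l distance (λ { _ (here refl) → ≤-trans i<k (n≤1+n k) ; _ (there (here refl)) → ≤-refl })
      i<k (here refl) (there (here refl)) e≤ (inj₂ (refl , refl))
  ; free⊆ = kept
  ; qr≤   = qr<n
  }
  where
  kept : ∀ {x} → x ∈ free (nearby i k e χ) → F x
  kept x∈ with free-quantify⁻ some (dist≤ i k e ∧′ χ) x∈
  ... | here refl , _             = Fi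
  ... | there (here refl) , x≢k   = contradiction refl x≢k
  ... | there (there x∈χ) , x≢k   = F∋ x∈χ x≢k

nearby⁺ : ∀ {i e} (χ : Formula σ M) A v {z} → i ≢ k → Within A e (v i) z → T (⟦ χ ⟧ A (v [ k ↦ z ])) →
          T (⟦ nearby i k e χ ⟧ A v)
nearby⁺ {k = k} {i} {e} χ A v {z} i≢k w t = ∃′-intro (dist≤ i k e ∧′ χ) A v z
  (∧⁺ (Within.reached (subst₂ (Within A e) (sym (update-other v i≢k)) (sym (update-same v k)) w)) t)

nearby⁻ : ∀ {i e} (χ : Formula σ M) A v → i ≢ k → T (⟦ nearby i k e χ ⟧ A v) →
          ∃[ z ] Within A e (v i) z × T (⟦ χ ⟧ A (v [ k ↦ z ]))
nearby⁻ {k = k} {i} {e} χ A v i≢k t with ∃′-elim (dist≤ i k e ∧′ χ) A v t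
... | z , t′ with ∧⁻ t′
...   | w , u = z , subst₂ (Within A e) (update-other v i≢k) (update-same v k) (path w) , u

-- α is the quantified formula, and β describes its variable when this is far from the others.
-- Every x that has a β-witness within distance R is tested for the largest number of these x
-- with pairwise distances > t s; by pigeonhole some s < k gives the same number c as s + 1.
-- Then c is also the largest number of scattered β-witnesses close to the x, so a distant
-- witness exists iff c + 1 scattered ones do.
module Existence {σ : Signature} {M : List ℕ} {d q k n : ℕ} {F : Var → Set} {α β : Formula σ M}
  (lα : Local d q (suc k) α) (α⊆ : ∀ {x} → x ∈ free α → x ≢ k → F x) (α< : qr α < n)
  (lβ : Local d q (suc k) β) (β⊆ : ∀ {x} → x ∈ free β → x ≡ k) (β< : qr β < n)
  where

  -- `D` is the widest guard that `near` admits for formulas of the class below.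
  R R⁺ D : ℕ
  R  = r₁ q (suc k) d
  R⁺ = r₁ (suc q) k d
  D  = R⁺ ∸ R

  -- `2 * ρ s` is the midpoint between `t s` and `t (suc s)`. The two halves, of length `2 * R`
  -- each, absorb the errors made when variables are replaced by nearby β-witnesses and when
  -- witnesses are replaced by nearby variables.
  t ρ : ℕ → ℕ
  t s = 4 * s * R
  ρ s = 2 * s * R + R

  2ρ+2R : ∀ s → 2 * ρ s + R + R ≡ t (suc s)
  2ρ+2R s = identity s R
    where
    identity : ∀ s R → 2 * (2 * s * R + R) + R + R ≡ 4 * suc s * R
    identity = solve-∀

  t+2R : ∀ s → R + (2 * ρ s + R) ≡ t (suc s)
  t+2R s = identity s R
    where
    identity : ∀ s R → R + (2 * (2 * s * R + R) + R) ≡ 4 * suc s * R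
    identity = solve-∀

  2ρ : ∀ s → R + (t s + R) ≡ 2 * ρ s
  2ρ s = identity s R
    where
    identity : ∀ s R → R + (4 * s * R + R) ≡ 2 * (2 * s * R + R)
    identity = solve-∀

  t≤R⁺ : ∀ {s} → s ≤ k → t s ≤ R⁺
  t≤R⁺ s≤k = *-monoˡ-≤ R (*-monoʳ-≤ 4 s≤k)

  2ρ+R≤D : ∀ {s} → s < k → 2 * ρ s + R ≤ D
  2ρ+R≤D {s} s<k = m+n≤o⇒m≤o∸n (2 * ρ s + R) (≤-trans (≤-reflexive (2ρ+2R s)) (t≤R⁺ s<k))

  D+R≤R⁺ : ∀ {i} → i < k → D + R ≤ R⁺
  D+R≤R⁺ i<k = ≤-reflexive (m∸n+n≡m (r₁-step q i<k))

  R≤D : ∀ {i} → i < k → R ≤ D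
  R≤D i<k = ≤-trans (m≤n+m R (2 * ρ 0)) (2ρ+R≤D (≤-trans (s≤s z≤n) i<k))

  2R≤R⁺ : ∀ {i} → i < k → R + R ≤ R⁺
  2R≤R⁺ i<k = ≤-trans (+-monoˡ-≤ R (R≤D i<k)) (D+R≤R⁺ i<k)

  2ρ≤ : ∀ {s} → s < k → 2 * ρ s ≤ R⁺ + 2 * R
  2ρ≤ {s} s<k = ≤-trans (m≤m+n (2 * ρ s) R) (≤-trans (2ρ+R≤D s<k)
    (≤-trans (m≤m+n D R) (≤-trans (D+R≤R⁺ s<k) (m≤m+n R⁺ (2 * R)))))

  indices : List (Index k F)
  indices = mapWith∈ (filter (λ x → ¬? (x ℕ.≟ k)) (free α)) λ {x} x∈ → index (∈-filter⁻ (λ x → ¬? (x ℕ.≟ k)) x∈)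
    where
    index : ∀ {x} → x ∈ free α × x ≢ k → Index k F
    index {x} (x∈ , x≢k) = x , below-suc x≢k (local-below lα x x∈) , α⊆ x∈ x≢k

  indices-complete : ∀ {x} → x ∈ free α → x ≢ k → ∃[ i ] i ∈ indices × proj₁ i ≡ x
  indices-complete x∈ x≢k =
    _ , mapWith∈-∈ (filter (λ x → ¬? (x ℕ.≟ k)) (free α)) _ (∈-filter⁺ (λ x → ¬? (x ℕ.≟ k)) x∈ x≢k) , refl

  Program : Set → Set
  Program = Tree (Question {σ} {M} d n F (suc q) k)

  askNearα askNearβ : Index k F → Program Bool
  askNearα (i , i<k , Fi) = query (nearby i k D α) (asLocal (nearby-piece i<k Fi lα (D+R≤R⁺ i<k) α⊆ α<))
  askNearβ (i , i<k , Fi) = query (nearby i k R β)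
    (asLocal (nearby-piece i<k Fi lβ (2R≤R⁺ i<k) (λ x∈ x≢k → contradiction (β⊆ x∈) x≢k) β<))

  spread : ℕ → List (Index k F) → Formula σ M
  spread s J = ⋀ (pairwiseDist> (t s) (map proj₁ J))

  askSpread : ∀ s → s ≤ k → ℕ → List (Index k F) → Program Bool
  askSpread s s≤k c I = anyT (λ J → query (spread s J) (asLocal (pairwise-piece (good J) (t≤R⁺ s≤k)))) (words c I)
    where
    good : ∀ (J : List (Index k F)) {y} → y ∈ map proj₁ J → y < k × F y
    good J y∈ with ∈-map⁻ proj₁ y∈
    ... | (y , y<k , Fy) , _ , refl = y<k , Fy

  askScattered : ∀ ℓ s → 1 ≤ ℓ → ℓ ≤ suc k → 2 * ρ s ≤ R⁺ + 2 * R → Program Bool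
  askScattered ℓ s 1≤ℓ ℓ≤ 2ρ≤ = query (scatter ℓ (ρ s) (β [ k ≔ 0 ])) (asSentence
    (scattered ℓ (ρ s) (body lβ β⊆ β<) 1≤ℓ
      (≤-trans ℓ≤ (≤-trans (s≤s (m≤m+n k q)) (≤-reflexive (sym (+-suc k q))))) (m≤n+m R (2 * s * R)) 2ρ≤))

  s<k : ∀ {s c} → suc s + c ≡ suc k → 1 ≤ c → s < k
  s<k {s} {c} eq 1≤c = ≤-trans (≤-trans (≤-reflexive (+-comm 1 s)) (+-monoʳ-≤ s 1≤c)) (≤-reflexive (cong pred eq))

  1+c≤1+k : ∀ {s c} → suc s + c ≡ suc k → suc c ≤ suc k
  1+c≤1+k {s} {c} eq = s≤s (≤-trans (m≤n+m c s) (≤-reflexive (cong pred eq)))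

  -- Invariant: c of the x have pairwise distances > `t s`, and s + c = k + 1. If no c + 1 of them
  -- have pairwise distances greater than the next lower threshold, the number is stable between the
  -- two thresholds and the sentence is asked; otherwise s decreases and c increases by one.
  walk : ∀ s c → s + c ≡ suc k → 1 ≤ c → List (Index k F) → Program Bool
  -- A dummy answer: here c is k + 1, and k variables cannot provide so many different elements.
  walk zero    c eq 1≤c I = leaf false
  walk (suc s) c eq 1≤c I = askSpread s (<⇒≤ (s<k eq 1≤c)) (suc c) I >>= λ b →
    if b then walk s (suc c) (trans (+-suc s c) eq) (s≤s z≤n) I
         else askScattered (suc c) s (s≤s z≤n) (1+c≤1+k eq) (2ρ≤ (s<k eq 1≤c))

  dispatch : List (Index k F) → Program Bool
  -- No x is near a β-witness, so every β-witness is an α-witness and one is enough. The sentence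
  -- still needs an `r` that is at least the inner radius `R`; for k = 0 only the summand `2 * R` of
  -- the inner distance makes room for it.
  dispatch []        = askScattered 1 0 ≤-refl (s≤s z≤n) (m≤n+m (2 * R) R⁺)
  dispatch I@(_ ∷ _) = walk k 1 (+-comm k 1) ≤-refl I

  program : Program Bool
  program = anyT askNearα indices >>= λ b →
    -- Once no α-witness is within `D` of the x, every remaining one is distant and is described by
    -- β.
    if b then leaf true else (filterT askNearβ indices >>= dispatch)

  module _ (A : Structure σ) (v : Assignment A)
    (far-agree : ∀ z → (∀ {x} → x ∈ free α → x ≢ k → ¬ Within A R (v x) z) →
                 ⟦ α ⟧ A (v [ k ↦ z ]) ≡ ⟦ β ⟧ A (v [ k ↦ z ]))
    where
    open Structure A using (Carrier)

    at : Index k F → Carrier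
    at (i , _) = v i

    α-at β-at : Carrier → Set
    α-at z = T (⟦ α ⟧ A (v [ k ↦ z ]))
    β-at z = T (⟦ β ⟧ A (v [ k ↦ z ]))

    Spread : ℕ → ℕ → List (Index k F) → Set
    Spread s c I = ∃[ J ] length J ≡ c × All (_∈ I) J × AllPairs (λ i j → Apart A (t s) (at i) (at j)) J

    run-askNearα : ∀ i → run (askNearα i) (oracle A v) ≡ ⟦ nearby (proj₁ i) k D α ⟧ A v
    run-askNearα (i , i<k , Fi) = if-true-false (⟦ nearby i k D α ⟧ A v)

    run-askNearβ : ∀ i → run (askNearβ i) (oracle A v) ≡ ⟦ nearby (proj₁ i) k R β ⟧ A v
    run-askNearβ (i , i<k , Fi) = if-true-false (⟦ nearby i k R β ⟧ A v)

    askSpread⁺ : ∀ {s c I} s≤k → Spread s c I → T (run (askSpread s s≤k c I) (oracle A v))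
    askSpread⁺ {s} {c} {I} s≤k (J , len , J⊆I , apart) = subst T (sym (run-anyT _ (words c I) (oracle A v)))
      (any-intro _ (words⁺ len J⊆I) (subst T (sym (if-true-false (⟦ spread s J ⟧ A v)))
        (⋀⁺ A (pairwise⁺ A (AllPairs.map⁺ (AllPairs.map⁺ apart))))))

    askSpread⁻ : ∀ {s c I} s≤k → T (run (askSpread s s≤k c I) (oracle A v)) → Spread s c I
    askSpread⁻ {s} {c} {I} s≤k u
      with any-elim _ (words c I) (subst T (run-anyT _ (words c I) (oracle A v)) u)
    ... | J , J∈ , u′ with words⁻ c J∈
    ...   | len , J⊆I = J , len , J⊆I , AllPairs.map⁻ (AllPairs.map⁻ (pairwise⁻ A (map proj₁ J)
      (⋀⁻ A (pairwiseDist> (t s) (map proj₁ J)) (subst T (if-true-false (⟦ spread s J ⟧ A v)) u′))))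

    -- Two of k + 1 variables below k coincide, and their common value is at distance 0 from itself.
    no-long-spread : ∀ {I} → ¬ Spread 0 (suc k) I
    no-long-spread (J , len , J⊆I , apart)
      with pigeonhole (≤-reflexive (sym len)) (λ p → fromℕ< (proj₁ (proj₂ (lookup J p))))
    ... | p , p′ , p<p′ , eq = AllPairs-lookup apart p<p′
      (subst (Within A 0 (at (lookup J p)))
        (cong v (trans (sym (toℕ-fromℕ< _)) (trans (cong toℕ eq) (toℕ-fromℕ< _)))) (within-here A 0))

    module _ {I : List (Index k F)}
      (isolated : ∀ {i z} → i ∈ indices → Within A D (at i) z → ¬ α-at z)
      (I⁻ : ∀ {i} → i ∈ I → i ∈ indices × (∃[ z ] Within A R (at i) z × β-at z))
      (I⁺ : ∀ {i z} → i ∈ indices → Within A R (at i) z → β-at z → i ∈ I)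
      where

      collect : ∀ s J → All (_∈ I) J → AllPairs (λ i j → Apart A (t (suc s)) (at i) (at j)) J →
                ∃[ bs ] length bs ≡ length J × AllPairs (Apart A (2 * ρ s)) bs × All β-at bs ×
                        All (λ b → ∃[ j ] j ∈ J × Within A R (at j) b) bs
      collect s []      []           []             = [] , refl , [] , [] , []
      collect s (j ∷ J) (j∈ ∷ J⊆I) (apart ∷ aparts) with collect s J J⊆I aparts | I⁻ j∈
      ... | bs , len , bs-apart , bs-β , bs-close | _ , b , close , b-β =
        b ∷ bs , cong suc len , All.map b-apart bs-close ∷ bs-apart , b-β ∷ bs-β ,
        (j , here refl , close) ∷ All.map (λ (j′ , j′∈ , w) → j′ , there j′∈ , w) bs-close
        where
        b-apart : ∀ {b′} → ∃[ j′ ] j′ ∈ J × Within A R (at j′) b′ → Apart A (2 * ρ s) b b′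
        b-apart (j′ , j′∈ , w′) w = All.lookup apart j′∈ (within-mono A (≤-reflexive (t+2R s))
          (within-trans A R close (within-trans A (2 * ρ s) w (within-sym A R w′))))

      -- The distant witness z is the additional one. No x is within `D` of it, and `D` is at least
      -- `2 * ρ s + R`, so z is also apart from the β-witness chosen near each member of J.
      witness⇒scattered : ∀ s c → (∀ {i} → i < k → s < k) → Spread (suc s) c I → ∀ z → α-at z →
                          ∃[ bs ] length bs ≡ suc c × AllPairs (Apart A (2 * ρ s)) bs × All β-at bs
      witness⇒scattered s c small (J , len , J⊆I , apart) z z-α with collect s J J⊆I apart
      ... | bs , len′ , bs-apart , bs-β , bs-close =
        z ∷ bs , cong suc (trans len′ len) , All.map z-apart bs-close ∷ bs-apart ,
        subst T (far-agree z z-far) z-α ∷ bs-β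
        where
        z-far : ∀ {x} → x ∈ free α → x ≢ k → ¬ Within A R (v x) z
        z-far x∈ x≢k w with indices-complete x∈ x≢k
        ... | i@(_ , i<k , _) , i∈ , refl = isolated i∈ (within-mono A (R≤D i<k) w) z-α
        z-apart : ∀ {b} → ∃[ j ] j ∈ J × Within A R (at j) b → Apart A (2 * ρ s) z b
        z-apart (j@(_ , j<k , _) , j∈ , w′) w = isolated (proj₁ (I⁻ (All.lookup J⊆I j∈)))
          (within-mono A (≤-trans (≤-reflexive (+-comm R (2 * ρ s))) (2ρ+R≤D (small j<k)))
            (within-trans A R w′ (within-sym A (2 * ρ s) w))) z-α

      -- A β-witness farther than `R` from all x satisfies α. If there is none, each is replaced by
      -- an x near it. This loses at most `2 * R` of a distance, the amount by which `2 * ρ s`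
      -- exceeds `t s`.
      scattered⇒witness : ∀ s bs → AllPairs (Apart A (2 * ρ s)) bs → All β-at bs → (∃[ z ] α-at z) ⊎
                          (Σ[ (J , _) ∈ Spread s (length bs) I ] All (λ j → ∃[ b ] b ∈ bs × Within A R (at j) b) J)
      scattered⇒witness s []       []               []           = inj₂ (([] , refl , [] , []) , [])
      scattered⇒witness s (b ∷ bs) (apart ∷ aparts) (b-β ∷ bs-β)
        with scattered⇒witness s bs aparts bs-β | Any.any? (λ i → within? A R (at i) b) indices
      ... | inj₁ found | _ = inj₁ found
      ... | inj₂ _ | no far = inj₁ (b , subst T (sym (far-agree b b-far)) b-β)
        where
        b-far : ∀ {x} → x ∈ free α → x ≢ k → ¬ Within A R (v x) b
        b-far x∈ x≢k w with indices-complete x∈ x≢k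
        ... | i , i∈ , refl = far (lose i∈ w)
      ... | inj₂ ((J , len , J⊆I , J-apart) , J-close) | yes found with find found
      ...   | i , i∈ , close = inj₂
        ((i ∷ J , cong suc len , I⁺ i∈ close b-β ∷ J⊆I , All.map (λ {j} → i-apart {j}) J-close ∷ J-apart) ,
         (b , here refl , close) ∷ All.map (λ (b′ , b′∈ , w) → b′ , there b′∈ , w) J-close)
        where
        i-apart : ∀ {j} → ∃[ b′ ] b′ ∈ bs × Within A R (at j) b′ → Apart A (t s) (at i) (at j)
        i-apart (b′ , b′∈ , w′) w = All.lookup apart b′∈ (within-mono A (≤-reflexive (2ρ s))
          (within-trans A R (within-sym A R close) (within-trans A (t s) w w′)))

      -- Stating `s < k` conditionally on some `i < k` lets s = 0 cover the case k = 0 as well.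
      scattered-correct : ∀ s c → (∀ {i} → i < k → s < k) → Spread (suc s) c I → ¬ Spread s (suc c) I →
                          ⟦ scatter (suc c) (ρ s) (β [ k ≔ 0 ]) ⟧ A v ≡ ⟦ ∃′ k α ⟧ A v
      scattered-correct s c small wide ¬narrow = T-ext forwards backwards
        where
        only : FreeBelow 1 (β [ k ≔ 0 ])
        only = Body.only (body {n = n} lβ β⊆ β<)
        forwards : T (⟦ scatter (suc c) (ρ s) (β [ k ≔ 0 ]) ⟧ A v) → T (⟦ ∃′ k α ⟧ A v)
        forwards u with scattered⁻ (suc c) (ρ s) (β [ k ≔ 0 ]) only A v u
        ... | bs , len , apart , bodies
          with scattered⇒witness s bs apart (All.map (λ {b} → subst T (body-value {n = n} lβ β⊆ A v b)) bodies)
        ...   | inj₁ (z , z-α)    = ∃′-intro α A v z z-α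
        ...   | inj₂ (narrow , _) = contradiction (subst (λ c → Spread s c I) len narrow) ¬narrow
        backwards : T (⟦ ∃′ k α ⟧ A v) → T (⟦ scatter (suc c) (ρ s) (β [ k ≔ 0 ]) ⟧ A v)
        backwards u with ∃′-elim α A v u
        ... | z , z-α with witness⇒scattered s c small wide z z-α
        ...   | bs , len , apart , bs-β = scattered⁺ (suc c) (ρ s) (β [ k ≔ 0 ]) only A v
          (bs , len , apart , All.map (λ {b} → subst T (sym (body-value {n = n} lβ β⊆ A v b))) bs-β)

      walk-correct : ∀ s c eq 1≤c → Spread s c I → run (walk s c eq 1≤c I) (oracle A v) ≡ ⟦ ∃′ k α ⟧ A v
      walk-correct zero    c refl 1≤c wide = contradiction wide no-long-spread
      walk-correct (suc s) c eq 1≤c wide = trans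
        (run->>= (askSpread s (<⇒≤ (s<k eq 1≤c)) (suc c) I) _ (oracle A v)) (cases _ refl)
        where
        cases : ∀ b → run (askSpread s (<⇒≤ (s<k eq 1≤c)) (suc c) I) (oracle A v) ≡ b →
                run (if b then walk s (suc c) (trans (+-suc s c) eq) (s≤s z≤n) I
                     else askScattered (suc c) s (s≤s z≤n) (1+c≤1+k eq) (2ρ≤ (s<k eq 1≤c)))
                    (oracle A v) ≡ ⟦ ∃′ k α ⟧ A v
        cases true  ran = walk-correct s (suc c) _ _ (askSpread⁻ (<⇒≤ (s<k eq 1≤c)) (subst T (sym ran) tt))
        cases false ran = trans (if-true-false (⟦ scatter (suc c) (ρ s) (β [ k ≔ 0 ]) ⟧ A v))
          (scattered-correct s c (λ _ → s<k eq 1≤c) wide λ narrow →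
            subst T ran (askSpread⁺ (<⇒≤ (s<k eq 1≤c)) narrow))

    dispatch-correct : ∀ I → (∀ {i z} → i ∈ indices → Within A D (at i) z → ¬ α-at z) →
      (∀ {i} → i ∈ I → i ∈ indices × (∃[ z ] Within A R (at i) z × β-at z)) →
      (∀ {i z} → i ∈ indices → Within A R (at i) z → β-at z → i ∈ I) →
      run (dispatch I) (oracle A v) ≡ ⟦ ∃′ k α ⟧ A v
    dispatch-correct [] isolated I⁻ I⁺ = trans (if-true-false (⟦ scatter 1 (ρ 0) (β [ k ≔ 0 ]) ⟧ A v))
      (scattered-correct isolated I⁻ I⁺ 0 0 (≤-trans (s≤s z≤n)) ([] , refl , [] , []) λ { (_ ∷ _ , _ , () ∷ _ , _) })
    dispatch-correct (i ∷ I) isolated I⁻ I⁺ =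
      walk-correct isolated I⁻ I⁺ k 1 (+-comm k 1) ≤-refl (i ∷ [] , refl , here refl ∷ [] , [] ∷ [])

    program-correct : run program (oracle A v) ≡ ⟦ ∃′ k α ⟧ A v
    program-correct = trans (run->>= (anyT askNearα indices) _ (oracle A v))
      (cases _ (run-anyT askNearα indices (oracle A v)))
      where
      cases : ∀ b → b ≡ any (λ i → run (askNearα i) (oracle A v)) indices →
              run (if b then leaf true else (filterT askNearβ indices >>= dispatch)) (oracle A v) ≡ ⟦ ∃′ k α ⟧ A v
      cases true eq with any-elim _ indices (subst T eq tt)
      ... | i@(x , x<k , _) , i∈ , u with nearby⁻ {e = D} α A v (<⇒≢ x<k) (subst T (run-askNearα i) u)
      ...   | z , _ , z-α = sym (T⇒true (∃′-intro α A v z z-α))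
      cases false eq = begin
        run (filterT askNearβ indices >>= dispatch) (oracle A v)
          ≡⟨ run->>= (filterT askNearβ indices) dispatch (oracle A v) ⟩
        run (dispatch (run (filterT askNearβ indices) (oracle A v))) (oracle A v)
          ≡⟨ cong (λ I → run (dispatch I) (oracle A v)) (run-filterT askNearβ indices (oracle A v)) ⟩
        run (dispatch I) (oracle A v)
          ≡⟨ dispatch-correct I isolated I⁻ I⁺ ⟩
        ⟦ ∃′ k α ⟧ A v
          ∎
        where
        open ≡-Reasoning
        accepted : Index k F → Bool
        accepted i = run (askNearβ i) (oracle A v)
        I : List (Index k F)
        I = filterᵇ accepted indices
        isolated : ∀ {i z} → i ∈ indices → Within A D (at i) z → ¬ α-at z
        isolated {i@(x , x<k , _)} i∈ w z-α = subst T (sym eq)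
          (any-intro _ i∈ (subst T (sym (run-askNearα i)) (nearby⁺ α A v (<⇒≢ x<k) w z-α)))
        I⁻ : ∀ {i} → i ∈ I → i ∈ indices × (∃[ z ] Within A R (at i) z × β-at z)
        I⁻ {i@(x , x<k , _)} i∈ with ∈-filter⁻ (T? ∘ accepted) {xs = indices} i∈
        ... | i∈′ , u = i∈′ , nearby⁻ β A v (<⇒≢ x<k) (subst T (run-askNearβ i) u)
        I⁺ : ∀ {i z} → i ∈ indices → Within A R (at i) z → β-at z → i ∈ I
        I⁺ {i@(x , x<k , _)} i∈ w z-β = ∈-filter⁺ (T? ∘ accepted) i∈
          (subst T (sym (run-askNearβ i)) (nearby⁺ β A v (<⇒≢ x<k) w z-β))

-- Modulo-counting quantification over a local formula

record Guard {σ M} (d q k : ℕ) (F : Var → Set) (γ : Formula σ M) : Set where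
  field
    atomic  : Atomic γ
    below   : FreeBelow (suc k) γ
    md≤cap  : md γ ≤ cap d q (suc k)
    reach≤r₁  : reach γ ≤ r₁ q (suc k) d
    inside  : ∀ {x} → x ∈ free γ → x ≢ k → F x
    {index} : Var
    index<k : index < k
    index∈  : index ∈ free γ
    k∈      : k ∈ free γ

-- The number of α-witnesses is that of the β-witnesses plus a correction: α and β differ only
-- where some guard holds, and the witnesses of α and of β satisfying a guard are counted locally.
module Counting {σ : Signature} {M : List ℕ} {d q k n : ℕ} {F : Var → Set} {α β : Formula σ M}
  (lα : Local d q (suc k) α) (α⊆ : ∀ {x} → x ∈ free α → x ≢ k → F x) (α< : qr α < n)
  (lβ : Local d q (suc k) β) (β⊆ : ∀ {x} → x ∈ free β → x ≡ k) (β< : qr β < n)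
  {m-1 : ℕ} (m∈ : suc m-1 ∈ M)
  where

  private
    m : ℕ
    m = suc m-1

  Program : Set → Set
  Program = Tree (Question {σ} {M} d n F (suc q) k)

  record Inner (χ : Formula σ M) : Set where
    constructor inner
    field
      isLoc : Local d q (suc k) χ
      keeps : ∀ {x} → x ∈ free χ → x ≢ k → F x
      ranks : qr χ < n

  open Inner

  inner-∧ : ∀ {χ ξ} → Inner χ → Inner ξ → Inner (χ ∧′ ξ)
  inner-∧ {χ} a b = inner (isLoc a ∧′ isLoc b)
    (λ x∈ x≢k → [ (λ x∈χ → keeps a x∈χ x≢k) , (λ x∈ξ → keeps b x∈ξ x≢k) ]′ (∈-++⁻ (free χ) x∈))
    (⊔-lub (ranks a) (ranks b))

  inner-α : Inner α
  inner-α = inner lα α⊆ α<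

  inner-β : Inner β
  inner-β = inner lβ (λ x∈ x≢k → contradiction (β⊆ x∈) x≢k) β<

  inner-true : Inner true′
  inner-true = inner true′ (λ ()) (≤-trans (s≤s z≤n) α<)

  inner-guard : ∀ {γ} → Guard d q k F γ → Inner γ
  inner-guard {γ} g = inner (atom atomic below md≤cap) inside
    (≤-trans (s≤s (≤-trans (≤-reflexive (atomic-qr atomic)) z≤n)) α<)
    where open Guard g

  inner-¬ : ∀ {χ} → Inner χ → Inner (¬′ χ)
  inner-¬ a = inner (¬′ isLoc a) (keeps a) (ranks a)

  guarded-piece : ∀ {γ χ} i → Guard d q k F γ → Inner χ → Piece d (suc q) k F n (∃mod m∈ i k (γ ∧′ χ))
  guarded-piece {γ} {χ} i g a = record
    { local = guarded (mod m∈ i) (isLoc a) atomic below index<k index∈ k∈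
        (≤-trans (+-monoˡ-≤ (r₁ q (suc k) d) reach≤r₁) (2R≤ index<k)) (inj₁ md≤cap)
    ; free⊆ = λ x∈ → let x∈′ , x≢k = free-quantify⁻ (mod m∈ i) (γ ∧′ χ) x∈ in keeps both x∈′ x≢k
    ; qr≤   = ranks both
    }
    where
    open Guard g
    both : Inner (γ ∧′ χ)
    both = inner-∧ (inner-guard g) a
    2R≤ : ∀ {i} → i < k → r₁ q (suc k) d + r₁ q (suc k) d ≤ r₁ (suc q) k d
    2R≤ i<k = ≤-trans (≤-reflexive (cong (r₁ q (suc k) d +_) (sym (+-identityʳ _))))
      (*-monoˡ-≤ (r₁ q (suc k) d) (≤-trans (s≤s (s≤s z≤n)) (*-monoʳ-≤ 4 (≤-trans (s≤s z≤n) i<k))))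

  search : (χ : Fin m → Formula σ M) → (∀ i → Question d n F (suc q) k (χ i)) → List (Fin m) → Program ℕ
  -- Only a fallback: `residue` searches all of `Fin m`, where the actual residue is found.
  search χ p []       = leaf 0
  search χ p (i ∷ is) = query (χ i) (p i) >>= λ b → if b then leaf (toℕ i) else search χ p is

  residue : (χ : Fin m → Formula σ M) → (∀ i → Question d n F (suc q) k (χ i)) → Program ℕ
  residue χ p = search χ p (allFin m)

  guardedResidue : ∀ {γ χ} → Guard d q k F γ → Inner χ → Program ℕ
  guardedResidue {γ} {χ} g a = residue (λ i → ∃mod m∈ i k (γ ∧′ χ)) (λ i → asLocal (guarded-piece i g a))

  -- κ says that all earlier guards fail. So an element is attributed to the first guard that it
  -- satisfies, and none is counted twice. Elements without a guard contribute nothing, because α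
  -- and β agree on them.
  correction : ∀ {κ} → List (∃[ γ ] Guard {σ} {M} d q k F γ) → Inner κ → Program ℕ
  correction []             a = leaf 0
  correction ((γ , g) ∷ gs) a =
    correction gs (inner-∧ (inner-¬ (inner-guard g)) a) >>= λ c →
    guardedResidue g (inner-∧ a inner-α) >>= λ x →
    guardedResidue g (inner-∧ a inner-β) >>= λ y →
    -- Modulo m, adding `m-1 * y` amounts to subtracting y.
    leaf (c + x + m-1 * y)

  residue-β : Program ℕ
  residue-β = residue (λ i → ∃mod m∈ i 0 (β [ k ≔ 0 ])) (λ i → asSentence (counted m∈ i (body lβ β⊆ β<)))

  program : List (∃[ γ ] Guard {σ} {M} d q k F γ) → Fin m → Program Bool
  program gs i =
    correction gs inner-true >>= λ c →
    residue-β >>= λ b →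
    leaf (((b + c) % m) ≡ᵇ toℕ i)

  infix 4 _≈_
  _≈_ : ℕ → ℕ → Set
  a ≈ b = a % m ≡ b % m

  +-≈ : ∀ a b a′ b′ → a ≈ b → a′ ≈ b′ → a + a′ ≈ b + b′
  +-≈ a b a′ b′ p p′ = begin
    (a + a′) % m            ≡⟨ %-distribˡ-+ a a′ m ⟩
    (a % m + a′ % m) % m    ≡⟨ cong₂ (λ x y → (x + y) % m) p p′ ⟩
    (b % m + b′ % m) % m    ≡⟨ %-distribˡ-+ b b′ m ⟨
    (b + b′) % m            ∎
    where open ≡-Reasoning

  search-correct : ∀ (χ : Fin m → Formula σ M) p is (ρ : Oracle σ M) N → (∀ i → ρ (χ i) ≡ ((N % m) ≡ᵇ toℕ i)) →
                   fromℕ< (m%n<n N m) ∈ is → run (search χ p is) ρ ≡ N % m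
  search-correct χ p (i ∷ is) ρ N tests found
    rewrite run->>= (query (χ i) (p i)) (λ b → if b then leaf (toℕ i) else search χ p is) ρ
          | if-true-false (ρ (χ i)) = cases (ρ (χ i)) refl found
    where
    cases : ∀ b → ρ (χ i) ≡ b → fromℕ< (m%n<n N m) ∈ i ∷ is →
            run (if b then leaf (toℕ i) else search χ p is) ρ ≡ N % m
    cases true  eq _            = sym (≡ᵇ⇒≡ (N % m) (toℕ i) (subst T (trans (sym eq) (tests i)) tt))
    cases false eq (there found) = search-correct χ p is ρ N tests found
    cases false eq (here i≡)    = ⊥-elim (subst T (trans (sym (tests i)) eq)
      (≡⇒≡ᵇ (N % m) (toℕ i) (trans (sym (toℕ-fromℕ< (m%n<n N m))) (cong toℕ i≡))))

  residue-correct : ∀ (χ : Fin m → Formula σ M) p (ρ : Oracle σ M) N → (∀ i → ρ (χ i) ≡ ((N % m) ≡ᵇ toℕ i)) →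
                    run (residue χ p) ρ ≡ N % m
  residue-correct χ p ρ N tests = search-correct χ p (allFin m) ρ N tests (∈-allFin _)

  module _ (A : Structure σ) (v : Assignment A) where
    open Structure A using (Carrier; elements)

    # : Formula σ M → ℕ
    # χ = witnesses χ A v k

    True : Formula σ M → Carrier → Set
    True χ z = T (⟦ χ ⟧ A (v [ k ↦ z ]))

    guardedResidue-correct : ∀ {γ χ} (g : Guard d q k F γ) (a : Inner χ) →
                             run (guardedResidue g a) (oracle A v) ≡ # (γ ∧′ χ) % m
    guardedResidue-correct {γ} {χ} g a = residue-correct _ _ (oracle A v) (# (γ ∧′ χ)) (λ i → refl)

    correction-correct : ∀ {κ} gs (a : Inner κ) →
      (∀ z → True κ z → (∀ {g} → g ∈ gs → ¬ True (proj₁ g) z) → ⟦ α ⟧ A (v [ k ↦ z ]) ≡ ⟦ β ⟧ A (v [ k ↦ z ])) →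
      # (κ ∧′ α) ≈ # (κ ∧′ β) + run (correction gs a) (oracle A v)
    correction-correct {κ} [] a agree = cong (_% m) (trans
      (count-cong elements (λ z → ∧-congʳ (λ κz → agree z κz (λ ()))))
      (sym (+-identityʳ _)))
    correction-correct {κ} ((γ , g) ∷ gs) a agree = begin
      # (κ ∧′ α) % m
        ≡⟨ cong (_% m) (partition α) ⟩
      (# (γ ∧′ κ ∧′ α) + # ((¬′ γ ∧′ κ) ∧′ α)) % m
        ≡⟨ +-≈ (# (γ ∧′ κ ∧′ α)) x _ (b + c) (sym (m%n%n≡m%n (# (γ ∧′ κ ∧′ α)) m)) induction ⟩
      (x + (b + c)) % m
        -- The multiple `y * m` is introduced to be divided into `y`, which restores the guarded
        -- β-witnesses, and `m-1 * y`, which belongs to the correction.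
        ≡⟨ [m+kn]%n≡m%n (x + (b + c)) y m ⟨
      (x + (b + c) + y * m) % m
        ≡⟨ cong (_% m) (rearrange x b c y m-1) ⟩
      (y + (b + (c + x + m-1 * y))) % m
        ≡⟨ +-≈ y (# (γ ∧′ κ ∧′ β)) (b + (c + x + m-1 * y)) _ (m%n%n≡m%n (# (γ ∧′ κ ∧′ β)) m) refl ⟩
      (# (γ ∧′ κ ∧′ β) + (b + (c + x + m-1 * y))) % m
        ≡⟨ cong (_% m) (sym (+-assoc (# (γ ∧′ κ ∧′ β)) _ _)) ⟩
      (# (γ ∧′ κ ∧′ β) + b + (c + x + m-1 * y)) % m
        ≡⟨ cong₂ (λ a b → (a + b) % m) (sym (partition β)) (sym ran) ⟩
      (# (κ ∧′ β) + run (correction ((γ , g) ∷ gs) a) (oracle A v)) % m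
        ∎
      where
      open ≡-Reasoning
      a′ : Inner (¬′ γ ∧′ κ)
      a′ = inner-∧ (inner-¬ (inner-guard g)) a
      b c x y : ℕ
      b = # ((¬′ γ ∧′ κ) ∧′ β)
      c = run (correction gs a′) (oracle A v)
      x = # (γ ∧′ κ ∧′ α) % m
      y = # (γ ∧′ κ ∧′ β) % m
      partition : ∀ χ → # (κ ∧′ χ) ≡ # (γ ∧′ κ ∧′ χ) + # ((¬′ γ ∧′ κ) ∧′ χ)
      partition χ = trans
        (count-∧ (λ z → ⟦ γ ⟧ A (v [ k ↦ z ])) (λ z → ⟦ κ ∧′ χ ⟧ A (v [ k ↦ z ])) elements)
        (cong (# (γ ∧′ κ ∧′ χ) +_) (count-cong elements (λ z → sym (∧-assoc (⟦ ¬′ γ ⟧ A (v [ k ↦ z ])) _ _))))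
      induction : # ((¬′ γ ∧′ κ) ∧′ α) ≈ # ((¬′ γ ∧′ κ) ∧′ β) + c
      induction = correction-correct gs a′ λ z t others →
        agree z (proj₂ (∧⁻ t)) λ { (here refl) → T-not⁻ (proj₁ (∧⁻ t)) ; (there g∈) → others g∈ }
      rearrange : ∀ x b c y p → x + (b + c) + y * suc p ≡ y + (b + (c + x + p * y))
      rearrange = solve-∀
      ran : run (correction ((γ , g) ∷ gs) a) (oracle A v) ≡ c + x + m-1 * y
      ran = trans (run->>= (correction gs a′) _ (oracle A v))
        (trans (run->>= (guardedResidue g (inner-∧ a inner-α)) _ (oracle A v))
          (trans (run->>= (guardedResidue g (inner-∧ a inner-β)) _ (oracle A v))
            (cong₂ (λ x y → c + x + m-1 * y) (guardedResidue-correct g (inner-∧ a inner-α))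
                                             (guardedResidue-correct g (inner-∧ a inner-β)))))

    program-correct : ∀ gs i →
      (∀ z → (∀ {g} → g ∈ gs → ¬ True (proj₁ g) z) → ⟦ α ⟧ A (v [ k ↦ z ]) ≡ ⟦ β ⟧ A (v [ k ↦ z ])) →
      run (program gs i) (oracle A v) ≡ ⟦ ∃mod m∈ i k α ⟧ A v
    program-correct gs i agree = trans (run->>= (correction gs inner-true) _ (oracle A v))
      (trans (run->>= residue-β (λ b → leaf (((b + c) % m) ≡ᵇ toℕ i)) (oracle A v)) (cong (_≡ᵇ toℕ i) (begin
        (b + c) % m             ≡⟨ cong (λ b → (b + c) % m) counted-β ⟩
        (# β % m + c) % m       ≡⟨ +-≈ (# β % m) (# β) c c (m%n%n≡m%n (# β) m) refl ⟩
        (# β + c) % m           ≡⟨ correction-correct gs inner-true (λ z _ → agree z) ⟨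
        # α % m                 ∎)))
      where
      open ≡-Reasoning
      b c : ℕ
      b = run residue-β (oracle A v)
      c = run (correction gs inner-true) (oracle A v)
      counted-β : b ≡ # β % m
      counted-β = residue-correct _ _ (oracle A v) (# β) λ i →
        cong (λ N → (N % m) ≡ᵇ toℕ i) (count-cong elements (body-value {n = n} lβ β⊆ A v))

-- Normal forms as decision trees

NormalForm : (σ : Signature) (M : List ℕ) (d n : ℕ) → (Var → Set) → (q k : ℕ) → Set
NormalForm σ M d n F q k = Tree (Question {σ} {M} d n F q k) Bool

Preliminary : (d n : ℕ) → (Var → Set) → (q k : ℕ) → Formula σ M → Set
Preliminary d n F q k ψ = Question d n F (suc q) k ψ × k ∉ free ψ

prefix : ∀ {σ M d n F q k B} {P P₂ : Formula σ M → Set} →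
         (∀ {ψ} → P ψ → Preliminary d n F q k ψ ⊎ P₂ ψ) →
         Tree P B → Tree (Question {σ} {M} d n F (suc q) k) (Tree P₂ B)
prefix h t = reask proj₁ (pull h t)

run-prefix : ∀ {σ M d n F q k B} {P P₂ : Formula σ M → Set}
             (h : ∀ {ψ} → P ψ → Preliminary {σ} {M} d n F q k ψ ⊎ P₂ ψ) (t : Tree P B) A v z →
             run (run (prefix {P₂ = P₂} h t) (oracle A v)) (oracle A (v [ k ↦ z ])) ≡ run t (oracle A (v [ k ↦ z ]))
run-prefix {d = d} {n} {F} {q} {k} {P₂ = P₂} h t A v z = trans
  (cong (λ u → run u (oracle A (v [ k ↦ z ])))
    (run-reask {P₂ = Question d n F (suc q) k} proj₁ (pull {P₁ = Preliminary d n F q k} {P₂ = P₂} h t) (oracle A v)))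
  (run-pull h t unaffected)
  where
  unaffected : ∀ {ψ} → Preliminary d n F q k ψ → ⟦ ψ ⟧ A v ≡ ⟦ ψ ⟧ A (v [ k ↦ z ])
  unaffected {ψ} (_ , k∉) = coincidence ψ A (λ x∈ → sym (update-other v (λ { refl → k∉ x∈ })))

module Quantification {σ : Signature} {M : List ℕ} {d q k n : ℕ} {F : Var → Set} {α : Formula σ M}
  (lα : Local d q (suc k) α) (α⊆ : ∀ {x} → x ∈ free α → x ≢ k → F x) (α< : qr α < n)
  where

  isNew : Var → Bool
  isNew x = ⌊ x ℕ.≟ k ⌋

  isNew⁻ : ∀ {x} → isNew x ≡ true → x ≡ k
  isNew⁻ {x} eq = toWitness {a? = x ℕ.≟ k} (subst T (sym eq) tt)

  isOld⁻ : ∀ {x} → isNew x ≡ false → x ≢ k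
  isOld⁻ {x} eq x≡k = subst T eq (fromWitness {a? = x ℕ.≟ k} x≡k)

  separated⁻ : ∀ {x y} → isNew x ≢ isNew y → (x ≡ k × y ≢ k) ⊎ (x ≢ k × y ≡ k)
  separated⁻ {x} {y} ne with x ℕ.≟ k | y ℕ.≟ k
  ... | yes p | yes _ = contradiction refl ne
  ... | yes p | no ¬r = inj₁ (p , ¬r)
  ... | no ¬p | yes r = inj₂ (¬p , r)
  ... | no _  | no _  = contradiction refl ne

  NewPiece : Formula σ M → Set
  NewPiece = Piece d q (suc k) (λ x → x ∈ free α × isNew x ≡ true) (qr α)

  classify : ∀ {ψ} → OneSided d q (suc k) (_∈ free α) isNew (qr α) ψ → Preliminary d n F q k ψ ⊎ NewPiece ψ
  classify (true  , p) = inj₂ p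
  classify {ψ} (false , p) = inj₁ (asLocal (record
    { local = raise (local p) (λ x x∈ → below-suc (old x∈) (local-below (local p) x x∈))
    ; free⊆ = λ x∈ → α⊆ (proj₁ (free⊆ p x∈)) (old x∈)
    ; qr≤   = ≤-trans (qr≤ p) (<⇒≤ α<)
    }) , λ k∈ → old k∈ refl)
    where
    old : ∀ {x} → x ∈ free ψ → x ≢ k
    old x∈ = isOld⁻ (proj₂ (free⊆ p x∈))

  sides : Tree (OneSided {σ} {M} d q (suc k) (_∈ free α) isNew (qr α)) Bool
  sides = split isNew (_∈ free α) lα id ≤-refl

  Crossings : Set
  Crossings = List (∃[ γ ] Crossing {σ} {M} d q (suc k) (_∈ free α) isNew γ)

  across : Crossings
  across = crossings isNew (_∈ free α) lα id

  -- k is the only variable on the new side. Hence one end of a crossing is k, and the other is a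
  -- variable below k to which the atom can tie it.
  guard : ∃[ γ ] Crossing {σ} {M} d q (suc k) (_∈ free α) isNew γ → ∃[ γ ] Guard {σ} {M} d q k F γ
  guard (γ , c) = γ , oriented (separated⁻ separated)
    where
    open Crossing c
    make : ∀ {i} → i ∈ free γ → i ≢ k → k ∈ free γ → Guard d q k F γ
    make i∈ i≢k k∈ = record
      { atomic = atomic ; below = below ; md≤cap = md≤cap ; reach≤r₁ = reach≤r₁
      ; inside = λ x∈ x≢k → α⊆ (inside x∈) x≢k
      ; index<k = below-suc i≢k (below _ i∈) ; index∈ = i∈ ; k∈ = k∈ }
    oriented : (left ≡ k × right ≢ k) ⊎ (left ≢ k × right ≡ k) → Guard d q k F γ
    oriented (inj₁ (l≡k , r≢k)) = make right∈ r≢k (subst (_∈ free γ) l≡k left∈)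
    oriented (inj₂ (l≢k , r≡k)) = make left∈ l≢k (subst (_∈ free γ) r≡k right∈)

  new-free : ∀ (t : Tree NewPiece Bool) {x} → x ∈ free (formula t) → x ≡ k
  new-free t x∈ = isNew⁻ (proj₂ (formula-free t free⊆ x∈))

  new-qr : ∀ (t : Tree NewPiece Bool) → qr (formula t) < n
  new-qr t = ≤-trans (s≤s (formula-qr t qr≤)) α<

  -- For ∃ distances to the x suffice, since wide distance guards are available. Counting takes the
  -- crossings as guards, because these are atoms of the class below.
  answer : Quantifier M → Tree NewPiece Bool → NormalForm σ M d n F (suc q) k
  answer some                t = Existence.program lα α⊆ α< (piece-formula t) (new-free t) (new-qr t)
  answer (mod {suc m} m∈ i) t =
    Counting.program lα α⊆ α< (piece-formula t) (new-free t) (new-qr t) m∈ (map guard across) i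

  program : Quantifier M → NormalForm σ M d n F (suc q) k
  program Q = prefix classify sides >>= answer Q

  module _ (A : Structure σ) (v : Assignment A) where

    far-refuted : ∀ z → (∀ {x} → x ∈ free α → x ≢ k → ¬ Within A (r₁ q (suc k) d) (v x) z) →
                  Refuted A (v [ k ↦ z ]) across
    far-refuted z far {γ , c} _ u = oriented (inside left∈) (inside right∈) (separated⁻ separated)
      (crossing-within c A (v [ k ↦ z ]) u)
      where
      open Crossing c
      R : ℕ
      R = r₁ q (suc k) d
      oriented : ∀ {x y} → x ∈ free α → y ∈ free α → (x ≡ k × y ≢ k) ⊎ (x ≢ k × y ≡ k) →
                 ¬ Within A R ((v [ k ↦ z ]) x) ((v [ k ↦ z ]) y)
      oriented x∈ y∈ (inj₁ (refl , y≢k)) w = far y∈ y≢k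
        (within-sym A R (subst₂ (Within A R) (update-same v k) (update-other v y≢k) w))
      oriented x∈ y∈ (inj₂ (x≢k , refl)) w = far x∈ x≢k
        (subst₂ (Within A R) (update-other v x≢k) (update-same v k) w)

    new : Tree NewPiece Bool
    new = run (prefix classify sides) (oracle A v)

    agree : ∀ z → Refuted A (v [ k ↦ z ]) across → ⟦ α ⟧ A (v [ k ↦ z ]) ≡ ⟦ formula new ⟧ A (v [ k ↦ z ])
    agree z refuted = begin
      ⟦ α ⟧ A (v [ k ↦ z ])               ≡⟨ split-correct isNew (_∈ free α) lα id ≤-refl A (v [ k ↦ z ]) refuted ⟨
      run sides (oracle A (v [ k ↦ z ]))  ≡⟨ run-prefix classify sides A v z ⟨
      run new (oracle A (v [ k ↦ z ]))    ≡⟨ ⟦formula⟧ new A (v [ k ↦ z ]) ⟨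
      ⟦ formula new ⟧ A (v [ k ↦ z ])     ∎
      where open ≡-Reasoning

    answer-correct : ∀ Q → run (answer Q new) (oracle A v) ≡ ⟦ quantify Q k α ⟧ A v
    answer-correct some =
      Existence.program-correct lα α⊆ α< (piece-formula new) (new-free new) (new-qr new) A v
        (λ z far → agree z (far-refuted z far))
    answer-correct (mod {suc m} m∈ i) =
      Counting.program-correct lα α⊆ α< (piece-formula new) (new-free new) (new-qr new) m∈ A v (map guard across) i
        (λ z refuted → agree z (λ c∈ → refuted (∈-map⁺ guard c∈)))

    program-correct : ∀ Q → run (program Q) (oracle A v) ≡ ⟦ quantify Q k α ⟧ A v
    program-correct Q = trans (run->>= (prefix classify sides) (answer Q) (oracle A v)) (answer-correct Q)

-- Moving questions to the next quantifier rank

weaken-body : ∀ {n′} → n ≤ n′ → Body {σ} {M} d q k n φ → Body d q k n′ φ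
weaken-body n≤ b = record
  { isLoc = isLoc ; radius≤ = radius≤ ; class = class ; only = only ; qr< = ≤-trans qr< n≤ }
  where open Body b

weaken-sentence : ∀ {n′} → n ≤ n′ → Sentence {σ} {M} d q k n φ → Sentence d q k n′ φ
weaken-sentence n≤ (scattered ℓ r b p₁ p₂ p₃ p₄) = scattered ℓ r (weaken-body n≤ b) p₁ p₂ p₃ p₄
weaken-sentence n≤ (counted m∈ i b)              = counted m∈ i (weaken-body n≤ b)

raise-question : (∀ {x} → G x → F x × x < k) → Question {σ} {M} d n G q (suc k) φ → Question d n F (suc q) k φ
raise-question G⊆ (asLocal p)    = asLocal (record
  { local = raise (local p) (λ x x∈ → proj₂ (G⊆ (free⊆ p x∈)))
  ; free⊆ = λ x∈ → proj₁ (G⊆ (free⊆ p x∈))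
  ; qr≤   = qr≤ p })
raise-question G⊆ (asSentence s) = asSentence (raise-sentence s)

-- A sentence has no free variable, so it can be asked before k is quantified. What remains is a
-- tree of local questions, whose formula is again in the local fragment.
extract-sentences : ∀ {n′} → n′ ≤ n → Question {σ} {M} d n′ G q (suc k) φ →
                    Preliminary d n F q k φ ⊎ Piece d q (suc k) G n′ φ
extract-sentences n≤ (asLocal p)    = inj₂ p
extract-sentences n≤ (asSentence s) = inj₁ (asSentence (raise-sentence (weaken-sentence n≤ s)) , sentence-closed s)

quantifier-free-local : View φ → qr φ ≡ 0 → FreeBelow k φ → md φ ≤ d → Local d 0 k φ
quantifier-free-local true′          _ below md≤ = true′
quantifier-free-local false′         _ below md≤ = false′
quantifier-free-local (x ≈′ y)       _ below md≤ = atom equality below md≤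
quantifier-free-local (rel R xs)     _ below md≤ = atom relation below md≤
quantifier-free-local (dist≤ x y e)  _ below md≤ = atom distance below md≤
quantifier-free-local (¬′ p)         q≡0 below md≤ = ¬′ quantifier-free-local p q≡0 below md≤
quantifier-free-local (_∧′_ {φ} {ψ} p r) q≡0 below md≤ =
  quantifier-free-local p (n≤0⇒n≡0 (≤-trans (m≤m⊔n (qr φ) (qr ψ)) (≤-reflexive q≡0)))
    (λ x x∈ → below x (∈-++⁺ˡ x∈)) (≤-trans (m≤m⊔n (md φ) (md ψ)) md≤) ∧′
  quantifier-free-local r (n≤0⇒n≡0 (≤-trans (m≤n⊔m (qr φ) (qr ψ)) (≤-reflexive q≡0)))
    (λ x x∈ → below x (∈-++⁺ʳ (free φ) x∈)) (≤-trans (m≤n⊔m (md φ) (md ψ)) md≤)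
quantifier-free-local (_∨′_ {φ} {ψ} p r) q≡0 below md≤ =
  quantifier-free-local p (n≤0⇒n≡0 (≤-trans (m≤m⊔n (qr φ) (qr ψ)) (≤-reflexive q≡0)))
    (λ x x∈ → below x (∈-++⁺ˡ x∈)) (≤-trans (m≤m⊔n (md φ) (md ψ)) md≤) ∨′
  quantifier-free-local r (n≤0⇒n≡0 (≤-trans (m≤n⊔m (qr φ) (qr ψ)) (≤-reflexive q≡0)))
    (λ x x∈ → below x (∈-++⁺ʳ (free φ) x∈)) (≤-trans (m≤n⊔m (md φ) (md ψ)) md≤)
quantifier-free-local (quantified Q x {φ} p) q≡0 with () ← trans (sym (qr-quantify Q x φ)) q≡0

-- The induction on q

record Normalised {σ M} (d n : ℕ) (F : Var → Set) (q k : ℕ) (φ : Formula σ M) : Set₁ where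
  field
    tree    : NormalForm σ M d n F q k
    correct : ∀ A v → run tree (oracle A v) ≡ ⟦ φ ⟧ A v

open Normalised

-- `F` and `n` are arbitrary because under a quantifier the hypothesis is applied with the free
-- variables and the rank of the matrix, where k may be free, rather than those of the whole
-- formula.
Normaliser : (σ : Signature) (M : List ℕ) (d q k : ℕ) → Set₁
Normaliser σ M d q k = ∀ {φ : Formula σ M} {n F} → FO+MOD⁺ q k d φ → (∀ {x} → x ∈ free φ → F x) → qr φ ≤ n →
                       Normalised d n F q k φ

module Step {σ : Signature} {M : List ℕ} {d q k : ℕ} (normal : Normaliser σ M d q (suc k)) where

  module Matrix {ψ : Formula σ M} (c : FO+MOD⁺ q (suc k) d ψ) (n : ℕ) (F : Var → Set) (ψ<n : qr ψ < n)
    (ψ⊆ : ∀ {x} → x ∈ free ψ → x ≢ k → F x) where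

    ih : Normalised d (qr ψ) (_∈ free ψ) q (suc k) ψ
    ih = normal c id ≤-refl

    LocalTree : Set
    LocalTree = Tree (Piece {σ} {M} d q (suc k) (_∈ free ψ) (qr ψ)) Bool

    preliminaries : Tree (Question {σ} {M} d n F (suc q) k) LocalTree
    preliminaries = prefix (extract-sentences (<⇒≤ ψ<n)) (tree ih)

    keeps : ∀ (t : LocalTree) {x} → x ∈ free (formula t) → x ≢ k → F x
    keeps t x∈ = ψ⊆ (formula-free t free⊆ x∈)

    ranks : ∀ (t : LocalTree) → qr (formula t) < n
    ranks t = ≤-trans (s≤s (formula-qr t qr≤)) ψ<n

    chosen : ∀ A → Assignment A → LocalTree
    chosen A v = run preliminaries (oracle A v)

    same : ∀ A v z → ⟦ formula (chosen A v) ⟧ A (v [ k ↦ z ]) ≡ ⟦ ψ ⟧ A (v [ k ↦ z ])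
    same A v z = trans (⟦formula⟧ (chosen A v) A (v [ k ↦ z ]))
      (trans (run-prefix (extract-sentences (<⇒≤ ψ<n)) (tree ih) A v z) (correct ih A (v [ k ↦ z ])))

  quantified-normal : ∀ (Q : Quantifier M) {ψ : Formula σ M} {n F} → FO+MOD⁺ q (suc k) d ψ →
                      (∀ {x} → x ∈ free (quantify Q k ψ) → F x) → qr (quantify Q k ψ) ≤ n →
                      Normalised d n F (suc q) k (quantify Q k ψ)
  quantified-normal Q {ψ} {n} {F} c F∋ ≤n = record
    { tree    = preliminaries >>= inner
    ; correct = λ A v → trans (run->>= preliminaries inner (oracle A v)) (begin
        run (inner (chosen A v)) (oracle A v)
          ≡⟨ Quantification.program-correct
               (piece-formula (chosen A v)) (keeps (chosen A v)) (ranks (chosen A v)) A v Q ⟩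
        ⟦ quantify Q k (formula (chosen A v)) ⟧ A v
          ≡⟨ ⟦quantify⟧ Q k (formula (chosen A v)) A v ⟩
        accepts Q (witnesses (formula (chosen A v)) A v k)
          ≡⟨ cong (accepts Q) (count-cong (Structure.elements A) (same A v)) ⟩
        accepts Q (witnesses ψ A v k)
          ≡⟨ ⟦quantify⟧ Q k ψ A v ⟨
        ⟦ quantify Q k ψ ⟧ A v
          ∎)
    }
    where
    open ≡-Reasoning
    open Matrix c n F (subst (_≤ n) (qr-quantify Q k ψ) ≤n) (λ x∈ x≢k → F∋ (free-quantify⁺ Q ψ x∈ x≢k))
    inner : LocalTree → NormalForm σ M d n F (suc q) k
    inner t = Quantification.program (piece-formula t) (keeps t) (ranks t) Q

  generator-normal : ∀ {φ : Formula σ M} {n F} → Generator q k d (FO+MOD⁺ q (suc k) d) φ →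
                     (∀ {x} → x ∈ free φ → F x) → qr φ ≤ n → Normalised d n F (suc q) k φ
  generator-normal {φ} {n} {F} (lower c below) F∋ ≤n = record
    { tree    = reask (raise-question raised) (tree ih)
    ; correct = λ A v → trans (run-reask (raise-question raised) (tree ih) (oracle A v)) (correct ih A v)
    }
    where
    ih : Normalised d n (_∈ free φ) q (suc k) φ
    ih = normal c id ≤n
    raised : ∀ {x} → x ∈ free φ → F x × x < k
    raised x∈ = F∋ x∈ , below _ x∈
  generator-normal {φ} (distance i<k j<k e≤) F∋ ≤n = record
    { tree    = query φ (asLocal (piece
        (atom distance (λ { _ (here refl) → i<k ; _ (there (here refl)) → j<k }) e≤) F∋ ≤n))
    ; correct = λ A v → if-true-false (⟦ φ ⟧ A v)
    }
  -- Here the quantifier is guarded already: once the sentences in its scope have been asked, a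
  -- single local question remains.
  generator-normal {n = n} {F} (near {i} {e} {ψ} c i<k e≤) F∋ ≤n = record
    { tree    = preliminaries >>= λ t → query (nearby i k e (formula t)) (piece-of t)
    ; correct = λ A v → trans (run->>=-query (λ t → nearby i k e (formula t)) piece-of preliminaries (oracle A v))
        (trans (⟦quantify⟧ some k (dist≤ i k e ∧′ formula (chosen A v)) A v)
          (trans (cong (accepts (some {M = M})) (count-cong (Structure.elements A) (λ z →
            cong (Structure.within A e ((v [ k ↦ z ]) i) ((v [ k ↦ z ]) k) ∧_) (same A v z))))
            (sym (⟦quantify⟧ some k (dist≤ i k e ∧′ ψ) A v))))
    }
    where
    F∋′ : ∀ {x} → x ∈ i ∷ k ∷ free ψ → x ≢ k → F x
    F∋′ = λ x∈ x≢k → F∋ (free-quantify⁺ some (dist≤ i k e ∧′ ψ) x∈ x≢k)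
    open Matrix c n F ≤n (λ x∈ → F∋′ (there (there x∈)))
    piece-of : ∀ t → Question d n F (suc q) k (nearby i k e (formula t))
    piece-of t = asLocal (nearby-piece i<k (F∋′ (here refl) (<⇒≢ i<k)) (piece-formula t) e≤ (keeps t) (ranks t))
  generator-normal (exists c)      F∋ ≤n = quantified-normal some c F∋ ≤n
  generator-normal (modulo m∈ i c) F∋ ≤n = quantified-normal (mod m∈ i) c F∋ ≤n

  combination-normal : ∀ {φ : Formula σ M} {n F} → BooleanCombination (Generator q k d (FO+MOD⁺ q (suc k) d)) φ →
                       (∀ {x} → x ∈ free φ → F x) → qr φ ≤ n → Normalised d n F (suc q) k φ
  combination-normal (base g) F∋ ≤n = generator-normal g F∋ ≤n
  combination-normal (neg b)  F∋ ≤n = record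
    { tree    = tree nb >>= λ x → leaf (not x)
    ; correct = λ A v → trans (run->>= (tree nb) _ (oracle A v)) (cong not (correct nb A v))
    }
    where nb = combination-normal b F∋ ≤n
  combination-normal (conj {φ} {ψ} b c) F∋ ≤n = record
    { tree    = tree nb >>= λ x → tree nc >>= λ y → leaf (x ∧ y)
    ; correct = λ A v → trans (run->>= (tree nb) _ (oracle A v)) (trans (run->>= (tree nc) _ (oracle A v))
        (cong₂ _∧_ (correct nb A v) (correct nc A v)))
    }
    where
    nb = combination-normal b (F∋ ∘ ∈-++⁺ˡ) (≤-trans (m≤m⊔n (qr φ) (qr ψ)) ≤n)
    nc = combination-normal c (F∋ ∘ ∈-++⁺ʳ (free φ)) (≤-trans (m≤n⊔m (qr φ) (qr ψ)) ≤n)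
  combination-normal (disj {φ} {ψ} b c) F∋ ≤n = record
    { tree    = tree nb >>= λ x → tree nc >>= λ y → leaf (x ∨ y)
    ; correct = λ A v → trans (run->>= (tree nb) _ (oracle A v)) (trans (run->>= (tree nc) _ (oracle A v))
        (cong₂ _∨_ (correct nb A v) (correct nc A v)))
    }
    where
    nb = combination-normal b (F∋ ∘ ∈-++⁺ˡ) (≤-trans (m≤m⊔n (qr φ) (qr ψ)) ≤n)
    nc = combination-normal c (F∋ ∘ ∈-++⁺ʳ (free φ)) (≤-trans (m≤n⊔m (qr φ) (qr ψ)) ≤n)

normal : ∀ q k → Normaliser σ M d q k
normal zero k {φ} (q≡0 , below , md≤) F∋ ≤n = record
  { tree    = query φ (asLocal (piece (quantifier-free-local (view φ) q≡0 below md≤) F∋ ≤n))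
  ; correct = λ A v → if-true-false (⟦ φ ⟧ A v)
  }
normal (suc q) k (_ , b) F∋ ≤n = Step.combination-normal (normal q (suc k)) b F∋ ≤n

-- Membership in the classes is decidable

below? : ∀ k (φ : Formula σ M) → Dec (FreeBelow k φ)
below? k φ = map′ (λ all x x∈ → All.lookup all x∈) (λ below → All.tabulate (below _)) (All.all? (ℕ._<? k) (free φ))

combination? : {P : Formula σ M → Set} → (∀ φ → Dec (P φ)) → ∀ φ → Dec (BooleanCombination P φ)
combination? P? true′            = map′ base (λ { (base p) → p }) (P? true′)
combination? P? false′           = map′ base (λ { (base p) → p }) (P? false′)
combination? P? (x ≈′ y)         = map′ base (λ { (base p) → p }) (P? (x ≈′ y))
combination? P? (rel R xs)       = map′ base (λ { (base p) → p }) (P? (rel R xs))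
combination? P? (dist≤ x y e)    = map′ base (λ { (base p) → p }) (P? (dist≤ x y e))
combination? P? (¬′ φ)           = map′ [ base , neg ]′ (λ { (base p) → inj₁ p ; (neg b) → inj₂ b })
  (P? (¬′ φ) ⊎-dec combination? P? φ)
combination? P? (φ ∧′ ψ)         = map′ [ base , (λ (b , c) → conj b c) ]′
  (λ { (base p) → inj₁ p ; (conj b c) → inj₂ (b , c) })
  (P? (φ ∧′ ψ) ⊎-dec (combination? P? φ ×-dec combination? P? ψ))
combination? P? (φ ∨′ ψ)         = map′ [ base , (λ (b , c) → disj b c) ]′
  (λ { (base p) → inj₁ p ; (disj b c) → inj₂ (b , c) })
  (P? (φ ∨′ ψ) ⊎-dec (combination? P? φ ×-dec combination? P? ψ))
combination? P? (∃′ x φ)         = map′ base (λ { (base p) → p }) (P? (∃′ x φ))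
combination? P? (∃mod m∈ i x φ)  = map′ base (λ { (base p) → p }) (P? (∃mod m∈ i x φ))

module _ {σ : Signature} {M : List ℕ} (q k d : ℕ) {C : Formula σ M → Set} (C? : ∀ φ → Dec (C φ)) where

  private
    -- Detaches the shape of the matrix in `near` from the quantifier in front, so that each is
    -- recognised by its own case distinction.
    data NearBody : Formula σ M → Set where
      nearBody : ∀ {i e ψ} → C ψ → i < k → e + r₁ q (suc k) d ≤ r₁ (suc q) k d → NearBody (dist≤ i k e ∧′ ψ)

    nearConjunction? : ∀ χ ψ → Dec (NearBody (χ ∧′ ψ))
    nearConjunction? (dist≤ i x e) ψ with x ℕ.≟ k
    ... | yes refl = map′ (λ (c , i<k , e≤) → nearBody c i<k e≤) (λ { (nearBody c i<k e≤) → c , i<k , e≤ })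
      (C? ψ ×-dec (i ℕ.<? k) ×-dec (e + r₁ q (suc k) d ℕ.≤? r₁ (suc q) k d))
    ... | no x≢k   = no λ { (nearBody _ _ _) → x≢k refl }
    nearConjunction? true′          ψ = no λ ()
    nearConjunction? false′         ψ = no λ ()
    nearConjunction? (_ ≈′ _)       ψ = no λ ()
    nearConjunction? (rel _ _)      ψ = no λ ()
    nearConjunction? (¬′ _)         ψ = no λ ()
    nearConjunction? (_ ∧′ _)       ψ = no λ ()
    nearConjunction? (_ ∨′ _)       ψ = no λ ()
    nearConjunction? (∃′ _ _)       ψ = no λ ()
    nearConjunction? (∃mod _ _ _ _) ψ = no λ ()

    nearBody? : ∀ φ → Dec (NearBody φ)
    nearBody? (χ ∧′ ψ)       = nearConjunction? χ ψ
    nearBody? true′          = no λ ()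
    nearBody? false′         = no λ ()
    nearBody? (_ ≈′ _)       = no λ ()
    nearBody? (rel _ _)      = no λ ()
    nearBody? (dist≤ _ _ _)  = no λ ()
    nearBody? (¬′ _)         = no λ ()
    nearBody? (_ ∨′ _)       = no λ ()
    nearBody? (∃′ _ _)       = no λ ()
    nearBody? (∃mod _ _ _ _) = no λ ()

    lower? : ∀ φ → Dec (C φ × FreeBelow k φ)
    lower? φ = C? φ ×-dec below? k φ

    quantified? : ∀ x ψ → Dec (x ≡ k × (C ψ ⊎ NearBody ψ))
    quantified? x ψ = (x ℕ.≟ k) ×-dec (C? ψ ⊎-dec nearBody? ψ)

    from∃ : ∀ {x ψ} → x ≡ k × (C ψ ⊎ NearBody ψ) → Generator q k d C (∃′ x ψ)
    from∃ (refl , inj₁ c)                     = exists c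
    from∃ (refl , inj₂ (nearBody c i<k e≤)) = near c i<k e≤

    to∃ : ∀ {x ψ} → Generator q k d C (∃′ x ψ) → (C (∃′ x ψ) × FreeBelow k (∃′ x ψ)) ⊎ (x ≡ k × (C ψ ⊎ NearBody ψ))
    to∃ (lower c b)     = inj₁ (c , b)
    to∃ (near c i<k e≤) = inj₂ (refl , inj₂ (nearBody c i<k e≤))
    to∃ (exists c)      = inj₂ (refl , inj₁ c)

  generator? : ∀ φ → Dec (Generator q k d C φ)
  generator? φ@true′           = map′ (λ (c , b) → lower c b) (λ { (lower c b) → c , b }) (lower? φ)
  generator? φ@false′          = map′ (λ (c , b) → lower c b) (λ { (lower c b) → c , b }) (lower? φ)
  generator? φ@(_ ≈′ _)        = map′ (λ (c , b) → lower c b) (λ { (lower c b) → c , b }) (lower? φ)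
  generator? φ@(rel _ _)       = map′ (λ (c , b) → lower c b) (λ { (lower c b) → c , b }) (lower? φ)
  generator? φ@(dist≤ i j e)   = map′
    [ (λ (c , b) → lower c b) , (λ (i<k , j<k , e≤) → distance i<k j<k e≤) ]′
    (λ { (lower c b) → inj₁ (c , b) ; (distance i<k j<k e≤) → inj₂ (i<k , j<k , e≤) })
    (lower? φ ⊎-dec ((i ℕ.<? k) ×-dec (j ℕ.<? k) ×-dec (e ℕ.≤? r₁ (suc q) k d)))
  generator? φ@(¬′ _)          = map′ (λ (c , b) → lower c b) (λ { (lower c b) → c , b }) (lower? φ)
  generator? φ@(_ ∧′ _)        = map′ (λ (c , b) → lower c b) (λ { (lower c b) → c , b }) (lower? φ)
  generator? φ@(_ ∨′ _)        = map′ (λ (c , b) → lower c b) (λ { (lower c b) → c , b }) (lower? φ)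
  generator? φ@(∃′ x ψ)        = map′ [ (λ (c , b) → lower c b) , from∃ ]′ to∃ (lower? φ ⊎-dec quantified? x ψ)
  generator? φ@(∃mod m∈ i x ψ) = map′
    [ (λ (c , b) → lower c b) , (λ { (refl , c) → modulo m∈ i c }) ]′
    (λ { (lower c b) → inj₁ (c , b) ; (modulo _ _ c) → inj₂ (refl , c) })
    (lower? φ ⊎-dec ((x ℕ.≟ k) ×-dec C? ψ))

class? : ∀ q k d (φ : Formula σ M) → Dec (FO+MOD⁺ q k d φ)
class? zero    k d φ = (qr φ ℕ.≟ 0) ×-dec below? k φ ×-dec (md φ ℕ.≤? d)
class? (suc q) k d φ = below? k φ ×-dec combination? (generator? q k d (class? q (suc k) d)) φ

-- From decision trees to Gaifman normal form

constituent : Question {σ} {M} d n F q k ψ → Constituent q k d ψ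
constituent (asLocal p) = localFormula (local-class (local p)) (_ , isLocal (local p))
constituent (asSentence (scattered ℓ r {β} b 1≤ℓ _ r̃≤r _)) = basicLocal (record
  { ℓ          = ℓ
  ; r          = r
  ; r̃         = radius
  ; body       = β
  ; body-class = class
  ; body-free  = only
  ; body-local = isLocal isLoc
  ; r̃≤r       = r̃≤r
  ; 1≤ℓ        = 1≤ℓ
  ; ys         = fresh β ℓ
  ; ys-length  = length-applyUpTo (λ j → suc (sum (bound β)) + j) ℓ
  ; ys-unique  = fresh-unique β ℓ
  ; ys-fresh   = All.tabulate (fresh-∉ β ℓ)
  ; shape      = refl
  })
  where open Body b
constituent (asSentence (counted m∈ i {β} b)) = localModulo (record
  { r̃         = radius
  ; body       = β
  ; y          = 0
  ; body-class = class
  ; body-free  = λ x x∈ → n≤0⇒n≡0 (≤-pred (only x x∈))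
  ; body-local = isLocal isLoc
  ; m          = _
  ; m∈M        = m∈
  ; i          = i
  ; shape      = refl
  })
  where open Body b

constantTrue : Question {σ} {M} d n F q k true′
constantTrue = asLocal (piece true′ (λ ()) z≤n)

constantFalse : Question {σ} {M} d n F q k false′
constantFalse = asLocal (piece false′ (λ ()) z≤n)

gaifman : (t : NormalForm σ M d n F q k) → GaifmanNormalForm q k d (formula t)
gaifman {n = n} {F} (leaf true)   = base (constituent (constantTrue {n = n} {F}))
gaifman {n = n} {F} (leaf false)  = base (constituent (constantFalse {n = n} {F}))
gaifman             (ask ψ p t f) =
  disj (conj (base (constituent p)) (gaifman t)) (conj (neg (base (constituent p))) (gaifman f))

-- The bounds on ranks, radii, width and distance all concern single constituents, so each of them
-- reduces to a property of questions.
every-constituent : ∀ {a} {Q : ∀ {φ : Formula σ M} → Constituent q k d φ → Set a} →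
                    (∀ {ψ} (p : Question d n F q k ψ) → Q (constituent p)) →
                    (t : NormalForm σ M d n F q k) → Every Q (gaifman t)
every-constituent h (leaf true)   = h constantTrue
every-constituent h (leaf false)  = h constantFalse
every-constituent h (ask ψ p t f) = (h p , every-constituent h t) , h p , every-constituent h f

question-free : Question {σ} {M} d n F q k ψ → ∀ {x} → x ∈ free ψ → F x
question-free (asLocal p)    x∈ = free⊆ p x∈
question-free (asSentence s) x∈ = ⊥-elim (sentence-closed s x∈)

-- The trivial questions x = x make every variable occur.
mention : ∀ {xs} → All (λ x → F x × x < k) xs → NormalForm σ M d n F q k → NormalForm σ M d n F q k
mention []                         t = t
mention (_∷_ {x} (Fx , x<k) rest) t = ask (x ≈′ x)
  (asLocal (piece (atom equality (λ { _ (here refl) → x<k ; _ (there (here refl)) → x<k }) z≤n)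
                  (λ { (here refl) → Fx ; (there (here refl)) → Fx }) z≤n))
  (mention rest t) (mention rest t)

run-mention : ∀ {xs} (good : All (λ x → F x × x < k) xs) (t : NormalForm σ M d n F q k) ρ →
              run (mention good t) ρ ≡ run t ρ
run-mention []                     t ρ = refl
run-mention (_∷_ {x} good rest) t ρ = trans (if-eta (ρ (x ≈′ x))) (run-mention rest t ρ)

mentioned : ∀ {xs} (good : All (λ x → F x × x < k) xs) (t : NormalForm σ M d n F q k) {x} →
            x ∈ xs → x ∈ free (formula (mention good t))
mentioned (_ ∷ _)    t (here refl) = here refl
mentioned (_ ∷ rest) t (there x∈)  = there (there (∈-++⁺ˡ (mentioned rest t x∈)))

below-class : ∀ q → FO+MOD⁺ q k d φ → FreeBelow k φ
below-class zero    (_ , below , _) = below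
below-class (suc q) (below , _)     = below

Result : (q k d : ℕ) (φ φ′ : Formula σ M) → Set₁
Result q k d φ φ′ =
  Equivalent φ φ′ ×
  Σ[ nf ∈ GaifmanNormalForm q k d φ′ ]
    ((∀ x → x ∈ free φ′ ⇔ x ∈ free φ) ×
     (OuterRank≤ (qr φ) nf × InnerRank< (qr φ) nf) ×
     (OuterRadius≤ (r₁ q k d) nf × InnerRadius≤ (r₁ (pred q) (suc k) d) nf) ×
     (Width≤ (k + q) nf × InnerDistance≤ (r₁ q k d + 2 * r₁ (pred q) (suc k) d) nf))

module _ {σ : Signature} {M : List ℕ} {q k d : ℕ} {φ : Formula σ M} (c : FO+MOD⁺ q k d φ) where

  private
    nφ : Normalised d (qr φ) (_∈ free φ) q k φ
    nφ = normal q k c id ≤-refl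

    good : All (λ x → x ∈ free φ × x < k) (free φ)
    good = All.tabulate λ x∈ → x∈ , below-class q c _ x∈

  complete-tree : NormalForm σ M d (qr φ) (_∈ free φ) q k
  complete-tree = mention good (Normalised.tree nφ)

  complete-result : Result q k d φ (formula complete-tree)
  complete-result =
    (λ A v → sym (trans (⟦formula⟧ complete-tree A v)
      (trans (run-mention good (Normalised.tree nφ) (oracle A v)) (Normalised.correct nφ A v)))) ,
    gaifman complete-tree ,
    (λ x → mk⇔ (formula-free complete-tree question-free) (mentioned good (Normalised.tree nφ))) ,
    (every-constituent (λ where
       (asLocal p)                                → qr≤ p
       (asSentence (scattered _ _ b _ ℓ≤ _ 2r≤)) → _
       (asSentence (counted _ _ b))               → _) complete-tree ,
     every-constituent (λ where
       (asLocal p)                                → _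
       (asSentence (scattered _ _ b _ ℓ≤ _ 2r≤)) → Body.qr< b
       (asSentence (counted _ _ b))               → Body.qr< b) complete-tree) ,
    (every-constituent (λ where
       (asLocal p)                                → isLocal (local p)
       (asSentence (scattered _ _ b _ ℓ≤ _ 2r≤)) → _
       (asSentence (counted _ _ b))               → _) complete-tree ,
     every-constituent (λ where
       (asLocal p)                                → _
       (asSentence (scattered _ _ b _ ℓ≤ _ 2r≤)) → Body.radius≤ b
       (asSentence (counted _ _ b))               → Body.radius≤ b) complete-tree) ,
    (every-constituent (λ where
       (asLocal p)                                → _
       (asSentence (scattered _ _ b _ ℓ≤ _ 2r≤)) → ℓ≤
       (asSentence (counted _ _ b))               → _) complete-tree ,
     every-constituent (λ where
       (asLocal p)                                → _
       (asSentence (scattered _ _ b _ ℓ≤ _ 2r≤)) → 2r≤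
       (asSentence (counted _ _ b))               → _) complete-tree)

-- A φ′ computed from φ, q, k and d cannot depend on a given proof of membership, so the proof comes
-- from a decision procedure. Outside the class φ itself is a dummy value.
normalForm : {q k d : ℕ} {φ : Formula σ M} → Dec (FO+MOD⁺ q k d φ) → Formula σ M
normalForm         (yes c) = formula (complete-tree c)
normalForm {φ = φ} (no _)  = φ

normalForm-correct : {q k d : ℕ} {φ : Formula σ M} (c? : Dec (FO+MOD⁺ q k d φ)) → FO+MOD⁺ q k d φ →
                     Result q k d φ (normalForm c?)
normalForm-correct (yes c) _ = complete-result c
normalForm-correct (no ¬c) c = contradiction c ¬c

corollary17 : (σ : Signature) (M : List ℕ) → M ≢ [] → All (2 ≤_) M →
    Σ[ normalise ∈ (Formula σ M → ℕ → ℕ → ℕ → Formula σ M) ]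
    ((q k d : ℕ) (φ : Formula σ M) → FO+MOD⁺ q k d φ →
    let φ′ = normalise φ q k d in
    Equivalent φ φ′ ×
    Σ[ nf ∈ GaifmanNormalForm q k d φ′ ]
    ((∀ x → x ∈ free φ′ ⇔ x ∈ free φ) ×
    (OuterRank≤ (qr φ) nf × InnerRank< (qr φ) nf) ×
    (OuterRadius≤ (r₁ q k d) nf × InnerRadius≤ (r₁ (pred q) (suc k) d) nf) ×
    (Width≤ (k + q) nf × InnerDistance≤ (r₁ q k d + 2 * r₁ (pred q) (suc k) d) nf)))
corollary17 σ M _ _ =
  (λ φ q k d → normalForm (class? q k d φ)) , λ q k d φ → normalForm-correct (class? q k d φ)
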